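{- The problem IN-MINTRAP$(f,\mathbf{z})$ — given a Boolean network $f:\mathbb{B}^n\to\mathbb{B}^n$ all of whose local functions are unate and are specified as propositional formulas (with the unateness orderings given), and a configuration $\mathbf{z}\in\mathbb{B}^n$, decide whether $\mathbf{z}$ is a vertex of some minimal trap space of $f$ — is coNP-hard.
   Context: $\mathbb{B}=\{0,1\}$. A Boolean network of dimension $n$ is a map $f:\mathbb{B}^n\to\mathbb{B}^n$ with local functions $f_i:\mathbb{B}^n\to\mathbb{B}$. A Boolean function $\phi:\mathbb{B}^n\to\mathbb{B}$ is unate if there is $\preceq\in\{\le,\ge\}^n$ such that for all $\mathbf{x},\mathbf{y}\in\mathbb{B}^n$, if $\mathbf{x}_j\preceq_j\mathbf{y}_j$ for all $j$ then $\phi(\mathbf{x})\le\phi(\mathbf{y})$. A propositional formula is built from variables and $\wedge,\vee,\neg$. A sub-hypercube is a vector $\mathbf{h}\in\{0,1,*\}^n$ with vertex set $v(\mathbf{h})=\{\mathbf{x}\in\mathbb{B}^n:\forall i,\ \mathbf{h}_i\neq *\Rightarrow\mathbf{x}_i=\mathbf{h}_i\}$. A trap space of $f$ is a sub-hypercube $\mathbf{h}$ with $f(\mathbf{x})\in v(\mathbf{h})$ for all $\mathbf{x}\in v(\mathbf{h})$; it is minimal if there is no trap space $\mathbf{h}'$ with $v(\mathbf{h}')\subsetneq v(\mathbf{h})$. Hardness is with respect to polynomial-time many-one reductions. -}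

module Defs where

open import Data.Bool using (Bool; true; false; _∧_; _∨_; not; _≤_)
open import Data.Nat using (ℕ; zero; suc; _^_) renaming (_+_ to _+ℕ_; _≤_ to _≤ℕ_)
open import Data.Fin using (Fin; toℕ)
open import Data.Vec using (Vec; lookup; map; tabulate)
open import Data.List using (List; []; _∷_; _++_; length; replicate; concatMap; takeWhile)
open import Data.Maybe using (Maybe; just; nothing)
open import Data.Product using (Σ; ∃; _×_; _,_)
open import Data.Empty using (⊥)
open import Relation.Nullary using (¬_)
open import Relation.Binary.PropositionalEquality using (_≡_)
open import Function.Bundles using (_⇔_)

Config : ℕ → Set
Config n = Vec Bool n

BN : ℕ → Set
BN n = Config n → Config n

data Formula (n : ℕ) : Set where
  var  : Fin n → Formula n
  neg  : Formula n → Formula n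
  conj : Formula n → Formula n → Formula n
  disj : Formula n → Formula n → Formula n

eval : ∀ {n} → Formula n → Config n → Bool
eval (var i)    x = lookup x i
eval (neg φ)    x = not (eval φ x)
eval (conj φ ψ) x = eval φ x ∧ eval ψ x
eval (disj φ ψ) x = eval φ x ∨ eval ψ x

-- An ordering ⪯ ∈ {≤,≥}ⁿ : entry true means ≤, false means ≥
Ordering : ℕ → Set
Ordering n = Vec Bool n

relOf : Bool → Bool → Bool → Set
relOf true  a b = a ≤ b
relOf false a b = b ≤ a

UnateWrt : ∀ {n} → Ordering n → (Config n → Bool) → Set
UnateWrt {n} o φ =
  ∀ (x y : Config n) → (∀ j → relOf (lookup o j) (lookup x j) (lookup y j)) → φ x ≤ φ y

-- Sub-hypercubes: nothing stands for *
SubCube : ℕ → Set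
SubCube n = Vec (Maybe Bool) n

_∈v_ : ∀ {n} → Config n → SubCube n → Set
_∈v_ {n} x h = ∀ (i : Fin n) (b : Bool) → lookup h i ≡ just b → lookup x i ≡ b

IsTrapSpace : ∀ {n} → BN n → SubCube n → Set
IsTrapSpace {n} f h = ∀ (x : Config n) → x ∈v h → f x ∈v h

_⊊v_ : ∀ {n} → SubCube n → SubCube n → Set
_⊊v_ {n} h' h = (∀ (x : Config n) → x ∈v h' → x ∈v h) × (∃ λ (x : Config n) → x ∈v h × ¬ (x ∈v h'))

IsMinTrapSpace : ∀ {n} → BN n → SubCube n → Set
IsMinTrapSpace {n} f h =
  IsTrapSpace f h × ¬ (∃ λ (h' : SubCube n) → IsTrapSpace f h' × h' ⊊v h)

record Instance : Set where
  constructor mkInstance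
  field
    dim       : ℕ
    formulas  : Vec (Formula dim) dim
    orderings : Vec (Ordering dim) dim
    point     : Config dim

network : (I : Instance) → BN (Instance.dim I)
network I x = map (λ φ → eval φ x) (Instance.formulas I)

Promise : Instance → Set
Promise I = ∀ i → UnateWrt (lookup (Instance.orderings I) i) (eval (lookup (Instance.formulas I) i))

InMinTrap : Instance → Set
InMinTrap I = ∃ λ h → IsMinTrapSpace (network I) h × Instance.point I ∈v h

-- Prefix-free bit encodings
encℕ : ℕ → List Bool
encℕ k = replicate k true ++ (false ∷ [])

encFormula : ∀ {n} → Formula n → List Bool
encFormula (var i)    = false ∷ false ∷ encℕ (toℕ i)
encFormula (neg φ)    = false ∷ true ∷ encFormula φ
encFormula (conj φ ψ) = true ∷ false ∷ encFormula φ ++ encFormula ψ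
encFormula (disj φ ψ) = true ∷ true ∷ encFormula φ ++ encFormula ψ

encBits : ∀ {n} → Vec Bool n → List Bool
encBits v = Data.Vec.toList v

encVecs : ∀ {A : Set} {m} → (A → List Bool) → Vec A m → List Bool
encVecs e Vec.[] = []
encVecs e (a Vec.∷ as) = e a ++ encVecs e as

encInstance : Instance → List Bool
encInstance (mkInstance n fs os z) =
  encℕ n ++ encVecs encFormula fs ++ encVecs encBits os ++ encBits z

data Sym : Set where
  blank : Sym
  bit   : Bool → Sym

data Move : Set where
  left right stay : Move

-- Single-tape Turing machine over tape alphabet {blank,0,1}.
-- States Fin (suc Q), start state zero; δ returning nothing = halt.
record TM : Set where
  field
    Q : ℕ
    δ : Fin (suc Q) → Sym → Maybe (Fin (suc Q) × Sym × Move)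

record Tape : Set where
  constructor tape
  field
    lefts  : List Sym   -- cells to the left of the head, nearest first
    head   : Sym
    rights : List Sym   -- cells to the right of the head, nearest first

moveTape : Move → Tape → Tape
moveTape stay  t = t
moveTape left  (tape []       h rs) = tape [] blank (h ∷ rs)
moveTape left  (tape (l ∷ ls) h rs) = tape ls l (h ∷ rs)
moveTape right (tape ls h [])       = tape (h ∷ ls) blank []
moveTape right (tape ls h (r ∷ rs)) = tape (h ∷ ls) r rs

record MConf (M : TM) : Set where
  constructor mconf
  field
    state : Fin (suc (TM.Q M))
    tp    : Tape

step : (M : TM) → MConf M → Maybe (MConf M)
step M (mconf q (tape ls h rs)) with TM.δ M q h
... | nothing = nothing
... | just (q' , s , mv) = just (mconf q' (moveTape mv (tape ls s rs)))

run : (M : TM) → ℕ → MConf M → MConf M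
run M zero c = c
run M (suc t) c with step M c
... | nothing = c
... | just c' = run M t c'

Halted : (M : TM) → MConf M → Set
Halted M c = step M c ≡ nothing

initConf : (M : TM) → List Bool → MConf M
initConf M []       = mconf Fin.zero (tape [] blank [])
initConf M (b ∷ bs) = mconf Fin.zero (tape [] (bit b) (Data.List.map bit bs))

readBits : List Sym → List Bool
readBits []            = []
readBits (blank ∷ _)   = []
readBits (bit b ∷ ss)  = b ∷ readBits ss

output : (M : TM) → MConf M → List Bool
output M (mconf _ (tape _ h rs)) = readBits (h ∷ rs)

poly : ℕ → ℕ → ℕ
poly c m = m ^ c +ℕ c

PolyTime : (List Bool → List Bool) → Set
PolyTime F = Σ TM λ M → Σ ℕ λ c → ∀ x →
  let cf = run M (poly c (length x)) (initConf M x) in Halted M cf × output M cf ≡ F x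

Language : Set₁
Language = List Bool → Set

pair : List Bool → List Bool → List Bool
pair x w = concatMap (λ b → b ∷ b ∷ []) x ++ (true ∷ false ∷ []) ++ w

InNP : Language → Set
InNP L = Σ (List Bool → List Bool) λ V → PolyTime V × Σ ℕ λ c →
  ∀ x → L x ⇔ (∃ λ w → length w ≤ℕ poly c (length x) × V (pair x w) ≡ true ∷ [])

InCoNP : Language → Set₁
InCoNP L = Σ Language λ L' → InNP L' × (∀ x → L x ⇔ (¬ L' x))

IN-MINTRAP-coNP-hard : Set₁
IN-MINTRAP-coNP-hard =
  ∀ (L : Language) → InCoNP L →
    Σ (List Bool → List Bool) λ R → PolyTime R ×
    Σ (List Bool → Instance) λ r → ∀ x →
      encInstance (r x) ≡ R x × Promise (r x) × (L x ⇔ InMinTrap (r x))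

-- Let L' be an NP language with verifier V.  Write the run of V on (x, w) as one long sequence of cells, each a
-- function of the cell before it and of three cells of the previous row, with w guessed in the first row, and
-- encode every cell one-hot.  The network has a component for each of these bits and a reset component b, all with
-- local functions of the form ¬ (b ∨ ψ) with ψ positive; b itself has ψ = "the last cell is accepting".  Every local
-- function is then antitone, so all orderings are ≥, and the image of the zero configuration is the all-one one, so
-- the only trap space that contains it is the full cube.  A fixed point encoding an accepting run is a smaller trap
-- space.  Conversely, in a trap space that is not full some component is frozen; this forces b to be frozen at 0,
-- and then the cells of a run lie in the trap space one after the other (in the guess region the letters frozen at
-- 1, if any, determine w), so that b can only stay at 0 if the run accepts.  Hence the zero configuration lies in a
-- minimal trap space iff x is not in L'.
--
-- The instance is printed by a program with bounded loops over unary counters.  Such programs run in polynomial time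
-- on a Turing machine that keeps the counters as tracks of a tape divided into columns of bits, to the left of its
-- start, and the output to the right.

module Submission where

open import Defs
open import Data.Bool using (Bool; true; false; _∧_; _∨_; not; if_then_else_)
open import Data.Bool.Properties using (∨-zeroʳ)
open import Data.Nat using (ℕ; zero; suc; _+_; _*_; _∸_; _^_; _/_; _%_; _≤_; _<_; z≤n; s≤s; _<ᵇ_; _≡ᵇ_; _<?_; _≟_; _⊔_)
open import Data.Nat.DivMod
  using (m≡m%n+[m/n]*n; m%n<n; m<n*o⇒m/o<n; m<n⇒m%n≡m; [m+kn]%n≡m%n; +-distrib-/; m*n/n≡m; m<n⇒m/n≡0; m*n%n≡0)
open import Data.Nat.Induction using (<-rec)
open import Data.Nat.Properties
  using (+-comm; +-assoc; +-suc; +-identityʳ; *-assoc; *-distribʳ-+; *-identityʳ; suc-injective;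
         ≤-refl; ≤-reflexive; ≤-trans; ≤-pred; ≤-total; <-trans; ≤-<-trans; <-≤-trans; <-irrefl; <⇒≤; ≮⇒≥; n≮0; ≤∧≢⇒<;
         n≤1+n; n<1+n; m≤m+n; m≤n+m; m≤n⇒m≤1+n; m≤n⇒m<n∨m≡n; m⊔n≤o⇒m≤o; m⊔n≤o⇒n≤o;
         +-mono-≤; +-monoˡ-≤; +-monoʳ-≤; +-monoʳ-<; +-cancelʳ-≤; +-cancelʳ-<; *-mono-≤; *-monoˡ-≤; *-monoʳ-≤; ^-monoˡ-≤; ^-monoʳ-≤;
         m+n∸m≡n; m+[n∸m]≡n; m∸n+n≡m; ^-distribˡ-+-*; ^-*-assoc; m^n>0; module ≤-Reasoning)
open import Data.Nat.Solver using (module +-*-Solver)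
open import Data.Fin using (Fin; zero; suc; toℕ; fromℕ<; inject₁; #_)
open import Data.Fin.Properties using (toℕ-fromℕ<; toℕ<n; toℕ-injective; toℕ-inject₁)
open import Data.Vec using (Vec; []; _∷_; lookup; tabulate; toList; _[_]≔_)
open import Data.Vec.Properties using (lookup∘tabulate; lookup∘update; lookup∘update′; lookup-replicate; lookup-map)
open import Data.List using (List; []; _∷_; _++_; length; map; concatMap; replicate; reverse; _ʳ++_; drop; allFin; foldr)
open import Data.List.Properties
  using (++-assoc; ++-identityʳ; length-++; length-map; map-++; unfold-reverse; reverse-++; reverse-involutive;
         length-replicate; length-reverse; concatMap-++)
open import Data.List.Membership.Propositional using (_∈_)
open import Data.List.Membership.Propositional.Properties using (∈-map⁺; ∈-++⁺ˡ; ∈-++⁺ʳ; ∈-allFin)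
open import Data.List.Relation.Unary.Any using (here; there; index)
open import Data.List.Relation.Unary.Any.Properties using (lookup-index)
open import Data.Maybe using (Maybe; just; nothing; fromMaybe)
open import Data.Maybe.Properties using (just-injective)
open import Data.Product using (Σ; ∃; _×_; _,_; proj₁; proj₂)
open import Data.Sum using (_⊎_; inj₁; inj₂)
open import Data.Empty using (⊥; ⊥-elim)
open import Data.Unit using (⊤; tt)
open import Relation.Nullary using (¬_; yes; no; contradiction)
open import Relation.Binary.PropositionalEquality using (_≡_; _≢_; refl; sym; trans; cong; cong₂; subst; subst₂)
open import Function using (_∘_; case_of_)
open import Function.Bundles using (mk⇔; Equivalence)

open +-*-Solver using (solve; _:+_; _:*_; _:=_; con)

-- Tapes up to trailing blanks

-- Negated positive formulas suffice because cells are one-hot and determined by their windows: bit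
-- a of a cell is 0 as soon as some window with a value other than a occurs, a positive condition on
-- earlier bits. The invariant for a trap space is that each frozen bit has its value in the run,
-- not that the bits of the run are frozen: free bits can be set as in the run, and computed bits
-- read only earlier cells and b, which permits induction. Guess cells break this order, since the
-- letters of one cell exclude each other; a letter has to be chosen before its bits can be checked,
-- and two letters frozen at 1 together must be impossible. Acceptance may occur in any row, whereas
-- b reads one fixed cell; the dependence on the preceding cell carries the mark `done` to the end.
-- Variable numbers are encoded in unary, so a number that is linear in a loop counter is printed by
-- concatenating blocks; this is why the cells form one sequence, with a distance D between rows
-- that is the same at every position.

hd : List Sym → Sym
hd []      = blank
hd (x ∷ _) = x

tl : List Sym → List Sym
tl []       = []
tl (_ ∷ xs) = xs

nth : List Sym → ℕ → Sym
nth []       _       = blank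
nth (x ∷ _)  zero    = x
nth (_ ∷ xs) (suc i) = nth xs i

infix 4 _≈_ _≋_

_≈_ : List Sym → List Sym → Set
xs ≈ ys = ∀ i → nth xs i ≡ nth ys i

hd-nth : ∀ xs → nth xs 0 ≡ hd xs
hd-nth []      = refl
hd-nth (_ ∷ _) = refl

tl-nth : ∀ xs i → nth (tl xs) i ≡ nth xs (suc i)
tl-nth []      _ = refl
tl-nth (_ ∷ _) _ = refl

hd-≈ : ∀ {xs ys} → xs ≈ ys → hd xs ≡ hd ys
hd-≈ {xs} {ys} e = trans (sym (hd-nth xs)) (trans (e 0) (hd-nth ys))

tl-≈ : ∀ {xs ys} → xs ≈ ys → tl xs ≈ tl ys
tl-≈ {xs} {ys} e i = trans (tl-nth xs i) (trans (e (suc i)) (sym (tl-nth ys i)))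

∷-≈ : ∀ {x y xs ys} → x ≡ y → xs ≈ ys → x ∷ xs ≈ y ∷ ys
∷-≈ p e zero    = p
∷-≈ p e (suc i) = e i

hd∷tl-≈ : ∀ xs → hd xs ∷ tl xs ≈ xs
hd∷tl-≈ []       zero    = refl
hd∷tl-≈ []       (suc i) = refl
hd∷tl-≈ (x ∷ xs) i       = refl

++blank-≈ : ∀ xs → xs ++ blank ∷ [] ≈ xs
++blank-≈ []       zero    = refl
++blank-≈ []       (suc i) = refl
++blank-≈ (x ∷ xs) zero    = refl
++blank-≈ (x ∷ xs) (suc i) = ++blank-≈ xs i

record _≋_ (t u : Tape) : Set where
  constructor mk≋
  field
    ≋l : Tape.lefts t ≈ Tape.lefts u
    ≋h : Tape.head t ≡ Tape.head u
    ≋r : Tape.rights t ≈ Tape.rights u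

≋-refl : ∀ {t} → t ≋ t
≋-refl = mk≋ (λ _ → refl) refl (λ _ → refl)

≋-reflexive : ∀ {t u} → t ≡ u → t ≋ u
≋-reflexive refl = ≋-refl

≋-sym : ∀ {t u} → t ≋ u → u ≋ t
≋-sym (mk≋ a b c) = mk≋ (λ i → sym (a i)) (sym b) (λ i → sym (c i))

≋-trans : ∀ {t u v} → t ≋ u → u ≋ v → t ≋ v
≋-trans (mk≋ a b c) (mk≋ a' b' c') = mk≋ (λ i → trans (a i) (a' i)) (trans b b') (λ i → trans (c i) (c' i))

-- The scanned cell is the first entry of `X`, so that a head running off the listed cells needs no
-- case distinction. `atR` is the mirror image.
atL : List Sym → List Sym → Tape
atL X R = tape (tl X) (hd X) R

atR : List Sym → List Sym → Tape
atR L X = tape L (hd X) (tl X)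

write : Sym → Tape → Tape
write s t = tape (Tape.lefts t) s (Tape.rights t)

move-left : ∀ L a R → moveTape left (tape L a R) ≡ atL L (a ∷ R)
move-left []      a R = refl
move-left (_ ∷ _) a R = refl

move-right : ∀ L a R → moveTape right (tape L a R) ≡ atR (a ∷ L) R
move-right L a []      = refl
move-right L a (_ ∷ _) = refl

moveTape-≋ : ∀ mv {t u} → t ≋ u → moveTape mv t ≋ moveTape mv u
moveTape-≋ stay e = e
moveTape-≋ left {tape ls h rs} {tape ls' h' rs'} (mk≋ a b c)
  rewrite move-left ls h rs | move-left ls' h' rs' = mk≋ (tl-≈ {ls} {ls'} a) (hd-≈ {ls} {ls'} a) (∷-≈ b c)
moveTape-≋ right {tape ls h rs} {tape ls' h' rs'} (mk≋ a b c)
  rewrite move-right ls h rs | move-right ls' h' rs' = mk≋ (∷-≈ b a) (hd-≈ {rs} {rs'} c) (tl-≈ {rs} {rs'} c)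

write-≋ : ∀ s {t u} → t ≋ u → write s t ≋ write s u
write-≋ s (mk≋ a b c) = mk≋ a refl c

-- Finite types

Finite : Set → Set
Finite A = Σ (List A) λ xs → ∀ a → a ∈ xs

fin-⊤ : Finite ⊤
fin-⊤ = tt ∷ [] , λ _ → here refl

fin-Bool : Finite Bool
fin-Bool = true ∷ false ∷ [] , λ { true → here refl ; false → there (here refl) }

fin-map : ∀ {A B} (f : A → B) → (∀ b → ∃ λ a → f a ≡ b) → Finite A → Finite B
fin-map f sur (xs , c) = map f xs , λ b → subst (_∈ map f xs) (proj₂ (sur b)) (∈-map⁺ f (c (proj₁ (sur b))))

fin-⊎ : ∀ {A B} → Finite A → Finite B → Finite (A ⊎ B)
fin-⊎ (xs , c) (ys , d) = map inj₁ xs ++ map inj₂ ys , λ where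
  (inj₁ a) → ∈-++⁺ˡ (∈-map⁺ inj₁ (c a))
  (inj₂ b) → ∈-++⁺ʳ (map inj₁ xs) (∈-map⁺ inj₂ (d b))

∈-concatMap : ∀ {A B : Set} {f : A → List B} {xs : List A} {a b} → a ∈ xs → b ∈ f a → b ∈ concatMap f xs
∈-concatMap (here refl)                   q = ∈-++⁺ˡ q
∈-concatMap {f = f} {xs = x ∷ _} (there p) q = ∈-++⁺ʳ (f x) (∈-concatMap p q)

fin-Σ : ∀ {A} {B : A → Set} → Finite A → (∀ a → Finite (B a)) → Finite (Σ A B)
fin-Σ (xs , c) fb = concatMap (λ a → map (a ,_) (proj₁ (fb a))) xs
  , λ { (a , b) → ∈-concatMap (c a) (∈-map⁺ (a ,_) (proj₂ (fb a) b)) }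

fin-Maybe : ∀ {A} → Finite A → Finite (Maybe A)
fin-Maybe (xs , c) = nothing ∷ map just xs , λ where
  nothing  → here refl
  (just a) → there (∈-map⁺ just (c a))

fin-Fin : ∀ n → Finite (Fin n)
fin-Fin n = allFin n , ∈-allFin

fin-Vec : ∀ {A} → Finite A → ∀ n → Finite (Vec A n)
fin-Vec fa zero    = [] ∷ [] , λ { [] → here refl }
fin-Vec fa (suc n) = fin-map (λ { (a , v) → a ∷ v }) (λ { (a ∷ v) → (a , v) , refl }) (fin-Σ fa (λ _ → fin-Vec fa n))

-- Machines with exits

-- Unlike a `TM`, a machine leaves with a value of type E, which selects the machine to run next;
-- data of finite type thus pass through the control instead of the tape.
record Mach (E : Set) : Set₁ where
  no-eta-equality
  field
    S     : Set
    fin   : Finite S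
    start : S
    move  : S → Sym → (S ⊎ E) × Sym × Move

open Mach

act : Sym → Move → Tape → Tape
act s mv t = moveTape mv (write s t)

act-≋ : ∀ s mv {t u} → t ≋ u → act s mv t ≋ act s mv u
act-≋ s mv e = moveTape-≋ mv (write-≋ s e)

data Steps {E} (M : Mach E) : S M → Tape → ℕ → E → Tape → Set where
  exit : ∀ {s t e a mv} → move M s (Tape.head t) ≡ (inj₂ e , a , mv) → Steps M s t 1 e (act a mv t)
  more : ∀ {s s₁ t n e a mv t'} → move M s (Tape.head t) ≡ (inj₁ s₁ , a , mv) →
         Steps M s₁ (act a mv t) n e t' → Steps M s t (suc n) e t'

Steps-≋ : ∀ {E} {M : Mach E} {s t u n e t'} → t ≋ u → Steps M s t n e t' → ∃ λ u' → Steps M s u n e u' × t' ≋ u'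
Steps-≋ {M = M} {s} q (exit {a = a} {mv} p) =
  _ , exit (trans (cong (move M s) (sym (_≋_.≋h q))) p) , act-≋ a mv q
Steps-≋ {M = M} {s} q (more {a = a} {mv} p r) with Steps-≋ (act-≋ a mv q) r
... | u' , r' , q' = u' , more (trans (cong (move M s) (sym (_≋_.≋h q))) p) r' , q'

record Run {E} (M : Mach E) (t : Tape) (N : ℕ) (e : E) (t' : Tape) : Set where
  constructor mkRun
  field
    {n}   : ℕ
    {t''} : Tape
    n≤N   : n ≤ N
    steps : Steps M (start M) t n e t''
    fin≋  : t'' ≋ t'

Run-resp : ∀ {E} {M : Mach E} {t u N N' e t' u'} → t ≋ u → N ≤ N' → t' ≋ u' → Run M t N e t' → Run M u N' e u'
Run-resp p le q (mkRun a b c) with Steps-≋ p b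
... | u'' , b' , r = mkRun (≤-trans a le) b' (≋-trans (≋-sym r) (≋-trans c q))

Run-≤ : ∀ {E} {M : Mach E} {t N N' e t'} → N ≤ N' → Run M t N e t' → Run M t N' e t'
Run-≤ le = Run-resp ≋-refl le ≋-refl

Run-to : ∀ {E} {M : Mach E} {t N e t' u'} → t' ≋ u' → Run M t N e t' → Run M t N e u'
Run-to = Run-resp ≋-refl ≤-refl

Run-from : ∀ {E} {M : Mach E} {t u N e t'} → u ≋ t → Run M t N e t' → Run M u N e t'
Run-from q = Run-resp (≋-sym q) ≤-refl ≋-refl

cell : ∀ {E} → (Sym → E × Sym × Move) → Mach E
cell f .S     = ⊤
cell f .fin   = fin-⊤
cell f .start = tt
cell f .move _ a = inj₂ (proj₁ (f a)) , proj₂ (f a)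

Run-cell : ∀ {E} (f : Sym → E × Sym × Move) L h R →
  Run (cell f) (tape L h R) 1 (proj₁ (f h)) (moveTape (proj₂ (proj₂ (f h))) (tape L (proj₁ (proj₂ (f h))) R))
Run-cell f L h R = mkRun ≤-refl (exit refl) ≋-refl

ret : ∀ {E} → E → Mach E
ret e = cell (λ a → e , a , stay)

Run-ret : ∀ {E} {e : E} {t} → Run (ret e) t 1 e t
Run-ret = mkRun ≤-refl (exit refl) ≋-refl

module _ {E F : Set} (M : Mach E) (finE : Finite E) (k : E → Mach F) where

  bind : Mach F
  bind .S     = S M ⊎ Σ E (λ e → S (k e))
  bind .fin   = fin-⊎ (fin M) (fin-Σ finE (λ e → fin (k e)))
  bind .start = inj₁ (start M)
  bind .move (inj₁ s) a with move M s a
  ... | inj₁ s' , b = inj₁ (inj₁ s') , b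
  -- The exit move of M already enters `k e`, so that the times simply add up.
  ... | inj₂ e  , b = inj₁ (inj₂ (e , start (k e))) , b
  bind .move (inj₂ (e , s)) a with move (k e) s a
  ... | inj₁ s' , b = inj₁ (inj₂ (e , s')) , b
  ... | inj₂ f  , b = inj₂ f , b

  bind-δ₁ : ∀ {s a s' b} → move M s a ≡ (inj₁ s' , b) → move bind (inj₁ s) a ≡ (inj₁ (inj₁ s') , b)
  bind-δ₁ p rewrite p = refl

  bind-δ₂ : ∀ {s a e b} → move M s a ≡ (inj₂ e , b) → move bind (inj₁ s) a ≡ (inj₁ (inj₂ (e , start (k e))) , b)
  bind-δ₂ p rewrite p = refl

  bind-δ₃ : ∀ {e s a s' b} → move (k e) s a ≡ (inj₁ s' , b) → move bind (inj₂ (e , s)) a ≡ (inj₁ (inj₂ (e , s')) , b)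
  bind-δ₃ p rewrite p = refl

  bind-δ₄ : ∀ {e s a f b} → move (k e) s a ≡ (inj₂ f , b) → move bind (inj₂ (e , s)) a ≡ (inj₂ f , b)
  bind-δ₄ p rewrite p = refl

  Steps-bindʳ : ∀ {e s t n f t'} → Steps (k e) s t n f t' → Steps bind (inj₂ (e , s)) t n f t'
  Steps-bindʳ (exit p)   = exit (bind-δ₄ p)
  Steps-bindʳ (more p r) = more (bind-δ₃ p) (Steps-bindʳ r)

  Steps-bind : ∀ {s t n e t' n' f t''} → Steps M s t n e t' → Steps (k e) (start (k e)) t' n' f t'' →
               Steps bind (inj₁ s) t (n + n') f t''
  Steps-bind (exit p)   q = more (bind-δ₂ p) (Steps-bindʳ q)
  Steps-bind (more p r) q = more (bind-δ₁ p) (Steps-bind r q)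

infixl 1 _>>=[_]_
_>>=[_]_ : ∀ {E F} → Mach E → Finite E → (E → Mach F) → Mach F
M >>=[ fe ] k = bind M fe k

infixl 1 _≫_
_≫_ : ∀ {F} → Mach ⊤ → Mach F → Mach F
M ≫ K = bind M fin-⊤ (λ _ → K)

Run-bind : ∀ {E F} {M : Mach E} {fe : Finite E} {k : E → Mach F} {t N e t' N' f t''} →
  Run M t N e t' → Run (k e) t' N' f t'' → Run (M >>=[ fe ] k) t (N + N') f t''
Run-bind {M = M} {fe} {k} (mkRun a b c) r with Run-resp (≋-sym c) ≤-refl ≋-refl r
... | mkRun a' b' c' = mkRun (+-mono-≤ a a') (Steps-bind M fe k b b') c'

module _ {C E : Set} (finC : Finite C) (k : C → Mach (C ⊎ E)) where

  iter : C → Mach E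
  iter c .S     = Σ C (λ c → S (k c))
  iter c .fin   = fin-Σ finC (λ c → fin (k c))
  iter c .start = c , start (k c)
  iter _ .move (c , s) a with move (k c) s a
  ... | inj₁ s'         , b = inj₁ (c , s') , b
  ... | inj₂ (inj₁ c')  , b = inj₁ (c' , start (k c')) , b
  ... | inj₂ (inj₂ e)   , b = inj₂ e , b

  iter-δ₁ : ∀ {c₀ c s a s' b} → move (k c) s a ≡ (inj₁ s' , b) → move (iter c₀) (c , s) a ≡ (inj₁ (c , s') , b)
  iter-δ₁ p rewrite p = refl

  iter-δ₂ : ∀ {c₀ c s a c' b} → move (k c) s a ≡ (inj₂ (inj₁ c') , b) → move (iter c₀) (c , s) a ≡ (inj₁ (c' , start (k c')) , b)
  iter-δ₂ p rewrite p = refl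

  iter-δ₃ : ∀ {c₀ c s a e b} → move (k c) s a ≡ (inj₂ (inj₂ e) , b) → move (iter c₀) (c , s) a ≡ (inj₂ e , b)
  iter-δ₃ p rewrite p = refl

  Steps-iter-done : ∀ {c₀ c s t n e t'} → Steps (k c) s t n (inj₂ e) t' → Steps (iter c₀) (c , s) t n e t'
  Steps-iter-done {c₀} (exit p) = exit (iter-δ₃ {c₀} p)
  Steps-iter-done {c₀} (more p r) = more (iter-δ₁ {c₀} p) (Steps-iter-done r)

  Steps-iter-more : ∀ {c₀ c s t n c' t' n' e t''} → Steps (k c) s t n (inj₁ c') t' →
    Steps (iter c') (c' , start (k c')) t' n' e t'' → Steps (iter c₀) (c , s) t (n + n') e t''
  Steps-iter-more {c₀} (exit p) q = more (iter-δ₂ {c₀} p) (change q)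
    where
    -- `iter c` and `iter c'` differ only in their start states, which `Steps` does not consult.
    change : ∀ {c c' s t n e t'} → Steps (iter c) s t n e t' → Steps (iter c') s t n e t'
    change (exit p)   = exit p
    change (more p r) = more p (change r)
  Steps-iter-more {c₀} (more p r) q = more (iter-δ₁ {c₀} p) (Steps-iter-more r q)

  Run-iter-done : ∀ {c t N e t'} → Run (k c) t N (inj₂ e) t' → Run (iter c) t N e t'
  Run-iter-done (mkRun a b c) = mkRun a (Steps-iter-done b) c

  Run-iter-more : ∀ {c t N c' t' N' e t''} → Run (k c) t N (inj₁ c') t' → Run (iter c') t' N' e t'' →
    Run (iter c) t (N + N') e t''
  Run-iter-more (mkRun a b c) r with Run-resp (≋-sym c) ≤-refl ≋-refl r
  ... | mkRun a' b' c' = mkRun (+-mono-≤ a a') (Steps-iter-more b b') c'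

-- From machines with exits to Turing machines

readBits-≈ : ∀ xs {ys} → xs ≈ ys → readBits xs ≡ readBits ys
readBits-≈ [] {[]} e = refl
readBits-≈ [] {y ∷ ys} e with y | e 0
... | .blank | refl = refl
readBits-≈ (x ∷ xs) {[]} e with x | e 0
... | .blank | refl = refl
readBits-≈ (x ∷ xs) {y ∷ ys} e with x | y | e 0
... | blank | .blank   | refl = refl
... | bit b | .(bit b) | refl = cong (b ∷_) (readBits-≈ xs (λ i → e (suc i)))

readBits-map : ∀ bs → readBits (map bit bs) ≡ bs
readBits-map []       = refl
readBits-map (b ∷ bs) = cong (b ∷_) (readBits-map bs)

module _ (M : Mach ⊤) where
  -- The start state stands in front because a `TM` starts in state zero; its second occurrence in
  -- the enumeration does no harm.
  states : List (S M ⊎ ⊤)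
  states = inj₁ (start M) ∷ (proj₁ (fin-⊎ (fin M) fin-⊤))

  State : Set
  State = Fin (length states)

  stateOf : State → S M ⊎ ⊤
  stateOf = Data.List.lookup states

  code : S M ⊎ ⊤ → State
  code s = suc (index (proj₂ (fin-⊎ (fin M) fin-⊤) s))

  stateOf-code : ∀ s → stateOf (code s) ≡ s
  stateOf-code s = sym (lookup-index (proj₂ (fin-⊎ (fin M) fin-⊤) s))

  next : (S M ⊎ ⊤) × Sym × Move → State × Sym × Move
  next (inj₁ s , b) = code (inj₁ s) , b
  next (inj₂ _ , b) = code (inj₂ tt) , b

  -- A `TM` halts without acting, while an exit still writes and moves. Hence the extra state
  -- `inj₂ tt`, entered by the exit and without transitions.
  δTM : S M ⊎ ⊤ → Sym → Maybe (State × Sym × Move)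
  δTM (inj₂ _) _ = nothing
  δTM (inj₁ s) a = just (next (move M s a))

  toTM : TM
  toTM = record { Q = length (proj₁ (fin-⊎ (fin M) fin-⊤)) ; δ = λ q → δTM (stateOf q) }

  step-next : ∀ q t {s s' a mv} → stateOf q ≡ inj₁ s → next (move M s (Tape.head t)) ≡ (s' , a , mv) →
              step toTM (mconf q t) ≡ just (mconf s' (act a mv t))
  step-next q (tape l h r) {s} p e with stateOf q
  step-next q (tape l h r) {s} refl e | .(inj₁ s) with next (move M s h)
  step-next q (tape l h r) {s} refl refl | .(inj₁ s) | _ = refl

  step-halt : ∀ q t → stateOf q ≡ inj₂ tt → step toTM (mconf q t) ≡ nothing
  step-halt q (tape l h r) p with stateOf q
  step-halt q (tape l h r) refl | .(inj₂ tt) = refl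

  run-halted : ∀ K c → step toTM c ≡ nothing → run toTM K c ≡ c
  run-halted zero    c p = refl
  run-halted (suc K) c p with step toTM c
  run-halted (suc K) c refl | .nothing = refl

  run-step : ∀ K c {c'} → step toTM c ≡ just c' → run toTM (suc K) c ≡ run toTM K c'
  run-step K c p with step toTM c
  run-step K c refl | .(just _) = refl

  -- A halted machine stays put, so the result is the same for every K from n on; a run of unknown
  -- length can then be compared with the polynomial clock of `PolyTime`.
  simulate : ∀ {s t n t'} q → Steps M s t n tt t' → stateOf q ≡ inj₁ s →
    ∃ λ q' → stateOf q' ≡ inj₂ tt × (∀ K → n ≤ K → run toTM K (mconf q t) ≡ mconf q' t')
  simulate {t = t} q (exit p) e = code (inj₂ tt) , stateOf-code (inj₂ tt) , λ where
    (suc K) (s≤s _) → trans (run-step K (mconf q t) (step-next q t e (cong next p))) (run-halted K _ (step-halt (code (inj₂ tt)) _ (stateOf-code (inj₂ tt))))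
  simulate {t = t} q (more {s₁ = s₁} p r) e with simulate (code (inj₁ s₁)) r (stateOf-code (inj₁ s₁))
  ... | q' , h , f = q' , h , λ where
    (suc K) (s≤s le) → trans (run-step K (mconf q t) (step-next q t e (cong next p))) (f K le)

  polyTime : ∀ (F : List Bool → List Bool) c →
    (∀ x → ∃ λ t' → Run M (atR [] (map bit x)) (poly c (length x)) tt t' × readBits (Tape.head t' ∷ Tape.rights t') ≡ F x) →
    PolyTime F
  polyTime F c spec = toTM , c , correct
    where
    init : ∀ x → initConf toTM x ≡ mconf zero (atR [] (map bit x))
    init []      = refl
    init (_ ∷ _) = refl

    correct : ∀ x → let cf = run toTM (poly c (length x)) (initConf toTM x) in Halted toTM cf × output toTM cf ≡ F x
    correct x rewrite init x with spec x
    ... | t' , mkRun {t'' = tape l h r} le st (mk≋ _ eh er) , out with simulate zero st refl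
    ... | q' , hq , f rewrite f _ le =
      step-halt q' _ hq , trans (readBits-≈ (h ∷ r) (∷-≈ eh er)) out

-- Columns of bits on the left of the head

bits : List Bool → List Sym
bits = map bit

bitsᵛ : ∀ {n} → Vec Bool n → List Sym
bitsᵛ v = bits (toList v)

Run-along : ∀ {Q E : Set} (M : Q → Mach E) {q q' t N e t'} → q ≡ q' → Run (M q') t N e t' → Run (M q) t N e t'
Run-along M refl r = r

le-by : ∀ {a b} s → a + s ≡ b → a ≤ b
le-by {a} s e = subst (a ≤_) e (m≤m+n a s)

++-≈ : ∀ P {X Y} → X ≈ Y → P ++ X ≈ P ++ Y
++-≈ []      e i       = e i
++-≈ (x ∷ P) e zero    = refl
++-≈ (x ∷ P) e (suc i) = ++-≈ P e i

moveL moveR : Mach ⊤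
moveL = cell (λ a → tt , a , left)
moveR = cell (λ a → tt , a , right)

Run-moveL : ∀ {L h R} → Run moveL (tape L h R) 1 tt (atL L (h ∷ R))
Run-moveL {L} {h} {R} = Run-to (≋-reflexive (move-left L h R)) (Run-cell _ L h R)

Run-moveR : ∀ {L h R} → Run moveR (tape L h R) 1 tt (atR (h ∷ L) R)
Run-moveR {L} {h} {R} = Run-to (≋-reflexive (move-right L h R)) (Run-cell _ L h R)

seekBody : Move → Sym → (⊤ ⊎ ⊤) × Sym × Move
seekBody mv blank   = inj₂ tt , blank , stay
seekBody mv (bit b) = inj₁ tt , bit b , mv

seek : Move → Mach ⊤
seek mv = iter fin-⊤ (λ _ → cell (seekBody mv)) tt

Run-seekR : ∀ bs {L O} → Run (seek right) (atR L (bits bs ++ blank ∷ O)) (length bs + 1) tt (tape (bits bs ʳ++ L) blank O)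
Run-seekR []       = Run-iter-done fin-⊤ _ (Run-cell (seekBody right) _ _ _)
Run-seekR (b ∷ bs) {L} {O} = Run-iter-more fin-⊤ _
  (Run-to (≋-reflexive (move-right L (bit b) _)) (Run-cell (seekBody right) _ _ _)) (Run-seekR bs)

Run-seekL : ∀ bs {X R} → Run (seek left) (atL (bits bs ++ blank ∷ X) R) (length bs + 1) tt (tape X blank (bits bs ʳ++ R))
Run-seekL []       = Run-iter-done fin-⊤ _ (Run-cell (seekBody left) _ _ _)
Run-seekL (b ∷ bs) {X} {R} = Run-iter-more fin-⊤ _
  (Run-to (≋-reflexive (move-left _ (bit b) R)) (Run-cell (seekBody left) _ _ _)) (Run-seekL bs)

fin-Col : ∀ n → Finite (Vec Bool n)
fin-Col = fin-Vec fin-Bool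

readCell : Sym → Maybe Bool × Sym × Move
readCell blank   = nothing , blank , stay
readCell (bit b) = just b , bit b , left

readCol : ∀ n → Mach (Maybe (Vec Bool n))
readCol zero    = ret (just [])
readCol (suc n) = cell readCell >>=[ fin-Maybe fin-Bool ] λ where
  nothing  → ret nothing
  (just b) → readCol n >>=[ fin-Maybe (fin-Col n) ] λ v → ret (Data.Maybe.map (b ∷_) v)

readCol-cost : ℕ → ℕ
readCol-cost zero    = 1
readCol-cost (suc n) = 1 + (readCol-cost n + 1)

Run-readCol : ∀ {n} (v : Vec Bool n) X {R} → Run (readCol n) (atL (bitsᵛ v ++ X) R) (readCol-cost n) (just v) (atL X (bitsᵛ v ʳ++ R))
Run-readCol []      X = Run-ret
Run-readCol (b ∷ v) X {R} = Run-bind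
  (Run-to (≋-reflexive (move-left (bitsᵛ v ++ X) (bit b) R)) (Run-cell readCell _ _ _))
  (Run-bind (Run-readCol v X) Run-ret)

Run-readCol-end : ∀ {n X R} → Run (readCol (suc n)) (tape X blank R) 2 nothing (tape X blank R)
Run-readCol-end = Run-bind (Run-cell readCell _ _ _) Run-ret

-- Entry 0 of a column is nearest to the centre. Writing proceeds to the right and reaches it last,
-- so the recursive call comes first.
putCol : ∀ {n} → Vec Bool n → Mach ⊤
putCol []      = moveR
putCol (b ∷ v) = putCol v ≫ cell (λ _ → tt , bit b , right)

Run-putCol : ∀ {n} (v w : Vec Bool n) {L h R} →
  Run (putCol v) (tape L h (bitsᵛ w ʳ++ R)) (n + 1) tt (atR (bitsᵛ v ++ h ∷ L) R)
Run-putCol []      []      = Run-moveR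
Run-putCol {suc n} (b ∷ v) (c ∷ w) {L} {h} {R} = Run-≤ (≤-reflexive (+-comm (n + 1) 1))
  (Run-bind (Run-putCol v w) (Run-to (≋-reflexive (move-right _ (bit b) R)) (Run-cell _ _ _ _)))

newCol : ∀ {n} → Vec Bool n → Mach ⊤
newCol []      = ret tt
newCol (b ∷ v) = cell (λ _ → tt , bit b , left) ≫ newCol v

Run-newCol : ∀ {n} (v : Vec Bool n) {R} → Run (newCol v) (atL [] R) (n + 1) tt (atL [] (bitsᵛ v ʳ++ R))
Run-newCol []      = Run-ret
Run-newCol (b ∷ v) {R} = Run-bind (Run-to (≋-reflexive (move-left [] (bit b) R)) (Run-cell _ _ _ _)) (Run-newCol v)

bits-ʳ++ : ∀ as ys {Z} → bits as ʳ++ (bits ys ++ Z) ≡ bits (as ʳ++ ys) ++ Z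
bits-ʳ++ []       ys = refl
bits-ʳ++ (a ∷ as) ys = bits-ʳ++ as (a ∷ ys)

bits-ʳ++-ʳ++ : ∀ as ys {Z} → bits (as ʳ++ ys) ʳ++ Z ≡ bits ys ʳ++ (bits as ++ Z)
bits-ʳ++-ʳ++ []       ys = refl
bits-ʳ++-ʳ++ (a ∷ as) ys = bits-ʳ++-ʳ++ as (a ∷ ys)

length-ʳ++ : ∀ (as ys : List Bool) → length (as ʳ++ ys) ≡ length as + length ys
length-ʳ++ []       ys = refl
length-ʳ++ (a ∷ as) ys = trans (length-ʳ++ as (a ∷ ys)) (+-suc (length as) (length ys))

length-toList : ∀ {n} (v : Vec Bool n) → length (toList v) ≡ n
length-toList []      = refl
length-toList (_ ∷ v) = cong suc (length-toList v)

module _ {k : ℕ} where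

  Col : Set
  Col = Vec Bool (suc k)

  cells : List Col → List Sym
  cells = concatMap bitsᵛ

  -- The head rests on a blank; columns extend to the left, the output to the right.
  centre : List Col → List Sym → Tape
  centre cs O = tape (cells cs ++ blank ∷ []) blank O

  record Op (C E : Set) : Set where
    field
      finC : Finite C
      onCol : C → Col → Col × (C ⊎ E)
      onEnd : C → Maybe Col × E

  -- A column is read, written back and crossed once more on the way out. The last `suc k` pays for
  -- the walk back to the centre, the 10 for the steps at the end of the scan.
  unit : ℕ
  unit = readCol-cost (suc k) + (suc k + 1 + (1 + (readCol-cost (suc k) + 1))) + suc k + 10

  scanCost : ℕ → ℕ → ℕ
  scanCost n y = n * unit + y + unit

  module _ {C E : Set} (op : Op C E) where
    open Op op

    scanF : C → List Col → List Col × E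
    scanF c [] with onEnd c
    ... | nothing , e = [] , e
    ... | just v  , e = v ∷ [] , e
    scanF c (v ∷ vs) with onCol c v
    ... | v' , inj₂ e  = v' ∷ vs , e
    ... | v' , inj₁ c' = v' ∷ proj₁ (scanF c' vs) , proj₂ (scanF c' vs)

    after : C ⊎ E → Mach (C ⊎ E)
    after (inj₂ e) = seek right ≫ ret (inj₂ e)
    after (inj₁ c) = moveL ≫ (readCol (suc k) >>=[ fin-Maybe (fin-Col _) ] λ _ → ret (inj₁ c))

    atEnd : Maybe Col × E → Mach (C ⊎ E)
    atEnd (nothing , e) = moveR ≫ (seek right ≫ ret (inj₂ e))
    atEnd (just v  , e) = newCol v ≫ (moveR ≫ (seek right ≫ ret (inj₂ e)))

    scanBody : C → Mach (C ⊎ E)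
    scanBody c = readCol (suc k) >>=[ fin-Maybe (fin-Col _) ] λ where
      nothing  → atEnd (onEnd c)
      (just v) → putCol (proj₁ (onCol c v)) ≫ after (proj₂ (onCol c v))

    scan : C → Mach E
    scan c = moveL ≫ iter finC scanBody c

    -- `ys` are the bits between head and centre, already passed. The induction needs them because
    -- the walk back happens only once, at the end.
    Run-iter-scan : ∀ c cs ys O → Run (iter finC scanBody c) (atL (cells cs ++ blank ∷ []) (bits ys ++ blank ∷ O))
      (scanCost (length cs) (length ys)) (proj₂ (scanF c cs))
      (tape (bits ys ʳ++ (cells (proj₁ (scanF c cs)) ++ blank ∷ [])) blank O)
    Run-iter-scan c [] ys O with onEnd c in eq
    ... | nothing , e = Run-iter-done finC scanBody (Run-≤ bound
            (Run-bind Run-readCol-end (Run-along atEnd eq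
              (Run-bind Run-moveR (Run-bind (Run-seekR ys) Run-ret)))))
      where
      bound : 2 + (1 + (length ys + 1 + 1)) ≤ length ys + unit
      bound = le-by (unit ∸ 5) (solve 2 (λ y u → con 2 :+ (con 1 :+ (y :+ con 1 :+ con 1)) :+ u := y :+ (con 5 :+ u)) refl (length ys) (unit ∸ 5)
              ■ cong (length ys +_) (m+[n∸m]≡n {5} {unit} (≤-trans (s≤s (s≤s (s≤s (s≤s (s≤s z≤n))))) (m≤n+m 10 (readCol-cost (suc k) + (suc k + 1 + (1 + (readCol-cost (suc k) + 1))) + suc k)))))
        where
        infixr 2 _■_
        _■_ = trans
    ... | just v , e = Run-iter-done finC scanBody (Run-≤ bound
            (Run-bind Run-readCol-end (Run-along atEnd eq
              (Run-bind (Run-newCol v) (Run-bind Run-moveR (Run-bind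
                (Run-resp (≋-reflexive (cong (atR _) (sym (bits-ʳ++ (toList v) ys)))) ≤-refl
                  (≋-reflexive (cong (λ l → tape l blank O)
                    (trans (bits-ʳ++-ʳ++ (toList v) ys) (cong (λ z → bits ys ʳ++ (z ++ blank ∷ [])) (sym (++-identityʳ (bitsᵛ v)))))))
                  (Run-seekR (toList v ʳ++ ys)))
                Run-ret))))))
      where
      bound : 2 + (suc k + 1 + (1 + (length (toList v ʳ++ ys) + 1 + 1))) ≤ length ys + unit
      bound rewrite length-ʳ++ (toList v) ys | length-toList v =
        le-by _ (solve 3 (λ y k r → let u = r :+ (con 1 :+ k :+ con 1 :+ (con 1 :+ (r :+ con 1))) :+ (con 1 :+ k) :+ con 10 in (con 2 :+ (con 1 :+ k :+ con 1 :+ (con 1 :+ (con 1 :+ k :+ y :+ con 1 :+ con 1)))) :+ (r :+ (con 1 :+ r :+ con 1) :+ con 5)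
              := y :+ u) refl (length ys) k (readCol-cost (suc k)))
    Run-iter-scan c (v ∷ vs) ys O with onCol c v in eq
    ... | v' , inj₂ e = Run-iter-done finC scanBody (Run-resp
            (≋-reflexive (cong (λ z → atL z (bits ys ++ blank ∷ O)) (sym (++-assoc (bitsᵛ v) (cells vs) (blank ∷ []))))) bound
            (≋-reflexive refl)
            (Run-bind (Run-readCol v (cells vs ++ blank ∷ [])) (Run-along (λ q → putCol (proj₁ q) ≫ after (proj₂ q)) eq
              (Run-bind (Run-putCol v' v) (Run-bind (Run-to
                 (mk≋ {u = tape (bits ys ʳ++ ((bitsᵛ v' ++ cells vs) ++ blank ∷ [])) blank O} (ʳ++-≈ ys) refl (λ _ → refl)) (Run-seekR ys)) Run-ret)))))
      where
      ʳ++-cong : ∀ zs {X Y} → X ≈ Y → bits zs ʳ++ X ≈ bits zs ʳ++ Y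
      ʳ++-cong []       q = q
      ʳ++-cong (z ∷ zs) q = ʳ++-cong zs (∷-≈ refl q)
      ʳ++-≈ : ∀ zs → bits zs ʳ++ (bitsᵛ v' ++ hd (cells vs ++ blank ∷ []) ∷ tl (cells vs ++ blank ∷ [])) ≈ bits zs ʳ++ ((bitsᵛ v' ++ cells vs) ++ blank ∷ [])
      ʳ++-≈ zs = ʳ++-cong zs (λ i → trans (++-≈ (bitsᵛ v') (hd∷tl-≈ (cells vs ++ blank ∷ [])) i)
        (cong (λ z → nth z i) (sym (++-assoc (bitsᵛ v') (cells vs) _))))
      bound : readCol-cost (suc k) + (suc k + 1 + (length ys + 1 + 1)) ≤ scanCost (suc (length vs)) (length ys)
      bound = le-by _ (solve 4 (λ n y k r → let u = r :+ (con 1 :+ k :+ con 1 :+ (con 1 :+ (r :+ con 1))) :+ (con 1 :+ k) :+ con 10 in (r :+ (con 1 :+ k :+ con 1 :+ (y :+ con 1 :+ con 1)) :+ 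
               (r :+ con 11 :+ k :+ n :* u :+ u))
              := (con 1 :+ n) :* u :+ y :+ u) refl (length vs) (length ys) k (readCol-cost (suc k)))
    ... | v' , inj₁ c' = Run-≤ bound (Run-iter-more finC scanBody
            (Run-from (≋-reflexive (cong (λ z → atL z (bits ys ++ blank ∷ O)) (++-assoc (bitsᵛ v) (cells vs) (blank ∷ []))))
            (Run-bind (Run-readCol v (cells vs ++ blank ∷ [])) (Run-along (λ q → putCol (proj₁ q) ≫ after (proj₂ q)) eq
              (Run-bind (Run-putCol v' v) (Run-from (mk≋ {u = atR (bitsᵛ v' ++ cells vs ++ blank ∷ []) (bits ys ++ blank ∷ O)} (++-≈ (bitsᵛ v') {hd (cells vs ++ blank ∷ []) ∷ tl (cells vs ++ blank ∷ [])} (hd∷tl-≈ (cells vs ++ blank ∷ []))) refl (λ _ → refl))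
                (Run-bind (Run-moveL {L = bitsᵛ v' ++ cells vs ++ blank ∷ []}) (Run-bind (Run-from (≋-reflexive (cong (atL (bitsᵛ v' ++ cells vs ++ blank ∷ [])) (hd∷tl ys))) (Run-readCol v' (cells vs ++ blank ∷ []))) Run-ret)))))))
            (Run-resp (≋-reflexive (cong (atL (cells vs ++ blank ∷ [])) (sym (bits-ʳ++ (toList v') ys)))) ≤-refl
              (≋-reflexive (cong (λ l → tape l blank O) (trans (bits-ʳ++-ʳ++ (toList v') ys)
                (cong (bits ys ʳ++_) (sym (++-assoc (bitsᵛ v') (cells (proj₁ (scanF c' vs))) _))))))
              (Run-iter-scan c' vs (toList v' ʳ++ ys) O)))
      where
      hd∷tl : ∀ ys → hd (bits ys ++ blank ∷ O) ∷ tl (bits ys ++ blank ∷ O) ≡ bits ys ++ blank ∷ O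
      hd∷tl []      = refl
      hd∷tl (_ ∷ _) = refl
      bound : readCol-cost (suc k) + (suc k + 1 + (1 + (readCol-cost (suc k) + 1))) + scanCost (length vs) (length (toList v' ʳ++ ys))
              ≤ scanCost (suc (length vs)) (length ys)
      bound rewrite length-ʳ++ (toList v') ys | length-toList v' =
        le-by 10 (solve 4 (λ w y k s → w :+ (s :+ (k :+ y) :+ (w :+ k :+ con 10)) :+ con 10 := (w :+ k :+ con 10) :+ s :+ y :+ (w :+ k :+ con 10)) refl
          (readCol-cost (suc k) + (suc k + 1 + (1 + (readCol-cost (suc k) + 1)))) (length ys) (suc k) (length vs * unit))

    Run-scan : ∀ c cs O → Run (scan c) (centre cs O) (scanCost (length cs) 1) (proj₂ (scanF c cs)) (centre (proj₁ (scanF c cs)) O)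
    Run-scan c cs O = Run-≤ (≤-reflexive (solve 2 (λ a u → con 1 :+ (a :+ con 0 :+ u) := a :+ con 1 :+ u) refl (length cs * unit) unit))
      (Run-bind Run-moveL (Run-iter-scan c cs [] O))

-- Counters and the input as tracks of the tape

bitAt : List Bool → ℕ → Bool
bitAt []       _       = false
bitAt (b ∷ _)  zero    = b
bitAt (_ ∷ bs) (suc i) = bitAt bs i

_[_↦_] : (ℕ → ℕ) → ℕ → ℕ → ℕ → ℕ
(ρ [ d ↦ v ]) l with l ≟ d
... | yes _ = v
... | no  _ = ρ l

↦-same : ∀ ρ d v → (ρ [ d ↦ v ]) d ≡ v
↦-same ρ d v with d ≟ d
... | yes _ = refl
... | no ne = ⊥-elim (ne refl)

↦-other : ∀ ρ d v {l} → l ≢ d → (ρ [ d ↦ v ]) l ≡ ρ l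
↦-other ρ d v {l} ne with l ≟ d
... | yes e = ⊥-elim (ne e)
... | no  _ = refl

↦-cong : ∀ ρ d v (P : ℕ → ℕ → Set) → P d v → (∀ l → l ≢ d → P l (ρ l)) → ∀ l → P l ((ρ [ d ↦ v ]) l)
↦-cong ρ d v P p q l with l ≟ d
... | yes refl = p
... | no ne    = q l ne

record St : Set where
  constructor st
  field
    inp : List Bool
    acc : ℕ
    out : List Bool
    env : ℕ → ℕ
open St

module Memory (n : ℕ) where

  Track : Set
  Track = Fin (suc (suc n))

  Column : Set
  Column = Col {suc n}

  get : List Column → ℕ → Track → Bool
  get []       _       _ = false
  get (v ∷ _)  zero    l = lookup v l
  get (_ ∷ vs) (suc i) l = get vs i l

  empty : Column
  empty = Data.Vec.replicate _ false

  spike : Track → Bool → Column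
  spike l b = empty [ l ]≔ b

  incOp : Track → Op {suc n} ⊤ ⊤
  incOp l = record
    { finC  = fin-⊤
    ; onCol = λ _ v → if lookup v l then (v , inj₁ tt) else (v [ l ]≔ true , inj₂ tt)
    ; onEnd = λ _ → just (spike l true) , tt }

  -- The first column with a 0 in track l has the value of counter l as its index. If r is a counter
  -- too, the bit of track r there says whether l is below r; if r is the input track, it is the
  -- input bit numbered by l.
  testOp : Track → Track → Op {suc n} ⊤ Bool
  testOp l r = record
    { finC  = fin-⊤
    ; onCol = λ _ v → v , (if lookup v l then inj₁ tt else inj₂ (lookup v r))
    ; onEnd = λ _ → nothing , false }

  clearOp : Track → Op {suc n} ⊤ ⊤
  clearOp l = record
    { finC  = fin-⊤
    ; onCol = λ _ v → if lookup v l then (v [ l ]≔ false , inj₁ tt) else (v , inj₂ tt)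
    ; onEnd = λ _ → nothing , tt }

  -- The control carries the displaced bit from column to column: the whole input track moves one
  -- place outwards.
  pushOp : Op {suc n} Bool ⊤
  pushOp = record
    { finC  = fin-Bool
    ; onCol = λ c v → v [ zero ]≔ c , inj₁ (lookup v zero)
    ; onEnd = λ c → just (spike zero c) , tt }

  Unary : List Column → Track → ℕ → Set
  Unary cs l r = ∀ i → get cs i l ≡ (i <ᵇ r)

  Same : List Column → List Column → Track → Set
  Same cs cs' l = ∀ i → get cs' i l ≡ get cs i l

  inc-spec : ∀ l cs r → Unary cs l r → let cs' = proj₁ (scanF (incOp l) tt cs) in
    Unary cs' l (suc r) × (∀ l' → l' ≢ l → Same cs cs' l') × length cs' ≤ suc (length cs)
  inc-spec l [] (suc r) u with () ← u 0
  inc-spec l [] zero u = (λ { zero → lookup∘update l empty true ; (suc i) → refl })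
    , (λ { l' ne zero → trans (lookup∘update′ ne empty true) (lookup-replicate l' false) ; l' ne (suc i) → refl }) , ≤-refl
  inc-spec l (v ∷ vs) r u with lookup v l in eq
  inc-spec l (v ∷ vs) zero u | false = (λ { zero → lookup∘update l v true ; (suc i) → u (suc i) })
    , (λ { l' ne zero → lookup∘update′ ne v true ; l' ne (suc i) → refl }) , n≤1+n _
  inc-spec l (v ∷ vs) (suc r) u | false with () ← trans (sym eq) (u 0)
  inc-spec l (v ∷ vs) zero u | true with () ← trans (sym eq) (u 0)
  inc-spec l (v ∷ vs) (suc r) u | true with inc-spec l vs r (λ i → u (suc i))
  ... | a , b , c = (λ { zero → eq ; (suc i) → a i }) , (λ { l' ne zero → refl ; l' ne (suc i) → b l' ne i }) , s≤s c

  clear-spec : ∀ l cs r → Unary cs l r → let cs' = proj₁ (scanF (clearOp l) tt cs) in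
    Unary cs' l 0 × (∀ l' → l' ≢ l → Same cs cs' l') × length cs' ≤ length cs
  clear-spec l [] r u = (λ _ → refl) , (λ _ _ _ → refl) , ≤-refl
  clear-spec l (v ∷ vs) r u with lookup v l in eq
  clear-spec l (v ∷ vs) zero u | false = u , (λ _ _ _ → refl) , ≤-refl
  clear-spec l (v ∷ vs) (suc r) u | false with () ← trans (sym eq) (u 0)
  clear-spec l (v ∷ vs) zero u | true with () ← trans (sym eq) (u 0)
  clear-spec l (v ∷ vs) (suc r) u | true with clear-spec l vs r (λ i → u (suc i))
  ... | a , b , c = (λ { zero → lookup∘update l v false ; (suc i) → a i })
    , (λ { l' ne zero → lookup∘update′ ne v false ; l' ne (suc i) → b l' ne i }) , s≤s c

  test-spec : ∀ l t cs r → Unary cs l r → scanF (testOp l t) tt cs ≡ (cs , get cs r t)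
  test-spec l t [] r u = refl
  test-spec l t (v ∷ vs) r u with lookup v l in eq
  test-spec l t (v ∷ vs) zero u | false = refl
  test-spec l t (v ∷ vs) (suc r) u | false with () ← trans (sym eq) (u 0)
  test-spec l t (v ∷ vs) zero u | true with () ← trans (sym eq) (u 0)
  test-spec l t (v ∷ vs) (suc r) u | true rewrite test-spec l t vs r (λ i → u (suc i)) = refl

  bitAt-drop : ∀ x i → bitAt x (suc i) ≡ bitAt (drop 1 x) i
  bitAt-drop []      i = refl
  bitAt-drop (_ ∷ _) i = refl

  push-spec : ∀ c cs x → (∀ i → get cs i zero ≡ bitAt x i) → let cs' = proj₁ (scanF pushOp c cs) in
    (∀ i → get cs' i zero ≡ bitAt (c ∷ x) i) × (∀ l' → l' ≢ zero → Same cs cs' l') × length cs' ≤ suc (length cs)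
  push-spec c [] x u = (λ { zero → refl ; (suc i) → u i })
    , (λ { zero ne i → ⊥-elim (ne refl) ; (suc l') ne zero → lookup-replicate l' false ; (suc l') ne (suc i) → refl }) , ≤-refl
  push-spec c ((b ∷ v) ∷ vs) x u with push-spec b vs (drop 1 x) (λ i → trans (u (suc i)) (bitAt-drop x i))
  ... | p , q , r = (λ { zero → refl ; (suc i) → trans (p i) (tail i) })
    , (λ { zero ne i → ⊥-elim (ne refl) ; (suc l') ne zero → refl ; (suc l') ne (suc i) → q (suc l') ne i }) , s≤s r
    where
    tail : ∀ i → bitAt (b ∷ drop 1 x) i ≡ bitAt x i
    tail zero    = trans (u 0) refl
    tail (suc i) = sym (bitAt-drop x i)

  X ACC : Track
  X   = zero
  ACC = suc zero

  lev : ∀ {d} → d < n → Track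
  lev p = suc (suc (fromℕ< p))

  record Rep (cs : List Column) (σ : St) : Set where
    constructor rep
    field
      repX : ∀ i → get cs i X ≡ bitAt (inp σ) i
      repA : Unary cs ACC (acc σ)
      repρ : ∀ (l : Fin n) → Unary cs (suc (suc l)) (env σ (toℕ l))

  -- An operation is a scan of the columns or a walk over the output; with Z bounding their number
  -- it takes at most κ (Z + 1) steps.
  κ : ℕ
  κ = suc (unit {suc n})

  -- A run with o elementary operations; Z bounds the space that it uses.
  record Does {E : Set} (M : Mach E) (σ : St) (o : ℕ) (e : E) (σ' : St) : Set where
    field
      runs : ∀ cs Z → Rep cs σ → length cs + length (out σ) + o ≤ Z →
        ∃ λ cs' → Rep cs' σ' × length cs' + length (out σ') ≤ length cs + length (out σ) + o
          × Run M (centre cs (bits (out σ))) (o * (κ * suc Z)) e (centre cs' (bits (out σ')))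

  open Does public

  _≐_ : St → St → Set
  σ ≐ σ' = inp σ ≡ inp σ' × acc σ ≡ acc σ' × out σ ≡ out σ' × (∀ l → env σ l ≡ env σ' l)

  Rep-≐ : ∀ {cs σ σ'} → σ ≐ σ' → Rep cs σ → Rep cs σ'
  Rep-≐ (refl , refl , refl , e) (rep a b c) = rep a b (λ l i → trans (c l i) (cong (i <ᵇ_) (e (toℕ l))))

  module _ {E : Set} {M : Mach E} where

    Does-to : ∀ {σ o e σ' σ''} → σ' ≐ σ'' → Does M σ o e σ' → Does M σ o e σ''
    Does-to q@(refl , refl , refl , _) D .runs cs Z r le with runs D cs Z r le
    ... | cs' , r' , b , run = cs' , Rep-≐ q r' , b , run

    Does-≤ : ∀ {σ o o' e σ'} → o ≤ o' → Does M σ o e σ' → Does M σ o' e σ'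
    Does-≤ {σ} q D .runs cs Z r le with runs D cs Z r (≤-trans (+-monoʳ-≤ (length cs + length (out σ)) q) le)
    ... | cs' , r' , b , run = cs' , r' , ≤-trans b (+-monoʳ-≤ (length cs + length (out σ)) q) , Run-≤ (*-monoˡ-≤ (κ * suc Z) q) run

  -- An operation adds at most one column or one output bit, so the space of the second run is
  -- bounded in advance and the same Z serves for both.
  combine : ∀ {E F G : Set} {M : Mach E} {K : Mach F} {J : Mach G} {σ o e σ' o' f σ'' g} →
    (∀ {t N t' N' t''} → Run M t N e t' → Run K t' N' f t'' → Run J t (N + N') g t'') →
    Does M σ o e σ' → Does K σ' o' f σ'' → Does J σ (o + o') g σ''
  combine {σ = σ} {o} {σ' = σ'} {o'} join D D' .runs cs Z r le
    with runs D cs Z r (≤-trans (+-monoʳ-≤ (length cs + length (out σ)) (m≤m+n o o')) le)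
  ... | cs' , r' , b , run
    with bound ← ≤-trans (+-monoˡ-≤ o' b) (≤-reflexive (+-assoc (length cs + length (out σ)) o o'))
    with runs D' cs' Z r' (≤-trans bound le)
  ... | cs'' , r'' , b' , run' = cs'' , r'' , ≤-trans b' bound
      , Run-≤ (≤-reflexive (sym (*-distribʳ-+ (κ * suc Z) o o'))) (join run run')

  Does-bind : ∀ {E F} {M : Mach E} {fe : Finite E} {k : E → Mach F} {σ o e σ' o' f σ''} →
    Does M σ o e σ' → Does (k e) σ' o' f σ'' → Does (M >>=[ fe ] k) σ (o + o') f σ''
  Does-bind = combine Run-bind

  Does-iter-more : ∀ {C E} {fc : Finite C} {k : C → Mach (C ⊎ E)} {c σ o c' σ' o' e σ''} →
    Does (k c) σ o (inj₁ c') σ' → Does (iter fc k c') σ' o' e σ'' → Does (iter fc k c) σ (o + o') e σ''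
  Does-iter-more {fc = fc} {k} = combine (Run-iter-more fc k)

  Does-iter-done : ∀ {C E} {fc : Finite C} {k : C → Mach (C ⊎ E)} {c σ o e σ'} →
    Does (k c) σ o (inj₂ e) σ' → Does (iter fc k c) σ o e σ'
  Does-iter-done {fc = fc} {k} D .runs cs Z r le with runs D cs Z r le
  ... | cs' , r' , b , run = cs' , r' , b , Run-iter-done fc k run

  κ-bound : ∀ {N} Z a → N ≤ a + Z * unit {suc n} → a ≤ suc Z + unit {suc n} → N ≤ 1 * (κ * suc Z)
  κ-bound {N} Z a p q = begin
    N                       ≤⟨ p ⟩
    a + Z * u               ≤⟨ +-monoˡ-≤ (Z * u) q ⟩
    suc Z + u + Z * u       ≡⟨ solve 2 (λ z u → con 1 :+ z :+ u :+ z :* u := con 1 :* ((con 1 :+ u) :* (con 1 :+ z))) refl Z u ⟩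
    1 * (κ * suc Z)         ∎
    where
    open ≤-Reasoning
    u = unit {suc n}

  ten≤unit : 10 ≤ unit {suc n}
  ten≤unit = m≤n+m 10 (readCol-cost (suc (suc n)) + (suc (suc n) + 1 + (1 + (readCol-cost (suc (suc n)) + 1))) + suc (suc n))

  Does-ret : ∀ {E} {e : E} {σ} → Does (ret e) σ 1 e σ
  Does-ret .runs cs Z r le = cs , r , m≤m+n _ 1 , Run-≤ (κ-bound Z 1 (m≤m+n 1 _) (s≤s z≤n)) Run-ret

  Does-scan : ∀ {C E} (op : Op {suc n} C E) c {σ e σ'} → out σ ≡ out σ' →
    (∀ cs → Rep cs σ → Rep (proj₁ (scanF op c cs)) σ' × proj₂ (scanF op c cs) ≡ e × length (proj₁ (scanF op c cs)) ≤ suc (length cs)) →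
    Does (scan op c) σ 1 e σ'
  Does-scan op c {σ} refl spec .runs cs Z r le with spec cs r
  ... | r' , refl , b = _ , r' , ≤-trans (+-monoˡ-≤ (length (out σ)) b) (≤-reflexive (+-comm 1 (length cs + length (out σ))))
      , Run-≤ (κ-bound Z (1 + unit {suc n}) (≤-trans (≤-reflexive (solve 2 (λ a u → a :+ con 1 :+ u := con 1 :+ u :+ a) refl (length cs * unit {suc n}) (unit {suc n})))
          (+-monoʳ-≤ (1 + unit {suc n}) (*-monoˡ-≤ (unit {suc n}) (≤-trans (m≤m+n (length cs) (length (out σ))) (≤-trans (m≤m+n _ 1) le))))) (s≤s (m≤n+m _ Z)))
        (Run-scan op c cs (bits (out σ)))

  lev≢ : ∀ {d} (p : d < n) {l : Fin n} → toℕ l ≢ d → suc (suc l) ≢ lev p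
  lev≢ p ne refl = ne (toℕ-fromℕ< p)

  lev-unary : ∀ {cs σ d} (p : d < n) → Rep cs σ → Unary cs (lev p) (env σ d)
  lev-unary {σ = σ} p r i = trans (Rep.repρ r (fromℕ< p) i) (cong (λ l → i <ᵇ env σ l) (toℕ-fromℕ< p))

  setLevel : ∀ {cs cs' σ d v} (p : d < n) → Rep cs σ → Unary cs' (lev p) v → (∀ l → l ≢ lev p → Same cs cs' l) →
    Rep cs' (record σ { env = env σ [ d ↦ v ] })
  setLevel {cs} {cs'} {σ} {d} {v} p (rep a b c) u same = rep
    (λ i → trans (same _ (λ ()) i) (a i)) (λ i → trans (same _ (λ ()) i) (b i)) level
    where
    level : ∀ l → Unary cs' (suc (suc l)) ((env σ [ d ↦ v ]) (toℕ l))
    level l i with toℕ l ≟ d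
    ... | no ne = trans (same _ (lev≢ p ne) i) (c l i)
    ... | yes e = trans (cong (λ z → get cs' i (suc (suc z))) (toℕ-injective (trans e (sym (toℕ-fromℕ< p))))) (u i)

  Does-inc : ∀ {d} (p : d < n) {σ} → Does (scan (incOp (lev p)) tt) σ 1 tt (record σ { env = env σ [ d ↦ suc (env σ d) ] })
  Does-inc {d} p {σ} = Does-scan (incOp (lev p)) tt refl λ cs r →
    case inc-spec (lev p) cs (env σ d) (lev-unary p r) of λ { (u , s , b) → setLevel p r u s , refl , b }

  Does-clear : ∀ {d} (p : d < n) {σ} → Does (scan (clearOp (lev p)) tt) σ 1 tt (record σ { env = env σ [ d ↦ 0 ] })
  Does-clear {d} p {σ} = Does-scan (clearOp (lev p)) tt refl λ cs r →
    case clear-spec (lev p) cs (env σ d) (lev-unary p r) of λ { (u , s , b) → setLevel p r u s , refl , m≤n⇒m≤1+n b }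

  Does-test : ∀ {d} (p : d < n) t {σ b} → (∀ cs → Rep cs σ → get cs (env σ d) t ≡ b) → Does (scan (testOp (lev p) t) tt) σ 1 b σ
  Does-test {d} p t {σ} q = Does-scan (testOp (lev p) t) tt refl λ cs r →
    let e = test-spec (lev p) t cs (env σ d) (lev-unary p r) in
    subst (λ c → Rep c σ) (cong proj₁ (sym e)) r , trans (cong proj₂ e) (q cs r) , ≤-trans (≤-reflexive (cong (length ∘ proj₁) e)) (n≤1+n _)

  Does-incAcc : ∀ {σ} → Does (scan (incOp ACC) tt) σ 1 tt (record σ { acc = suc (acc σ) })
  Does-incAcc {σ} = Does-scan (incOp ACC) tt refl λ { cs (rep a b c) →
    case inc-spec ACC cs (acc σ) b of λ { (u , s , l) →
      rep (λ i → trans (s X (λ ()) i) (a i)) u (λ t i → trans (s (suc (suc t)) (λ ()) i) (c t i)) , refl , l } }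

  Does-clearAcc : ∀ {σ} → Does (scan (clearOp ACC) tt) σ 1 tt (record σ { acc = 0 })
  Does-clearAcc {σ} = Does-scan (clearOp ACC) tt refl λ { cs (rep a b c) →
    case clear-spec ACC cs (acc σ) b of λ { (u , s , l) →
      rep (λ i → trans (s X (λ ()) i) (a i)) u (λ t i → trans (s (suc (suc t)) (λ ()) i) (c t i)) , refl , m≤n⇒m≤1+n l } }

  Does-push : ∀ {σ} b → Does (scan pushOp b) σ 1 tt (record σ { inp = b ∷ inp σ })
  Does-push {σ} b = Does-scan pushOp b refl λ { cs (rep p q c) →
    case push-spec b cs (inp σ) p of λ { (u , s , l) →
      rep u (λ i → trans (s ACC (λ ()) i) (q i)) (λ t i → trans (s (suc (suc t)) (λ ()) i) (c t i)) , refl , l } }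

  emitM : Bool → Mach ⊤
  emitM b = moveR ≫ (seek right ≫ (cell (λ _ → tt , bit b , left) ≫ seek left))

  bits-reverse : ∀ as {Z} → bits as ʳ++ Z ≡ bits (reverse as) ++ Z
  bits-reverse as = bits-ʳ++ as []

  bits-reverse-ʳ++ : ∀ as {Z} → bits (reverse as) ʳ++ Z ≡ bits as ++ Z
  bits-reverse-ʳ++ as = bits-ʳ++-ʳ++ as []

  Run-emit : ∀ b L o → Run (emitM b) (tape L blank (bits o)) (1 + (length o + 1 + (1 + (length (reverse o) + 1)))) tt
    (tape L blank (bits (o ++ b ∷ [])))
  Run-emit b L o = Run-to (≋-reflexive (cong (tape L blank) (trans (bits-reverse-ʳ++ o) (sym (map-++ bit o (b ∷ []))))))
    (Run-bind Run-moveR (Run-bind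
      (Run-from (mk≋ {u = atR (blank ∷ L) (bits o ++ blank ∷ [])} (λ _ → refl) (hd-≈ {bits o} {bits o ++ blank ∷ []} ext) (tl-≈ {bits o} {bits o ++ blank ∷ []} ext)) (Run-seekR o))
      (Run-bind (Run-to (≋-reflexive (trans (move-left _ (bit b) []) (cong (λ z → atL z (bit b ∷ [])) (bits-reverse o)))) (Run-cell _ _ _ _))
        (Run-seekL (reverse o)))))
    where
    ext : bits o ≈ bits o ++ blank ∷ []
    ext i = sym (++blank-≈ (bits o) i)

  out-bound : ∀ (cs : List Column) (o : List Bool) {Z} k → length cs + length o + 1 ≤ Z → k + (length o + length o) ≤ k + Z * unit {suc n}
  out-bound cs o {Z} k le = +-monoʳ-≤ k (begin
    length o + length o ≤⟨ +-mono-≤ lo lo ⟩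
    Z + Z               ≡⟨ solve 1 (λ z → z :+ z := z :* con 2) refl Z ⟩
    Z * 2               ≤⟨ *-monoʳ-≤ Z (≤-trans (s≤s (s≤s z≤n)) ten≤unit) ⟩
    Z * unit {suc n}    ∎)
    where
    open ≤-Reasoning
    lo : length o ≤ Z
    lo = ≤-trans (m≤n+m _ (length cs)) (≤-trans (m≤m+n _ 1) le)

  small : ∀ k Z → k ≤ 9 → k ≤ suc Z + unit {suc n}
  small k Z q = ≤-trans q (≤-trans (≤-trans (n≤1+n 9) ten≤unit) (m≤n+m _ (suc Z)))

  Does-emit : ∀ b {σ} → Does (emitM b) σ 1 tt (record σ { out = out σ ++ b ∷ [] })
  Does-emit b {σ} .runs cs Z (rep p q c) le = cs , rep p q c
    , ≤-reflexive (trans (cong (length cs +_) (length-++ (out σ))) (sym (+-assoc (length cs) _ 1)))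
    , Run-≤ (κ-bound Z 4 (≤-trans (≤-reflexive (trans (cong (λ z → 1 + (length (out σ) + 1 + (1 + (z + 1)))) (length-reverse (out σ)))
        (solve 1 (λ o → con 1 :+ (o :+ con 1 :+ (con 1 :+ (o :+ con 1))) := con 4 :+ (o :+ o)) refl (length (out σ)))))
        (out-bound cs (out σ) 4 le)) (small 4 Z 4≤9)) (Run-emit b _ (out σ))
    where
    4≤9 : 4 ≤ 9
    4≤9 = s≤s (s≤s (s≤s (s≤s z≤n)))

  popCell : Sym → Maybe Bool × Sym × Move
  popCell blank   = nothing , blank , stay
  popCell (bit b) = just b , blank , left

  popRest : Maybe Bool → Mach (Maybe Bool)
  popRest nothing  = ret nothing
  popRest (just b) = seek left ≫ ret (just b)

  popM : Mach (Maybe Bool)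
  popM = moveR ≫ (seek right ≫ (moveL ≫ (cell popCell >>=[ fin-Maybe fin-Bool ] popRest)))

  Run-popM-end : ∀ L → Run popM (tape L blank []) 5 nothing (tape L blank [])
  Run-popM-end L = Run-to (mk≋ (λ _ → refl) refl (λ { zero → refl ; (suc i) → refl }))
    (Run-bind Run-moveR (Run-bind (Run-from (mk≋ {u = atR (blank ∷ L) (blank ∷ [])} (λ _ → refl) refl (λ _ → refl)) (Run-seekR []))
      (Run-bind Run-moveL (Run-bind (Run-cell popCell _ _ _) Run-ret))))

  Run-popM : ∀ b L o → Run popM (tape L blank (bits (o ++ b ∷ []))) (1 + (length (o ++ b ∷ []) + 1 + (1 + (1 + (length (reverse o) + 1 + 1))))) (just b)
    (tape L blank (bits o))
  Run-popM b L o = Run-to (mk≋ (λ _ → refl) refl (λ i → trans (cong (λ z → nth z i) (bits-reverse-ʳ++ o)) (trim i)))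
    (Run-bind Run-moveR (Run-bind
      (Run-from (mk≋ {u = atR (blank ∷ L) (bits ob ++ blank ∷ [])} (λ _ → refl) (hd-≈ {bits ob} {bits ob ++ blank ∷ []} ext) (tl-≈ {bits ob} {bits ob ++ blank ∷ []} ext)) (Run-seekR ob))
      (Run-bind (Run-to (≋-reflexive (cong (λ z → atL z (blank ∷ [])) split)) (Run-moveL {L = bits ob ʳ++ (blank ∷ L)}))
        (Run-bind (Run-to (≋-reflexive (move-left _ blank _)) (Run-cell popCell _ _ _))
          (Run-bind (Run-seekL (reverse o)) Run-ret)))))
    where
    ob = o ++ b ∷ []
    ext : bits ob ≈ bits ob ++ blank ∷ []
    ext i = sym (++blank-≈ (bits ob) i)
    split : bits ob ʳ++ (blank ∷ L) ≡ bit b ∷ bits (reverse o) ++ blank ∷ L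
    split = trans (bits-reverse ob) (cong (λ z → bits z ++ blank ∷ L) (reverse-++ o (b ∷ [])))
    trim : bits o ++ blank ∷ blank ∷ [] ≈ bits o
    trim i = trans (cong (λ z → nth z i) (sym (++-assoc (bits o) (blank ∷ []) (blank ∷ []))))
      (trans (++blank-≈ (bits o ++ blank ∷ []) i) (++blank-≈ (bits o) i))

  Does-pop-end : ∀ {σ} → out σ ≡ [] → Does popM σ 1 nothing σ
  Does-pop-end {σ} refl .runs cs Z r le = cs , r , m≤m+n _ 1 , Run-≤ (κ-bound Z 5 (m≤m+n 5 _) (small 5 Z (s≤s (s≤s (s≤s (s≤s (s≤s z≤n))))))) (Run-popM-end _)

  Does-pop : ∀ {σ} b o → out σ ≡ o ++ b ∷ [] → Does popM σ 1 (just b) (record σ { out = o })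
  Does-pop {σ} b o refl .runs cs Z (rep p q c) le = cs , rep p q c
    , ≤-trans (+-monoʳ-≤ (length cs) (≤-trans (m≤m+n (length o) 1) (≤-reflexive (sym (length-++ o))))) (m≤m+n _ 1)
    , Run-≤ (κ-bound Z 6 (≤-trans (≤-trans (≤-reflexive (cong (λ z → 1 + (length ob + 1 + (1 + (1 + (z + 1 + 1))))) (length-reverse o)))
        (≤-trans (+-monoʳ-≤ 1 (+-monoʳ-≤ (length ob + 1) (+-monoʳ-≤ 2 (+-monoˡ-≤ 1 (+-monoˡ-≤ 1 (≤-trans (m≤m+n (length o) 1) (≤-reflexive (sym (length-++ o)))))))))
        (≤-reflexive (solve 1 (λ o → con 1 :+ (o :+ con 1 :+ (con 1 :+ (con 1 :+ (o :+ con 1 :+ con 1)))) := con 6 :+ (o :+ o)) refl (length ob)))))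
        (out-bound cs ob 6 le)) (small 6 Z 6≤9)) (Run-popM b _ o)
    where
    ob = o ++ b ∷ []
    6≤9 : 6 ≤ 9
    6≤9 = s≤s (s≤s (s≤s (s≤s (s≤s (s≤s z≤n)))))

-- Loop programs

catFrom : ℕ → ℕ → (ℕ → List Bool) → List Bool
catFrom i zero    f = []
catFrom i (suc k) f = f i ++ catFrom (suc i) k f

sumFrom : ℕ → ℕ → (ℕ → ℕ) → ℕ
sumFrom i zero    f = 0
sumFrom i (suc k) f = f i + sumFrom (suc i) k f

-- In Code d the variables below d are readable; the counter of a loop at depth d is variable d.
data Code : ℕ → Set where
  skip : ∀ {d} → Code d
  emit : ∀ {d} → Bool → Code d
  _⨾_  : ∀ {d} → Code d → Code d → Code d
  for  : ∀ {d} → Fin d → Code (suc d) → Code d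
  ifx  : ∀ {d} → Fin d → Code d → Code d → Code d

infixr 5 _⨾_

⟦_⟧ : ∀ {d} → Code d → List Bool → (ℕ → ℕ) → List Bool
⟦ skip ⟧ x ρ          = []
⟦ emit b ⟧ x ρ        = b ∷ []
⟦ E ⨾ E' ⟧ x ρ        = ⟦ E ⟧ x ρ ++ ⟦ E' ⟧ x ρ
⟦ for {d} r E ⟧ x ρ   = catFrom 0 (ρ (toℕ r)) (λ i → ⟦ E ⟧ x (ρ [ d ↦ i ]))
⟦ ifx r E E' ⟧ x ρ    = if bitAt x (ρ (toℕ r)) then ⟦ E ⟧ x ρ else ⟦ E' ⟧ x ρ

-- The constants count operations of the compiled code: test, increment and `ret` in each round;
-- test, clearing and `ret` at the end. `ifx` is charged for both branches, so that the polynomial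
-- bound need not consult the input.
cost : ∀ {d} → Code d → List Bool → (ℕ → ℕ) → ℕ
cost skip x ρ          = 1
cost (emit b) x ρ      = 1
cost (E ⨾ E') x ρ      = cost E x ρ + cost E' x ρ
cost (for {d} r E) x ρ = sumFrom 0 (ρ (toℕ r)) (λ i → 1 + (cost E x (ρ [ d ↦ i ]) + (1 + 1))) + 3
cost (ifx r E E') x ρ  = 1 + (cost E x ρ + cost E' x ρ)

maxd : ∀ {d} → Code d → ℕ
maxd skip         = 0
maxd (emit b)     = 0
maxd (E ⨾ E')     = maxd E ⊔ maxd E'
maxd (for {d} r E) = suc d ⊔ maxd E
maxd (ifx r E E') = maxd E ⊔ maxd E'

-- `def E` sets the next variable to the number of bits that E emits.
data Prog : ℕ → Set where
  def  : ∀ {d} → Code d → Prog (suc d) → Prog d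
  main : ∀ {d} → Code d → Prog d

⟦_⟧ᴾ : ∀ {d} → Prog d → List Bool → (ℕ → ℕ) → List Bool
⟦ def {d} E P ⟧ᴾ x ρ = ⟦ P ⟧ᴾ x (ρ [ d ↦ length (⟦ E ⟧ x ρ) ])
⟦ main E ⟧ᴾ x ρ      = ⟦ E ⟧ x ρ

costᴾ : ∀ {d} → Prog d → List Bool → (ℕ → ℕ) → ℕ
costᴾ (def {d} E P) x ρ = cost E x ρ + ((length (⟦ E ⟧ x ρ) * 3 + 3) + costᴾ P x (ρ [ d ↦ length (⟦ E ⟧ x ρ) ]))
costᴾ (main E) x ρ      = cost E x ρ

maxᴾ : ∀ {d} → Prog d → ℕ
maxᴾ (def {d} E P) = maxd E ⊔ (suc d ⊔ maxᴾ P)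
maxᴾ (main E)      = maxd E

-- The same code is compiled either to print or to count its output in the track `ACC`; counting is
-- how `def` obtains new loop bounds.
data Sink : Set where
  toOut toAcc : Sink

accOf : Sink → List Bool → ℕ → ℕ
accOf toOut bs a = a
accOf toAcc bs a = length bs + a

outOf : Sink → List Bool → List Bool → List Bool
outOf toOut bs o = o ++ bs
outOf toAcc bs o = o

feed : Sink → List Bool → St → St
feed s bs σ = st (inp σ) (accOf s bs (acc σ)) (outOf s bs (out σ)) (env σ)

withEnv : St → (ℕ → ℕ) → St
withEnv σ ρ = st (inp σ) (acc σ) (out σ) ρ

-- Compilation of loop programs

module Compile (n : ℕ) where
  open Memory n

  feed-[] : ∀ s {σ} → σ ≐ feed s [] σ
  feed-[] toOut {σ} = refl , refl , sym (++-identityʳ (out σ)) , λ _ → refl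
  feed-[] toAcc = refl , refl , refl , λ _ → refl

  feed-++ : ∀ s as bs {σ} → feed s bs (feed s as σ) ≐ feed s (as ++ bs) σ
  feed-++ toOut as bs {σ} = refl , refl , ++-assoc (out σ) as bs , λ _ → refl
  feed-++ toAcc as bs {σ} = refl , trans (sym (+-assoc (length bs) (length as) _))
    (cong (_+ acc σ) (trans (+-comm (length bs) _) (sym (length-++ as)))) , refl , λ _ → refl

  Does-from : ∀ {E} {M : Mach E} {σ o e σ' σ''} → σ'' ≐ σ → Does M σ o e σ' → Does M σ'' o e σ'
  Does-from q@(refl , refl , refl , _) D .runs cs Z r le = runs D cs Z (Rep-≐ q r) le

  ≐-refl-env : ∀ {σ ρ ρ'} → (∀ l → ρ l ≡ ρ' l) → withEnv σ ρ ≐ withEnv σ ρ'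
  ≐-refl-env e = refl , refl , refl , e

  ↦↦ : ∀ ρ d i j l → ((ρ [ d ↦ i ]) [ d ↦ j ]) l ≡ (ρ [ d ↦ j ]) l
  ↦↦ ρ d i j l with l ≟ d
  ... | yes _ = refl
  ... | no ne = ↦-other ρ d i ne

  ↦-id : ∀ ρ d {v} → ρ d ≡ v → ∀ l → (ρ [ d ↦ v ]) l ≡ ρ l
  ↦-id ρ d e l with l ≟ d
  ... | yes refl = sym e
  ... | no ne = refl

  ↦-suc : ∀ ρ d i l → ((ρ [ d ↦ i ]) [ d ↦ suc ((ρ [ d ↦ i ]) d) ]) l ≡ (ρ [ d ↦ suc i ]) l
  ↦-suc ρ d i l = trans (↦↦ ρ d i _ l) (cong (λ v → (ρ [ d ↦ suc v ]) l) (↦-same ρ d i))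

  sinkM : Sink → Bool → Mach ⊤
  sinkM toOut b = emitM b
  sinkM toAcc b = scan (incOp ACC) tt

  Does-sink : ∀ s b {σ} → Does (sinkM s b) σ 1 tt (feed s (b ∷ []) σ)
  Does-sink toOut b = Does-emit b
  Does-sink toAcc b = Does-incAcc

  readable : ∀ {d} → d ≤ n → Fin d → Track
  readable p r = lev (≤-trans (toℕ<n r) p)

  comp  : ∀ {d} (s : Sink) (E : Code d) → d ≤ n → maxd E ≤ n → Mach ⊤
  loopM : ∀ {d} (s : Sink) (E : Code (suc d)) → Track → suc d ≤ n → maxd E ≤ n → ⊤ → Mach (⊤ ⊎ ⊤)
  loopK : ∀ {d} (s : Sink) (E : Code (suc d)) → suc d ≤ n → maxd E ≤ n → Bool → Mach (⊤ ⊎ ⊤)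

  comp s skip p q        = ret tt
  comp s (emit b) p q    = sinkM s b
  comp s (E ⨾ E') p q    = comp s E p (m⊔n≤o⇒m≤o (maxd E) (maxd E') q) ≫ comp s E' p (m⊔n≤o⇒n≤o (maxd E) (maxd E') q)
  comp s (for {d} r E) p q = iter fin-⊤ (loopM s E (readable p r) (m⊔n≤o⇒m≤o (suc d) (maxd E) q) (m⊔n≤o⇒n≤o (suc d) (maxd E) q)) tt
  comp s (ifx r E E') p q = scan (testOp (readable p r) X) tt >>=[ fin-Bool ] λ where
    true  → comp s E p (m⊔n≤o⇒m≤o (maxd E) (maxd E') q)
    false → comp s E' p (m⊔n≤o⇒n≤o (maxd E) (maxd E') q)

  loopM s E t p q _ = scan (testOp (lev p) t) tt >>=[ fin-Bool ] loopK s E p q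

  loopK s E p q true  = comp s E p q ≫ (scan (incOp (lev p)) tt ≫ ret (inj₁ tt))
  loopK s E p q false = scan (clearOp (lev p)) tt ≫ ret (inj₂ tt)

  <ᵇ-irrefl : ∀ i → (i <ᵇ i) ≡ false
  <ᵇ-irrefl zero    = refl
  <ᵇ-irrefl (suc i) = <ᵇ-irrefl i

  <ᵇ-+ : ∀ i k → (i <ᵇ i + suc k) ≡ true
  <ᵇ-+ zero    k = refl
  <ᵇ-+ (suc i) k = <ᵇ-+ i k

  -- Loops rely on this: they never initialise their counter, but clear it on leaving.
  Fresh : ℕ → (ℕ → ℕ) → Set
  Fresh d ρ = ∀ l → d ≤ l → ρ l ≡ 0

  Fresh-↦ : ∀ {d ρ} i → Fresh d ρ → Fresh (suc d) (ρ [ d ↦ i ])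
  Fresh-↦ {d} {ρ} i f l le = trans (↦-other ρ d i (λ { refl → <-irrefl refl le })) (f l (<⇒≤ le))

  exec : ∀ {d} s (E : Code d) p q {σ} → Fresh d (env σ) →
         Does (comp s E p q) σ (cost E (inp σ) (env σ)) tt (feed s (⟦ E ⟧ (inp σ) (env σ)) σ)

  -- i rounds are over and k remain. The tape counter that controls the loop is also the variable
  -- that E reads.
  exec-loop : ∀ {d} s (E : Code (suc d)) (r : Fin d) p q q' {σ} k i → i + k ≡ env σ (toℕ r) → Fresh d (env σ) →
    Does (iter fin-⊤ (loopM s E (readable p r) q q') tt) (withEnv σ (env σ [ d ↦ i ]))
      (sumFrom i k (λ i → 1 + (cost E (inp σ) (env σ [ d ↦ i ]) + (1 + 1))) + 3) tt
      (feed s (catFrom i k (λ i → ⟦ E ⟧ (inp σ) (env σ [ d ↦ i ]))) σ)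

  exec s skip p q f = Does-to (feed-[] s) Does-ret
  exec s (emit b) p q f = Does-sink s b
  exec s (E ⨾ E') p q {σ} f = Does-to (feed-++ s (⟦ E ⟧ (inp σ) (env σ)) (⟦ E' ⟧ (inp σ) (env σ)))
    (Does-bind (exec s E p _ f) (exec s E' p _ f))
  exec s (for {d} r E) p q {σ} f = Does-from (≐-refl-env {σ} (λ l → sym (↦-id (env σ) d (f d ≤-refl) l)))
    (exec-loop s E r p _ _ (env σ (toℕ r)) 0 refl f)
  exec s (ifx r E E') p q {σ} f with bitAt (inp σ) (env σ (toℕ r)) in eq
  ... | true  = Does-≤ (+-monoʳ-≤ 1 (m≤m+n _ _)) (Does-bind (Does-test (≤-trans (toℕ<n r) p) X {σ} (λ cs ρ → trans (Rep.repX ρ _) eq)) (exec s E p _ f))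
  ... | false = Does-≤ (+-monoʳ-≤ 1 (m≤n+m _ (cost E (inp σ) (env σ)))) (Does-bind (Does-test (≤-trans (toℕ<n r) p) X {σ} (λ cs ρ → trans (Rep.repX ρ _) eq)) (exec s E' p _ f))

  exec-loop {d} s E r p q q' {σ} zero i e f = Does-iter-done (Does-to last (Does-bind (Does-test q (readable p r) {σᵢ} test) (Does-bind (Does-clear q {σᵢ}) Does-ret)))
    where
    σᵢ = withEnv σ (env σ [ d ↦ i ])
    last : withEnv σ ((env σ [ d ↦ i ]) [ d ↦ 0 ]) ≐ feed s [] σ
    last with feed-[] s {σ}
    ... | a , b , c , _ = a , b , c , λ l → trans (↦↦ (env σ) d i 0 l) (↦-id (env σ) d (f d ≤-refl) l)
    test : ∀ cs → Rep cs σᵢ → get cs ((env σ [ d ↦ i ]) d) (readable p r) ≡ false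
    test cs ρ = trans (lev-unary {σ = σᵢ} (≤-trans (toℕ<n r) p) ρ _) (trans (cong₂ _<ᵇ_ (↦-same (env σ) d i)
      (trans (↦-other (env σ) d i (λ h → <-irrefl h (toℕ<n r))) (trans (sym e) (+-identityʳ i)))) (<ᵇ-irrefl i))
  exec-loop {d} s E r p q q' {σ} (suc k) i e f = Does-≤ (≤-reflexive (sym (+-assoc (1 + (cost E (inp σ) (env σ [ d ↦ i ]) + (1 + 1))) _ 3)))
    (Does-to (let a , b , c , g = feed-++ s (⟦ E ⟧ (inp σ) (env σ [ d ↦ i ])) _ {σ} in a , b , c , g)
      (Does-iter-more
        (Does-bind (Does-test q (readable p r) {σᵢ} test)
          (Does-bind (exec s E q q' {σᵢ} (Fresh-↦ i f))
            (Does-bind (Does-to (≐-refl-env {feed s (⟦ E ⟧ (inp σ) (env σ [ d ↦ i ])) σ} (↦-suc (env σ) d i)) (Does-inc q {feed s (⟦ E ⟧ (inp σ) (env σ [ d ↦ i ])) σᵢ})) Does-ret)))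
        (exec-loop s E r p q q' {feed s (⟦ E ⟧ (inp σ) (env σ [ d ↦ i ])) σ} k (suc i) (trans (sym (+-suc i k)) e) f)))
    where
    σᵢ = withEnv σ (env σ [ d ↦ i ])
    test : ∀ cs → Rep cs σᵢ → get cs ((env σ [ d ↦ i ]) d) (readable p r) ≡ true
    test cs ρ = trans (lev-unary {σ = σᵢ} (≤-trans (toℕ<n r) p) ρ _) (trans (cong₂ _<ᵇ_ (↦-same (env σ) d i)
      (trans (↦-other (env σ) d i (λ h → <-irrefl h (toℕ<n r))) (sym e))) (<ᵇ-+ i k))

  copyK : ∀ {d} → d < n → Bool → Mach (⊤ ⊎ ⊤)
  copyK p true  = scan (incOp (lev p)) tt ≫ ret (inj₁ tt)
  copyK p false = scan (clearOp ACC) tt ≫ ret (inj₂ tt)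

  copyM : ∀ {d} → d < n → ⊤ → Mach (⊤ ⊎ ⊤)
  copyM p _ = scan (testOp (lev p) ACC) tt >>=[ fin-Bool ] copyK p

  -- `ACC` has to be free for the next `def`. The new counter is raised until it is no longer below
  -- `ACC`, which is then cleared.
  exec-copy : ∀ {d} (p : d < n) {σ} k i → i + k ≡ acc σ →
    Does (iter fin-⊤ (copyM p) tt) (withEnv σ (env σ [ d ↦ i ])) (k * 3 + 3) tt
      (st (inp σ) 0 (out σ) (env σ [ d ↦ acc σ ]))
  exec-copy {d} p {σ} zero i e = Does-iter-done (Does-to (refl , refl , refl , λ l → cong (λ v → (env σ [ d ↦ v ]) l) (trans (sym (+-identityʳ i)) e))
    (Does-bind (Does-test p ACC {σᵢ} (λ cs ρ → trans (Rep.repA ρ _) (trans (cong₂ _<ᵇ_ (↦-same (env σ) d i) (trans (sym e) (+-identityʳ i))) (<ᵇ-irrefl i))))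
      (Does-bind (Does-clearAcc {σᵢ}) Does-ret)))
    where σᵢ = withEnv σ (env σ [ d ↦ i ])
  exec-copy {d} p {σ} (suc k) i e = Does-iter-more
    (Does-bind (Does-test p ACC {σᵢ} (λ cs ρ → trans (Rep.repA ρ _) (trans (cong₂ _<ᵇ_ (↦-same (env σ) d i) (sym e)) (<ᵇ-+ i k))))
      (Does-bind (Does-to (≐-refl-env {σ} (↦-suc (env σ) d i)) (Does-inc p {σᵢ})) Does-ret))
    (exec-copy p {σ} k (suc i) (trans (sym (+-suc i k)) e))
    where σᵢ = withEnv σ (env σ [ d ↦ i ])

  compᴾ : ∀ {d} (P : Prog d) → d ≤ n → maxᴾ P ≤ n → Mach ⊤
  compᴾ (def {d} E P) p q = let q' = m⊔n≤o⇒n≤o (maxd E) (suc d ⊔ maxᴾ P) q in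
    comp toAcc E p (m⊔n≤o⇒m≤o (maxd E) (suc d ⊔ maxᴾ P) q) ≫ (iter fin-⊤ (copyM (m⊔n≤o⇒m≤o (suc d) (maxᴾ P) q')) tt ≫ compᴾ P (m⊔n≤o⇒m≤o (suc d) (maxᴾ P) q') (m⊔n≤o⇒n≤o (suc d) (maxᴾ P) q'))
  compᴾ (main E) p q = comp toOut E p q

  execᴾ : ∀ {d} (P : Prog d) p q {σ} → Fresh d (env σ) → acc σ ≡ 0 → ∃ λ σ' →
    out σ' ≡ out σ ++ ⟦ P ⟧ᴾ (inp σ) (env σ) × Does (compᴾ P p q) σ (costᴾ P (inp σ) (env σ)) tt σ'
  execᴾ (main E) p q f e = _ , refl , exec toOut E p q f
  execᴾ (def {d} E P) p q {σ} f refl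
    with execᴾ P (m⊔n≤o⇒m≤o (suc d) (maxᴾ P) (m⊔n≤o⇒n≤o (maxd E) (suc d ⊔ maxᴾ P) q)) (m⊔n≤o⇒n≤o (suc d) (maxᴾ P) (m⊔n≤o⇒n≤o (maxd E) (suc d ⊔ maxᴾ P) q))
      {st (inp σ) 0 (out σ) (env σ [ d ↦ length (⟦ E ⟧ (inp σ) (env σ)) ])} (Fresh-↦ _ f) refl
  ... | σ' , o , D = σ' , o , Does-bind (exec toAcc E p _ f) (Does-bind
      (Does-to (refl , refl , refl , λ l → cong (λ v → (env σ [ d ↦ v ]) l) (+-identityʳ (length bs)))
        (Does-≤ (≤-reflexive (cong (λ v → v * 3 + 3) (+-identityʳ (length bs))))
        (Does-from (≐-refl-env {feed toAcc bs σ} (λ l → sym (↦-id (env σ) d (f d ≤-refl) l))) (exec-copy (m⊔n≤o⇒m≤o (suc d) (maxᴾ P) (m⊔n≤o⇒n≤o (maxd E) (suc d ⊔ maxᴾ P) q)) {feed toAcc bs σ} (length bs + 0) 0 refl)))) D)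
    where bs = ⟦ E ⟧ (inp σ) (env σ)

-- Polynomial bounds

data Pol : Set where
  var     : Pol
  num     : ℕ → Pol
  _⊕_ _⊗_ : Pol → Pol → Pol

infixl 6 _⊕_
infixl 7 _⊗_

val : Pol → ℕ → ℕ
val var     m = m
val (num k) m = k
val (p ⊕ q) m = val p m + val q m
val (p ⊗ q) m = val p m * val q m

_⟨_⟩ : Pol → Pol → Pol
var     ⟨ r ⟩ = r
num k   ⟨ r ⟩ = num k
(p ⊕ q) ⟨ r ⟩ = p ⟨ r ⟩ ⊕ q ⟨ r ⟩
(p ⊗ q) ⟨ r ⟩ = p ⟨ r ⟩ ⊗ q ⟨ r ⟩

val-⟨⟩ : ∀ p r m → val (p ⟨ r ⟩) m ≡ val p (val r m)
val-⟨⟩ var     r m = refl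
val-⟨⟩ (num k) r m = refl
val-⟨⟩ (p ⊕ q) r m = cong₂ _+_ (val-⟨⟩ p r m) (val-⟨⟩ q r m)
val-⟨⟩ (p ⊗ q) r m = cong₂ _*_ (val-⟨⟩ p r m) (val-⟨⟩ q r m)

-- These are exponents of 2 + m. As the base is at least 2, a numeral k is below the k-th power, and
-- the factor 2 from bounding a sum costs one more power.
degree : Pol → ℕ
degree var     = 1
degree (num k) = k
degree (p ⊕ q) = suc (degree p + degree q)
degree (p ⊗ q) = degree p + degree q

n<2^n : ∀ n → n < 2 ^ n
n<2^n zero    = s≤s z≤n
n<2^n (suc n) = ≤-trans (s≤s (n<2^n n)) (≤-trans (+-monoˡ-≤ (2 ^ n) (m^n>0 2 n)) (+-monoʳ-≤ (2 ^ n) (≤-reflexive (sym (+-identityʳ _)))))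

val-degree : ∀ p m → val p m ≤ (2 + m) ^ degree p
val-degree var     m = ≤-trans (m≤n+m m 2) (≤-reflexive (sym (*-identityʳ (2 + m))))
val-degree (num k) m = ≤-trans (<⇒≤ (n<2^n k)) (^-monoˡ-≤ k (m≤m+n 2 m))
val-degree (p ⊕ q) m = begin
  val p m + val q m         ≤⟨ +-mono-≤ (≤-trans (val-degree p m) (^-monoʳ-≤ (2 + m) (m≤m+n a b))) (≤-trans (val-degree q m) (^-monoʳ-≤ (2 + m) (m≤n+m b a))) ⟩
  t + t                     ≡⟨ cong (t +_) (sym (+-identityʳ t)) ⟩
  2 * t                     ≤⟨ *-monoˡ-≤ t (m≤m+n 2 m) ⟩
  (2 + m) * t               ∎
  where
  open ≤-Reasoning
  a = degree p
  b = degree q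
  t = (2 + m) ^ (a + b)
val-degree (p ⊗ q) m = ≤-trans (*-mono-≤ (val-degree p m) (val-degree q m)) (≤-reflexive (sym (^-distribˡ-+-* (2 + m) (degree p) (degree q))))

-- From m = 2 on, 2 + m is at most the square of m; for m = 0 and m = 1 the summand 3 ^ d of the
-- constant is enough.
pow-≤-poly : ∀ d m → (2 + m) ^ d ≤ poly (2 * d + 3 ^ d) m
pow-≤-poly d zero          = ≤-trans (^-monoˡ-≤ d (s≤s (s≤s z≤n))) (≤-trans (m≤n+m (3 ^ d) (2 * d)) (m≤n+m _ (0 ^ (2 * d + 3 ^ d))))
pow-≤-poly d (suc zero)    = ≤-trans (m≤n+m (3 ^ d) (2 * d)) (m≤n+m _ (1 ^ (2 * d + 3 ^ d)))
pow-≤-poly d (suc (suc k)) = begin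
  (4 + k) ^ d                 ≤⟨ ^-monoˡ-≤ d le ⟩
  ((2 + k) ^ 2) ^ d           ≡⟨ ^-*-assoc (2 + k) 2 d ⟩
  (2 + k) ^ (2 * d)           ≤⟨ ^-monoʳ-≤ (2 + k) (m≤m+n (2 * d) (3 ^ d)) ⟩
  (2 + k) ^ (2 * d + 3 ^ d)   ≤⟨ m≤m+n _ _ ⟩
  poly (2 * d + 3 ^ d) (2 + k) ∎
  where
  open ≤-Reasoning
  le : 4 + k ≤ (2 + k) ^ 2
  le = le-by (k * k + 3 * k) (solve 1 (λ k → con 4 :+ k :+ (k :* k :+ con 3 :* k) := (con 2 :+ k) :* ((con 2 :+ k) :* con 1)) refl k)

-- Abstract, since otherwise the type checker unfolds the powers of numerals that occur here.
abstract
  val-poly : ∀ p → ∃ λ c → ∀ m → val p m ≤ poly c m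
  val-poly p = 2 * degree p + 3 ^ degree p , λ m → ≤-trans (val-degree p m) (pow-≤-poly (degree p) m)

costPol : ∀ {d} → Code d → Pol
costPol skip         = num 1
costPol (emit b)     = num 1
costPol (E ⨾ E')     = costPol E ⊕ costPol E'
costPol (for r E)    = var ⊗ (num 3 ⊕ costPol E) ⊕ num 3
costPol (ifx r E E') = num 1 ⊕ (costPol E ⊕ costPol E')

-- After `def E` the variables are bounded no longer by m but by m plus the length of what E emits,
-- hence the substitution.
costPolᴾ : ∀ {d} → Prog d → Pol
costPolᴾ (def E P) = costPol E ⊕ (costPol E ⊗ num 3 ⊕ num 3 ⊕ costPolᴾ P ⟨ var ⊕ costPol E ⟩)
costPolᴾ (main E)  = costPol E

Below : ℕ → (ℕ → ℕ) → ℕ → Set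
Below d ρ m = ∀ l → l < d → ρ l ≤ m

Below-↦ : ∀ {d ρ m v} → Below d ρ m → v ≤ m → Below (suc d) (ρ [ d ↦ v ]) m
Below-↦ {d} {ρ} {m} b v≤m = ↦-cong ρ d _ (λ l w → l < suc d → w ≤ m) (λ _ → v≤m)
  (λ { l ne (s≤s le) → b l (≤∧≢⇒< le ne) })

sumFrom-≤ : ∀ i k f M → (∀ j → j < i + k → f j ≤ M) → sumFrom i k f ≤ k * M
sumFrom-≤ i zero    f M h = z≤n
sumFrom-≤ i (suc k) f M h = +-mono-≤ (h i (≤-trans (s≤s (m≤m+n i k)) (≤-reflexive (sym (+-suc i k)))))
  (sumFrom-≤ (suc i) k f M (λ j lt → h j (≤-trans lt (≤-reflexive (sym (+-suc i k))))))

cost-≤ : ∀ {d} (E : Code d) x {ρ m} → Below d ρ m → cost E x ρ ≤ val (costPol E) m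
cost-≤ skip         x b = ≤-refl
cost-≤ (emit _)     x b = ≤-refl
cost-≤ (E ⨾ E')     x b = +-mono-≤ (cost-≤ E x b) (cost-≤ E' x b)
cost-≤ (for {d} r E) x {ρ} {m} b = +-monoˡ-≤ 3 (≤-trans
  (sumFrom-≤ 0 (ρ (toℕ r)) _ (3 + val (costPol E) m) (λ j lt → s≤s (≤-trans (≤-reflexive (+-comm (cost E x (ρ [ d ↦ j ])) 2))
    (+-monoʳ-≤ 2 (cost-≤ E x (Below-↦ b (≤-trans (<⇒≤ lt) (b (toℕ r) (toℕ<n r)))))))))
  (*-monoˡ-≤ (3 + val (costPol E) m) (b (toℕ r) (toℕ<n r))))
cost-≤ (ifx r E E') x b = s≤s (+-mono-≤ (cost-≤ E x b) (cost-≤ E' x b))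

length-catFrom : ∀ i k f g → (∀ j → length (f j) ≤ g j) → length (catFrom i k f) ≤ sumFrom i k g
length-catFrom i zero    f g h = z≤n
length-catFrom i (suc k) f g h = ≤-trans (≤-reflexive (length-++ (f i))) (+-mono-≤ (h i) (length-catFrom (suc i) k f g h))

length-≤ : ∀ {d} (E : Code d) x ρ → length (⟦ E ⟧ x ρ) ≤ cost E x ρ
length-≤ skip     x ρ = z≤n
length-≤ (emit _) x ρ = ≤-refl
length-≤ (E ⨾ E') x ρ = ≤-trans (≤-reflexive (length-++ (⟦ E ⟧ x ρ))) (+-mono-≤ (length-≤ E x ρ) (length-≤ E' x ρ))
length-≤ (for {d} r E) x ρ = ≤-trans (length-catFrom 0 (ρ (toℕ r)) _ _ (λ j → m≤n⇒m≤1+n (≤-trans (length-≤ E x (ρ [ d ↦ j ])) (m≤m+n _ 2)))) (m≤m+n _ 3)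
length-≤ (ifx r E E') x ρ with bitAt x (ρ (toℕ r))
... | true  = m≤n⇒m≤1+n (≤-trans (length-≤ E x ρ) (m≤m+n _ _))
... | false = m≤n⇒m≤1+n (≤-trans (length-≤ E' x ρ) (m≤n+m _ (cost E x ρ)))

cost-≤ᴾ : ∀ {d} (P : Prog d) x {ρ m} → Below d ρ m → costᴾ P x ρ ≤ val (costPolᴾ P) m
cost-≤ᴾ (main E) x b = cost-≤ E x b
cost-≤ᴾ (def {d} E P) x {ρ} {m} b = +-mono-≤ (cost-≤ E x b) (+-mono-≤ (+-monoˡ-≤ 3 (*-monoˡ-≤ 3 len))
  (≤-trans (cost-≤ᴾ P x (Below-↦ {v = length (⟦ E ⟧ x ρ)} (λ l lt → ≤-trans (b l lt) (m≤m+n m _)) (≤-trans len (m≤n+m _ m))))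
    (≤-reflexive (sym (val-⟨⟩ (costPolᴾ P) (var ⊕ costPol E) m)))))
  where
  len : length (⟦ E ⟧ x ρ) ≤ val (costPol E) m
  len = ≤-trans (length-≤ E x ρ) (cost-≤ E x b)

-- Every program runs in polynomial time

inputEnv : List Bool → ℕ → ℕ
inputEnv x = (λ _ → 0) [ 0 ↦ length x ]

module Whole (P : Prog 1) where

  n : ℕ
  n = suc (maxᴾ P)

  open Memory n
  open Compile n

  0<n : 0 < n
  0<n = s≤s z≤n

  -- The input is taken from the output area bit by bit, the last bit first; level 0 counts the bits.
  loadK : Maybe Bool → Mach (⊤ ⊎ ⊤)
  loadK nothing  = ret (inj₂ tt)
  loadK (just b) = scan pushOp b ≫ (scan (incOp (lev 0<n)) tt ≫ ret (inj₁ tt))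

  loadM : ⊤ → Mach (⊤ ⊎ ⊤)
  loadM _ = popM >>=[ fin-Maybe fin-Bool ] loadK

  loaded : List Bool → List Bool → St
  loaded y o = st y 0 o (inputEnv y)

  Does-load : ∀ zs y → Does (iter fin-⊤ loadM tt) (loaded y (reverse zs)) (length zs * 4 + 2) tt (loaded (reverse zs ++ y) [])
  Does-load [] y = Does-iter-done (Does-bind (Does-pop-end refl) Does-ret)
  Does-load (z ∷ zs) y = subst (λ w → Does (iter fin-⊤ loadM tt) (loaded y (reverse (z ∷ zs))) (length (z ∷ zs) * 4 + 2) tt (loaded w []))
    (trans (sym (++-assoc (reverse zs) (z ∷ []) y)) (cong (_++ y) (sym (unfold-reverse z zs))))
    (Does-iter-more
      (Does-bind (Does-pop z (reverse zs) (unfold-reverse z zs))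
        (Does-bind (Does-push {loaded y (reverse zs)} z)
          (Does-bind (Does-to (≐-refl-env {loaded (z ∷ y) (reverse zs)} (↦-suc (λ _ → 0) 0 (length y))) (Does-inc 0<n {st (z ∷ y) 0 (reverse zs) (inputEnv y)})) Does-ret)))
      (Does-load zs (z ∷ y)))

  p₁ : 1 ≤ n
  p₁ = s≤s z≤n

  p₂ : maxᴾ P ≤ n
  p₂ = n≤1+n _

  ops : List Bool → ℕ
  ops x = length x * 4 + 2 + costᴾ P x (inputEnv x)

  Does-all : ∀ x → ∃ λ σ' → out σ' ≡ ⟦ P ⟧ᴾ x (inputEnv x) ×
    Does (iter fin-⊤ loadM tt ≫ compᴾ P p₁ p₂) (loaded [] x) (ops x) tt σ'
  Does-all x with execᴾ P p₁ p₂ {loaded x []} (Fresh-↦ {0} (length x) (λ _ _ → refl)) refl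
  ... | σ' , o , D = σ' , o , Does-bind load D
    where
    load : Does (iter fin-⊤ loadM tt) (loaded [] x) (length x * 4 + 2) tt (loaded x [])
    load = subst₂ (λ a b → Does (iter fin-⊤ loadM tt) (loaded [] a) (b * 4 + 2) tt (loaded x [])) (reverse-involutive x) (length-reverse x)
      (subst (λ w → Does (iter fin-⊤ loadM tt) (loaded [] (reverse (reverse x))) (length (reverse x) * 4 + 2) tt (loaded w []))
        (trans (++-identityʳ _) (reverse-involutive x)) (Does-load (reverse x) []))

  -- One step to the left makes the input the output area of an empty memory; the step to the right
  -- at the end puts the head on the first bit of the output.
  machine : Mach ⊤
  machine = moveL ≫ ((iter fin-⊤ loadM tt ≫ compᴾ P p₁ p₂) ≫ moveR)

  opsPol timePol : Pol
  opsPol = var ⊗ num 4 ⊕ num 2 ⊕ costPolᴾ P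
  timePol = num 1 ⊕ (opsPol ⊗ (num κ ⊗ (num 1 ⊕ (var ⊕ opsPol))) ⊕ num 1)

  ops-≤ : ∀ x → ops x ≤ val opsPol (length x)
  ops-≤ x = +-monoʳ-≤ (length x * 4 + 2) (cost-≤ᴾ P x (Below-↦ {0} (λ _ ()) ≤-refl))

  run-machine : ∀ x → ∃ λ t' → Run machine (atR [] (bits x)) (poly (proj₁ (val-poly timePol)) (length x)) tt t'
    × readBits (Tape.head t' ∷ Tape.rights t') ≡ ⟦ P ⟧ᴾ x (inputEnv x)
  run-machine x with Does-all x
  ... | σ' , o , D with runs D [] (length x + val opsPol (length x)) (rep (λ _ → refl) (λ _ → refl) (λ l i → env0 (toℕ l) i)) (+-monoʳ-≤ (length x) (ops-≤ x))
    where
    env0 : ∀ l i → false ≡ (i <ᵇ inputEnv [] l)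
    env0 l i = cong (i <ᵇ_) (sym (↦-id (λ _ → 0) 0 refl l))
  ... | cs , _ , _ , run = _ ,
    Run-≤ (≤-trans (s≤s (+-monoˡ-≤ 1 (*-monoˡ-≤ (κ * suc (length x + val opsPol (length x))) (ops-≤ x)))) (proj₂ (val-poly timePol) (length x)))
      (Run-bind (Run-to (mk≋ {u = centre {suc n} [] (bits x)} (λ { zero → refl ; (suc i) → refl }) refl (hd∷tl-≈ (bits x))) Run-moveL)
        (Run-bind run Run-moveR))
    , trans (readBits-≈ (hd (bits (out σ')) ∷ tl (bits (out σ'))) (hd∷tl-≈ (bits (out σ')))) (trans (readBits-map (out σ')) o)

Prog-polyTime : (P : Prog 1) → PolyTime (λ x → ⟦ P ⟧ᴾ x (inputEnv x))
Prog-polyTime P = polyTime (Whole.machine P) (λ x → ⟦ P ⟧ᴾ x (inputEnv x)) (proj₁ (val-poly (Whole.timePol P))) (Whole.run-machine P)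

-- Networks of negated positive formulas

data PF : Set where
  pvar  : ℕ → PF
  pconj : PF → PF → PF
  pdisj : PF → PF → PF

evalP : PF → (ℕ → Bool) → Bool
evalP (pvar k)    y = y k
evalP (pconj p q) y = evalP p y ∧ evalP q y
evalP (pdisj p q) y = evalP p y ∨ evalP q y

AllP : (ℕ → Set) → PF → Set
AllP P (pvar k)    = P k
AllP P (pconj p q) = AllP P p × AllP P q
AllP P (pdisj p q) = AllP P p × AllP P q

evalP-cong : ∀ {P : ℕ → Set} p {y z} → AllP P p → (∀ k → P k → y k ≡ z k) → evalP p y ≡ evalP p z
evalP-cong (pvar k)    a       e = e k a
evalP-cong (pconj p q) (a , b) e = cong₂ _∧_ (evalP-cong p a e) (evalP-cong q b e)
evalP-cong (pdisj p q) (a , b) e = cong₂ _∨_ (evalP-cong p a e) (evalP-cong q b e)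

∨-true : ∀ {a b} → a ∨ b ≡ true → a ≡ true ⊎ b ≡ true
∨-true {true}  e = inj₁ refl
∨-true {false} e = inj₂ e

∧-true : ∀ {a b} → a ∧ b ≡ true → a ≡ true × b ≡ true
∧-true {true} e = refl , e

∨-false : ∀ {a b} → a ∨ b ≡ false → a ≡ false × b ≡ false
∨-false {false} e = refl , e

not-true : ∀ {a} → not a ≡ true → a ≡ false
not-true {false} e = refl

not-false : ∀ {a} → not a ≡ false → a ≡ true
not-false {true} e = refl

evalP-true : ∀ {P : ℕ → Set} p {y} → AllP P p → evalP p y ≡ true → ∃ λ k → P k × y k ≡ true
evalP-true (pvar k) a e = k , a , e
evalP-true (pconj p q) (a , b) e = evalP-true p a (proj₁ (∧-true e))
evalP-true (pdisj p q) (a , b) e with ∨-true e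
... | inj₁ e' = evalP-true p a e'
... | inj₂ e' = evalP-true q b e'

≤-true : ∀ {a b} → a Data.Bool.≤ b → a ≡ true → b ≡ true
≤-true Data.Bool.b≤b e = e

evalP-mono : ∀ p {y z} → (∀ k → y k ≡ true → z k ≡ true) → evalP p y ≡ true → evalP p z ≡ true
evalP-mono (pvar k)    h e = h k e
evalP-mono (pconj p q) h e = let a , b = ∧-true e in cong₂ _∧_ (evalP-mono p h a) (evalP-mono q h b)
evalP-mono (pdisj p q) {z = z} h e with ∨-true e
... | inj₁ e' = cong (_∨ evalP q z) (evalP-mono p h e')
... | inj₂ e' = trans (cong (evalP p z ∨_) (evalP-mono q h e')) (∨-zeroʳ (evalP p z))

module Network (m : ℕ) (ψ : ℕ → PF) (bounded : ∀ k → k < suc m → AllP (_< suc m) (ψ k)) where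

  n : ℕ
  n = suc m

  -- Only numbers below n matter; the others are sent to variable 0.
  clamp : ℕ → Fin n
  clamp k with k <? n
  ... | yes p = fromℕ< p
  ... | no  _ = zero

  toℕ-clamp : ∀ {k} → k < n → toℕ (clamp k) ≡ k
  toℕ-clamp {k} p with k <? n
  ... | yes q = toℕ-fromℕ< q
  ... | no ¬q = ⊥-elim (¬q p)

  clamp-toℕ : ∀ i → clamp (toℕ i) ≡ i
  clamp-toℕ i = toℕ-injective (toℕ-clamp (toℕ<n i))

  form : PF → Formula n
  form (pvar k)    = var (clamp k)
  form (pconj p q) = conj (form p) (form q)
  form (pdisj p q) = disj (form p) (form q)

  rule : ℕ → PF
  rule k = pdisj (pvar 0) (ψ k)

  local : ℕ → Formula n
  local k = neg (form (rule k))

  instance′ : Instance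
  instance′ = mkInstance n (tabulate (local ∘ toℕ)) (Data.Vec.replicate n (Data.Vec.replicate n false)) (Data.Vec.replicate n false)

  read : Config n → ℕ → Bool
  read x k = lookup x (clamp k)

  eval-form : ∀ p x → eval (form p) x ≡ evalP p (read x)
  eval-form (pvar k)    x = refl
  eval-form (pconj p q) x = cong₂ _∧_ (eval-form p x) (eval-form q x)
  eval-form (pdisj p q) x = cong₂ _∨_ (eval-form p x) (eval-form q x)

  upd : (ℕ → Bool) → ℕ → Bool
  upd y k = not (evalP (rule k) y)

  network-upd : ∀ x i → lookup (network instance′ x) i ≡ upd (read x) (toℕ i)
  network-upd x i = trans (lookup-map i _ (tabulate (local ∘ toℕ)))
    (trans (cong (λ φ → eval φ x) (lookup∘tabulate (local ∘ toℕ) i)) (cong not (eval-form (rule (toℕ i)) x)))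

  promise : Promise instance′
  promise i x y le rewrite lookup∘tabulate (local ∘ toℕ) i | lookup-replicate i (Data.Vec.replicate n false) = anti
    (subst₂ (λ a b → b ≡ true → a ≡ true) (sym (eval-form (rule (toℕ i)) x)) (sym (eval-form (rule (toℕ i)) y))
      (evalP-mono (rule (toℕ i)) (λ k → ≤-true (subst (λ o → relOf o (read x k) (read y k)) (lookup-replicate (clamp k) false) (le (clamp k))))))
    where
    anti : ∀ {a b} → (b ≡ true → a ≡ true) → not a Data.Bool.≤ not b
    anti {true}  {true}  h = Data.Bool.b≤b
    anti {true}  {false} h = Data.Bool.f≤t
    anti {false} {true}  h = contradiction (h refl) λ ()
    anti {false} {false} h = Data.Bool.b≤b

  config : (ℕ → Bool) → Config n
  config y = tabulate (y ∘ toℕ)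

  read-config : ∀ y {k} → k < n → read (config y) k ≡ y k
  read-config y {k} p = trans (lookup∘tabulate (y ∘ toℕ) (clamp k)) (cong y (toℕ-clamp p))

  rule-bounded : ∀ {k} → k < n → AllP (_< n) (rule k)
  rule-bounded p = s≤s z≤n , bounded _ p

  upd-cong : ∀ {k y z} → k < n → (∀ k → k < n → y k ≡ z k) → upd y k ≡ upd z k
  upd-cong {k} p e = cong not (evalP-cong (rule k) (rule-bounded p) e)

  -- Sub-hypercubes and configurations are handled as functions on numbers, so that the bits of a
  -- cell can be addressed by arithmetic; values from n on are ignored.
  Agrees : (ℕ → Maybe Bool) → (ℕ → Bool) → Set
  Agrees H y = ∀ k b → k < n → H k ≡ just b → y k ≡ b

  Trap : (ℕ → Maybe Bool) → Set
  Trap H = ∀ y → Agrees H y → ∀ k b → k < n → H k ≡ just b → upd y k ≡ b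

  trap : ∀ h → IsTrapSpace (network instance′) h → Trap (λ k → lookup h (clamp k))
  trap h T y ag k b p e = trans (sym (trans (network-upd (config y) (clamp k))
    (trans (cong (upd (read (config y))) (toℕ-clamp p)) (upd-cong p (λ k p → read-config y p)))))
    (T (config y) (λ i b e → trans (lookup∘tabulate (y ∘ toℕ) i) (ag (toℕ i) b (toℕ<n i) (trans (cong (lookup h) (clamp-toℕ i)) e))) (clamp k) b e)

  -- The two extreme points of a sub-hypercube. A component whose value differs from d at `fill d H`
  -- must be frozen (`fill-opp`), so one configuration yields information on H itself.
  fill : Bool → (ℕ → Maybe Bool) → ℕ → Bool
  fill d H k = fromMaybe d (H k)

  fill-agrees : ∀ d H → Agrees H (fill d H)
  fill-agrees d H k b _ e = cong (fromMaybe d) e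

  fill-opp : ∀ d H k {b} → fill d H k ≡ b → b ≢ d → H k ≡ just b
  fill-opp d H k e ne with H k
  ... | just _  = cong just e
  ... | nothing = ⊥-elim (ne (sym e))

  -- A component frozen at 1 freezes component 0 at 0; one frozen at 0 forces some component to be frozen at 1.
  frozen⇒reset : ∀ {H} → Trap H → ∀ {k b} → k < n → H k ≡ just b → H 0 ≡ just false
  frozen⇒reset {H} T {k} {true} p e =
    fill-opp true H 0 (proj₁ (∨-false (not-true (T (fill true H) (fill-agrees true H) k true p e)))) λ ()
  frozen⇒reset {H} T {k} {false} p e
    with evalP-true (rule k) (rule-bounded p) (not-false (T (fill false H) (fill-agrees false H) k false p e))
  ... | k' , p' , e' = frozen⇒reset T {k'} {true} p' (fill-opp false H k' e' λ ())

  zeros : Config n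
  zeros = Data.Vec.replicate n false

  network-zeros : ∀ i → lookup (network instance′ zeros) i ≡ true
  network-zeros i with evalP (rule (toℕ i)) (read zeros) in eq
  ... | false = trans (network-upd zeros i) (cong not eq)
  ... | true with evalP-true (rule (toℕ i)) (rule-bounded (toℕ<n i)) eq
  ... | k , _ , e = contradiction (trans (sym e) (lookup-replicate (clamp k) false)) λ ()

  fixed⇒¬InMinTrap : ∀ y → (∀ k → k < n → upd y k ≡ y k) → ¬ InMinTrap instance′
  fixed⇒¬InMinTrap y fix (h , (T , minimal) , z∈h) = minimal (h' , trap' , (λ x _ i b e → ⊥-elim (free i b e)) , zeros , z∈h , z∉h')
    where
    h' : SubCube n
    h' = Data.Vec.map just (config y)
    look : ∀ i → lookup h' i ≡ just (y (toℕ i))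
    look i = trans (lookup-map i just (config y)) (cong just (lookup∘tabulate (y ∘ toℕ) i))
    inside : ∀ x → x ∈v h' → ∀ i → lookup x i ≡ y (toℕ i)
    inside x x∈ i = x∈ i _ (look i)
    network-inside : ∀ x → x ∈v h' → ∀ i → lookup (network instance′ x) i ≡ y (toℕ i)
    network-inside x x∈ i = trans (network-upd x i)
      (trans (upd-cong (toℕ<n i) (λ k p → trans (inside x x∈ (clamp k)) (cong y (toℕ-clamp p)))) (fix (toℕ i) (toℕ<n i)))
    trap' : IsTrapSpace (network instance′) h'
    trap' x x∈ i b e = trans (network-inside x x∈ i) (just-injective (trans (sym (look i)) e))
    free : ∀ i b → lookup h i ≡ just b → ⊥
    free i b e with trans (sym (z∈h i b e)) (lookup-replicate i false) | trans (sym (T zeros z∈h i b e)) (network-zeros i)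
    ... | refl | ()
    z∉h' : ¬ (zeros ∈v h')
    z∉h' z∈ = contradiction (trans (sym (network-zeros zero)) (trans (network-inside zeros z∈ zero)
      (trans (sym (inside zeros z∈ zero)) (lookup-replicate {n = n} zero false)))) λ ()

  noReset⇒InMinTrap : (∀ H → Trap H → H 0 ≢ just false) → InMinTrap instance′
  noReset⇒InMinTrap none = full , ((λ x _ i b e → ⊥-elim (all-free i b e)) , minimal) , λ i b e → ⊥-elim (all-free i b e)
    where
    full : SubCube n
    full = Data.Vec.replicate n nothing
    all-free : ∀ i b → lookup full i ≡ just b → ⊥
    all-free i b e = contradiction (trans (sym e) (lookup-replicate i nothing)) λ ()
    minimal : ¬ (∃ λ h' → IsTrapSpace (network instance′) h' × h' ⊊v full)
    -- If h' had no frozen component, x would lie in it.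
    minimal (h' , T , _ , x , _ , x∉) = x∉ λ i b e → ⊥-elim (none _ (trap h' T)
      (frozen⇒reset (trap h' T) {toℕ i} (toℕ<n i) (trans (cong (lookup h') (clamp-toℕ i)) e)))

-- One-hot circuits and their trap spaces

≡ᵇ-refl : ∀ a → (a ≡ᵇ a) ≡ true
≡ᵇ-refl zero    = refl
≡ᵇ-refl (suc a) = ≡ᵇ-refl a

≡ᵇ-true : ∀ a b → (a ≡ᵇ b) ≡ true → a ≡ b
≡ᵇ-true zero    zero    e = refl
≡ᵇ-true (suc a) (suc b) e = cong suc (≡ᵇ-true a b e)

≢⇒≡ᵇ-false : ∀ {a b} → a ≢ b → (a ≡ᵇ b) ≡ false
≢⇒≡ᵇ-false {a} {b} ne with a ≡ᵇ b in eq
... | true  = ⊥-elim (ne (≡ᵇ-true a b eq))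
... | false = refl

data Kind (Cell : Set) : Set where
  fixed      : Cell → Kind Cell
  guess evolve : Kind Cell

∨-false₂ : ∀ p q r {y} → evalP (pdisj p (pdisj q r)) y ≡ false → evalP q y ≡ false × evalP r y ≡ false
∨-false₂ p q r {y} e = ∨-false (proj₂ (∨-false {evalP p y} e))

-- Variable 0 serves as the empty disjunction: it is false wherever this formula matters.
disjAll : List PF → PF
disjAll = foldr pdisj (pvar 0)

disjAll-true : ∀ {A : Set} (t : A → PF) qs {y q} → q ∈ qs → evalP (t q) y ≡ true → evalP (disjAll (map t qs)) y ≡ true
disjAll-true t (q ∷ qs) {y} (here refl) e = cong (_∨ evalP (disjAll (map t qs)) y) e
disjAll-true t (q ∷ qs) {y} (there p)   e = trans (cong (evalP (t q) y ∨_) (disjAll-true t qs p e)) (∨-zeroʳ _)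

disjAll-inv : ∀ {A : Set} (t : A → PF) qs {y} → y 0 ≡ false → evalP (disjAll (map t qs)) y ≡ true → ∃ λ q → evalP (t q) y ≡ true
disjAll-inv t []       y0 e = contradiction (trans (sym e) y0) λ ()
disjAll-inv t (q ∷ qs) y0 e with ∨-true e
... | inj₁ e' = q , e'
... | inj₂ e' = disjAll-inv t qs y0 e'

AllP-disjAll : ∀ {A : Set} {P : ℕ → Set} (t : A → PF) qs → P 0 → (∀ q → AllP P (t q)) → AllP P (disjAll (map t qs))
AllP-disjAll t []       p0 h = p0
AllP-disjAll t (q ∷ qs) p0 h = h q , AllP-disjAll t qs p0 h

module Circuit {Cell : Set} (finite : Finite Cell) (O Z B ✓ : Cell) (O≢Z : O ≢ Z) (O≢B : O ≢ B) (Z≢B : Z ≢ B)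
  (F : Cell → Cell → Cell → Cell → Cell) where

  -- The successor makes K visibly nonzero for `/` and `%`. Indices then start at 1, and each block
  -- has a bit 0 that stands for no value; the rules keep it at 0.
  K : ℕ
  K = suc (length (proj₁ finite))

  idx : Cell → ℕ
  idx v = suc (toℕ (index (proj₂ finite v)))

  idx<K : ∀ v → idx v < K
  idx<K v = s≤s (toℕ<n (index (proj₂ finite v)))

  idx-inj : ∀ {v w} → idx v ≡ idx w → v ≡ w
  idx-inj {v} {w} e = trans (lookup-index (proj₂ finite v))
    (trans (cong (Data.List.lookup (proj₁ finite)) (toℕ-injective (suc-injective e))) (sym (lookup-index (proj₂ finite w))))

  vr : ℕ → ℕ → ℕ
  vr j a = 2 + (a + j * K)

  vr-/ : ∀ j {a} → a < K → (a + j * K) / K ≡ j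
  vr-/ j {a} p = trans (+-distrib-/ a (j * K) (subst (_< K) (sym (cong₂ _+_ (m<n⇒m%n≡m p) (m*n%n≡0 j K))) (subst (_< K) (sym (+-identityʳ a)) p)))
    (cong₂ _+_ (m<n⇒m/n≡0 p) (m*n/n≡m j K))

  vr-% : ∀ j {a} → a < K → (a + j * K) % K ≡ a
  vr-% j {a} p = trans ([m+kn]%n≡m%n a j K) (m<n⇒m%n≡m p)

  vr< : ∀ j j' {a} → a < K → j < j' → vr j a < 2 + j' * K
  vr< j j' {a} p q = s≤s (s≤s (≤-trans (+-monoˡ-≤ (j * K) p) (*-monoˡ-≤ K q)))

  quads : Finite (Σ Cell λ _ → Σ Cell λ _ → Σ Cell λ _ → Cell)
  quads = fin-Σ finite λ _ → fin-Σ finite λ _ → fin-Σ finite λ _ → finite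

  -- π is the preceding cell, α, β and γ are the three cells above.
  window : ℕ → ℕ → ℕ → (Σ Cell λ _ → Σ Cell λ _ → Σ Cell λ _ → Cell) → PF
  window p i a (π , α , β , γ) = if idx (F π α β γ) ≡ᵇ a then pvar 0 else
    pconj (pvar (vr p (idx π))) (pconj (pvar (vr i (idx α))) (pconj (pvar (vr (1 + i) (idx β))) (pvar (vr (2 + i) (idx γ)))))

  -- Bit a must be 1 iff the window has the value a. As exactly one window occurs, this is the
  -- negation of "a window with another value occurs", which is positive.
  stepRule : ℕ → ℕ → ℕ → PF
  stepRule p i a = disjAll (map (window p i a) (proj₁ quads))

  -- O, Z and B exclude each other, and a B at p blocks O and Z at suc p: a valid guess is a word followed by Bs.
  guessRule : ℕ → ℕ → PF
  guessRule p a =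
    if a ≡ᵇ idx O then pdisj (pvar (vr (suc p) (idx Z))) (pdisj (pvar (vr (suc p) (idx B))) (pvar (vr p (idx B))))
    else if a ≡ᵇ idx Z then pdisj (pvar (vr (suc p) (idx O))) (pdisj (pvar (vr (suc p) (idx B))) (pvar (vr p (idx B))))
    else if a ≡ᵇ idx B then pdisj (pvar (vr (suc p) (idx O))) (pvar (vr (suc p) (idx Z)))
    else pvar 1

  -- Where variable 0 is 0 and variable 1 is 1, the negations of `pvar 0` and `pvar 1` are the
  -- constants 1 and 0.
  fixedRule : Cell → ℕ → PF
  fixedRule v a = if a ≡ᵇ idx v then pvar 0 else pvar 1

  module Tableau (D N' : ℕ) (kind : ℕ → Kind Cell) (3≤D : 3 ≤ D)
    (step-late : ∀ j → kind j ≡ evolve → D ≤ j) (guess-late : ∀ j → kind j ≡ guess → 1 ≤ j) where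

    N : ℕ
    N = suc N'

    cellRule : Kind Cell → ℕ → ℕ → PF
    cellRule (fixed v) j a = fixedRule v a
    cellRule guess     j a = guessRule (j ∸ 1) a
    cellRule evolve      j a = stepRule (j ∸ 1) (j ∸ D) a

    ψ : ℕ → PF
    ψ 0             = pvar (vr N' (idx ✓))
    ψ 1             = pvar 0
    ψ (suc (suc r)) = cellRule (kind (r / K)) (r / K) (r % K)

    ψ-vr : ∀ j {a} → a < K → ψ (vr j a) ≡ cellRule (kind j) j a
    ψ-vr j p rewrite vr-/ j p | vr-% j p = refl

    step-back : ∀ j → kind j ≡ evolve → 2 + (j ∸ D) < j
    step-back j e = subst (2 + (j ∸ D) <_) (m+[n∸m]≡n (step-late j e)) (+-monoˡ-≤ (j ∸ D) 3≤D)

    step-back₁ : ∀ j → kind j ≡ evolve → 1 + (j ∸ D) < j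
    step-back₁ j e = <-trans (n<1+n _) (step-back j e)

    step-back₀ : ∀ j → kind j ≡ evolve → j ∸ D < j
    step-back₀ j e = <-trans (n<1+n _) (step-back₁ j e)

    pred-< : ∀ {j} → 1 ≤ j → j ∸ 1 < j
    pred-< (s≤s le) = ≤-refl

    step-pos : ∀ j → kind j ≡ evolve → 1 ≤ j
    step-pos j e = ≤-trans (≤-trans (s≤s z≤n) 3≤D) (step-late j e)

    0<vr : ∀ {j} → 0 < 2 + j * K
    0<vr = s≤s z≤n

    fixed-bound : ∀ v j a → AllP (_< 2 + j * K) (fixedRule v a)
    fixed-bound v j a with a ≡ᵇ idx v
    ... | true  = 0<vr {j}
    ... | false = s≤s (s≤s z≤n)

    step-bound : ∀ j a → kind j ≡ evolve → AllP (_< 2 + j * K) (stepRule (j ∸ 1) (j ∸ D) a)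
    step-bound j a e = AllP-disjAll (window (j ∸ 1) (j ∸ D) a) (proj₁ quads) (0<vr {j}) one
      where
      one : ∀ q → AllP (_< 2 + j * K) (window (j ∸ 1) (j ∸ D) a q)
      one (π , α , β , γ) with idx (F π α β γ) ≡ᵇ a
      ... | true  = 0<vr {j}
      ... | false = vr< (j ∸ 1) j (idx<K π) (pred-< (step-pos j e)) , vr< (j ∸ D) j (idx<K α) (step-back₀ j e) , vr< (1 + (j ∸ D)) j (idx<K β) (step-back₁ j e) , vr< (2 + (j ∸ D)) j (idx<K γ) (step-back j e)

    -- The bound is the end of the block of j, not its beginning as for the other kinds: the letters
    -- of a guess cell exclude each other.
    guess-bound : ∀ j a → 1 ≤ j → AllP (_< 2 + suc j * K) (guessRule (j ∸ 1) a)
    guess-bound (suc p) a _ with a ≡ᵇ idx O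
    ... | true  = vr< (suc p) (suc (suc p)) (idx<K Z) ≤-refl , vr< (suc p) (suc (suc p)) (idx<K B) ≤-refl , vr< p (suc (suc p)) (idx<K B) (s≤s (n≤1+n p))
    ... | false with a ≡ᵇ idx Z
    ... | true  = vr< (suc p) (suc (suc p)) (idx<K O) ≤-refl , vr< (suc p) (suc (suc p)) (idx<K B) ≤-refl , vr< p (suc (suc p)) (idx<K B) (s≤s (n≤1+n p))
    ... | false with a ≡ᵇ idx B
    ... | true  = vr< (suc p) (suc (suc p)) (idx<K O) ≤-refl , vr< (suc p) (suc (suc p)) (idx<K Z) ≤-refl
    ... | false = s≤s (s≤s z≤n)

    AllP-map : ∀ {P Q : ℕ → Set} → (∀ {k} → P k → Q k) → ∀ p → AllP P p → AllP Q p
    AllP-map f (pvar k)    a       = f a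
    AllP-map f (pconj p q) (a , b) = AllP-map f p a , AllP-map f q b
    AllP-map f (pdisj p q) (a , b) = AllP-map f p a , AllP-map f q b

    bounded : ∀ k → k < 2 + N * K → AllP (_< 2 + N * K) (ψ k)
    bounded 0 _ = vr< N' N (idx<K ✓) ≤-refl
    bounded 1 _ = s≤s z≤n
    bounded (suc (suc r)) (s≤s (s≤s lt)) = go (r / K) (m<n*o⇒m/o<n {r} {N} {K} lt)
      where
      go : ∀ j → j < N → AllP (_< 2 + N * K) (cellRule (kind j) j (r % K))
      go j j<N with kind j in eq
      ... | fixed v = AllP-map (λ q → <-≤-trans q (s≤s (s≤s (*-monoˡ-≤ K (<⇒≤ j<N))))) (fixedRule v (r % K)) (fixed-bound v j (r % K))
      ... | guess   = AllP-map (λ q → <-≤-trans q (s≤s (s≤s (*-monoˡ-≤ K j<N)))) (guessRule (j ∸ 1) (r % K)) (guess-bound j (r % K) (guess-late j eq))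
      ... | evolve    = AllP-map (λ q → <-≤-trans q (s≤s (s≤s (*-monoˡ-≤ K (<⇒≤ j<N))))) (stepRule (j ∸ 1) (j ∸ D) (r % K)) (step-bound j (r % K) eq)

    open Network (suc (N * K)) ψ bounded public

    ValidAt : (ℕ → Cell) → ℕ → Kind Cell → Set
    ValidAt c j (fixed v) = c j ≡ v
    ValidAt c j guess     = (c j ≡ O ⊎ c j ≡ Z ⊎ c j ≡ B) × (c (j ∸ 1) ≡ B → c j ≡ B)
    ValidAt c j evolve      = c j ≡ F (c (j ∸ 1)) (c (j ∸ D)) (c (1 + (j ∸ D))) (c (2 + (j ∸ D)))

    Valid : (ℕ → Cell) → Set
    Valid c = ∀ j → ValidAt c j (kind j)

    hot : (ℕ → Cell) → ℕ → Bool
    hot c 0             = false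
    hot c 1             = true
    hot c (suc (suc r)) = r % K ≡ᵇ idx (c (r / K))

    hot-vr : ∀ c j {a} → a < K → hot c (vr j a) ≡ (a ≡ᵇ idx (c j))
    hot-vr c j p rewrite vr-/ j p | vr-% j p = refl

    hot-self : ∀ c j v → c j ≡ v → hot c (vr j (idx v)) ≡ true
    hot-self c j v refl = trans (hot-vr c j (idx<K v)) (≡ᵇ-refl (idx v))

    hot-inv : ∀ c j v → hot c (vr j (idx v)) ≡ true → v ≡ c j
    hot-inv c j v e = idx-inj (≡ᵇ-true _ _ (trans (sym (hot-vr c j (idx<K v))) e))

    hot-other : ∀ c j v → c j ≢ v → hot c (vr j (idx v)) ≡ false
    hot-other c j v ne with hot c (vr j (idx v)) in eq
    ... | true  = ⊥-elim (ne (sym (hot-inv c j v eq)))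
    ... | false = refl

    -- At `hot c` the only conjunction that holds is that of the window of c itself, and this window
    -- is replaced by variable 0 iff its value c j has index a.
    eval-step : ∀ c j a → c j ≡ F (c (j ∸ 1)) (c (j ∸ D)) (c (1 + (j ∸ D))) (c (2 + (j ∸ D))) →
      not (evalP (stepRule (j ∸ 1) (j ∸ D) a) (hot c)) ≡ (a ≡ᵇ idx (c j))
    eval-step c j a e with a ≡ᵇ idx (c j) in eq
    ... | false = cong not (disjAll-true (window (j ∸ 1) (j ∸ D) a) (proj₁ quads) {hot c} (proj₂ quads (_ , _ , _ , _)) fires)
      where
      fires : evalP (window (j ∸ 1) (j ∸ D) a (c (j ∸ 1) , c (j ∸ D) , c (1 + (j ∸ D)) , c (2 + (j ∸ D)))) (hot c) ≡ true
      fires rewrite sym e with idx (c j) ≡ᵇ a in eq'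
      ... | true  = contradiction (trans (sym eq) (trans (cong (_≡ᵇ idx (c j)) (sym (≡ᵇ-true (idx (c j)) a eq'))) (≡ᵇ-refl (idx (c j))))) λ ()
      ... | false = cong₂ _∧_ (hot-self c (j ∸ 1) _ refl) (cong₂ _∧_ (hot-self c (j ∸ D) _ refl) (cong₂ _∧_ (hot-self c (1 + (j ∸ D)) _ refl) (hot-self c (2 + (j ∸ D)) _ refl)))
    ... | true with evalP (stepRule (j ∸ 1) (j ∸ D) a) (hot c) in ev
    ... | false = refl
    ... | true with disjAll-inv (window (j ∸ 1) (j ∸ D) a) (proj₁ quads) {hot c} refl ev
    ... | (π , α , β , γ) , t with idx (F π α β γ) ≡ᵇ a in eq'
    ... | false = contradiction (trans (sym eq') same) λ ()
      where
      t₁ = ∧-true t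
      t₂ = ∧-true (proj₂ t₁)
      t₃ = ∧-true (proj₂ t₂)
      same : (idx (F π α β γ) ≡ᵇ a) ≡ true
      same = trans (cong₂ _≡ᵇ_ (cong idx (trans (cong₄ (hot-inv c _ π (proj₁ t₁)) (hot-inv c _ α (proj₁ t₂)) (hot-inv c _ β (proj₁ t₃)) (hot-inv c _ γ (proj₂ t₃))) (sym e)))
        (≡ᵇ-true a _ eq)) (≡ᵇ-refl (idx (c j)))
        where
        cong₄ : ∀ {π π' α α' β β' γ γ'} → π ≡ π' → α ≡ α' → β ≡ β' → γ ≡ γ' → F π α β γ ≡ F π' α' β' γ'
        cong₄ refl refl refl refl = refl

    eval-fixed : ∀ v a {y} → y 0 ≡ false → y 1 ≡ true → not (evalP (fixedRule v a) y) ≡ (a ≡ᵇ idx v)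
    eval-fixed v a e₀ e₁ with a ≡ᵇ idx v
    ... | true  = cong not e₀
    ... | false = cong not e₁

    -- Agreement with the run before block j is all that an induction over a trap space can offer.
    -- Guess cells are left out as they read their own block.
    early : ∀ c j a y → a < K → Valid c → kind j ≢ guess → (∀ k → k < 2 + j * K → y k ≡ hot c k) → upd y (vr j a) ≡ hot c (vr j a)
    early c j a y p V ng ag rewrite ψ-vr j p | hot-vr c j p | ag 0 (0<vr {j}) with kind j in eq | V j
    ... | fixed v | refl = eval-fixed (c j) a {y} (ag 0 (0<vr {j})) (ag 1 (s≤s (s≤s z≤n)))
    ... | guess   | _    = ⊥-elim (ng refl)
    ... | evolve    | e    = trans (cong not (evalP-cong (stepRule (j ∸ 1) (j ∸ D) a) (step-bound j a eq) ag)) (eval-step c j a e)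

    data GuessView (a : ℕ) : Set where
      isO   : a ≡ idx O → GuessView a
      isZ   : a ≡ idx Z → GuessView a
      isB   : a ≡ idx B → GuessView a
      other : (∀ p → guessRule p a ≡ pvar 1) → a ≢ idx O → a ≢ idx Z → a ≢ idx B → GuessView a

    guessView : ∀ a → GuessView a
    guessView a with a ≟ idx O | a ≟ idx Z | a ≟ idx B
    ... | yes e | _ | _ = isO e
    ... | no _ | yes e | _ = isZ e
    ... | no _ | no _ | yes e = isB e
    ... | no n₁ | no n₂ | no n₃ = other rule₁ n₁ n₂ n₃
      where
      rule₁ : ∀ p → guessRule p a ≡ pvar 1
      rule₁ p rewrite ≢⇒≡ᵇ-false n₁ | ≢⇒≡ᵇ-false n₂ | ≢⇒≡ᵇ-false n₃ = refl

    guessRule-O : ∀ p → guessRule p (idx O) ≡ pdisj (pvar (vr (suc p) (idx Z))) (pdisj (pvar (vr (suc p) (idx B))) (pvar (vr p (idx B))))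
    guessRule-O p rewrite ≡ᵇ-refl (idx O) = refl

    guessRule-Z : ∀ p → guessRule p (idx Z) ≡ pdisj (pvar (vr (suc p) (idx O))) (pdisj (pvar (vr (suc p) (idx B))) (pvar (vr p (idx B))))
    guessRule-Z p rewrite ≢⇒≡ᵇ-false {idx Z} {idx O} (λ e → O≢Z (sym (idx-inj e))) | ≡ᵇ-refl (idx Z) = refl

    guessRule-B : ∀ p → guessRule p (idx B) ≡ pdisj (pvar (vr (suc p) (idx O))) (pvar (vr (suc p) (idx Z)))
    guessRule-B p rewrite ≢⇒≡ᵇ-false {idx B} {idx O} (λ e → O≢B (sym (idx-inj e))) | ≢⇒≡ᵇ-false {idx B} {idx Z} (λ e → Z≢B (sym (idx-inj e))) | ≡ᵇ-refl (idx B) = refl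

    ψ-guess : ∀ p {a} → kind (suc p) ≡ guess → a < K → ψ (vr (suc p) a) ≡ guessRule p a
    ψ-guess p k q = trans (ψ-vr (suc p) q) (cong (λ z → cellRule z (suc p) _) k)

    -- The rules of O and Z also contain the bit of B at p; if c has one of these letters at
    -- `suc p`, the second half of `ValidAt` makes that bit 0.
    guess-fixed : ∀ c p a → a < K → kind (suc p) ≡ guess → ValidAt c (suc p) guess → upd (hot c) (vr (suc p) a) ≡ hot c (vr (suc p) a)
    guess-fixed c p a q k V rewrite ψ-guess p k q with guessView a | V
    ... | isO refl | inj₁ e , b rewrite guessRule-O p | hot-self c (suc p) O e | hot-other c (suc p) Z (λ z → O≢Z (trans (sym e) z)) | hot-other c (suc p) B (λ z → O≢B (trans (sym e) z))
      | hot-other c p B (λ z → O≢B (trans (sym e) (b z))) = refl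
    ... | isO refl | inj₂ (inj₁ e) , b rewrite guessRule-O p | hot-self c (suc p) Z e | hot-other c (suc p) O (λ z → O≢Z (trans (sym z) e)) = refl
    ... | isO refl | inj₂ (inj₂ e) , b rewrite guessRule-O p | hot-self c (suc p) B e | hot-other c (suc p) O (λ z → O≢B (trans (sym z) e)) = cong not (∨-zeroʳ _)
    ... | isZ refl | inj₁ e , b rewrite guessRule-Z p | hot-self c (suc p) O e | hot-other c (suc p) Z (λ z → O≢Z (trans (sym e) z)) = refl
    ... | isZ refl | inj₂ (inj₁ e) , b rewrite guessRule-Z p | hot-self c (suc p) Z e | hot-other c (suc p) O (λ z → O≢Z (trans (sym z) e)) | hot-other c (suc p) B (λ z → Z≢B (trans (sym e) z))
      | hot-other c p B (λ z → Z≢B (trans (sym e) (b z))) = refl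
    ... | isZ refl | inj₂ (inj₂ e) , b rewrite guessRule-Z p | hot-self c (suc p) B e | hot-other c (suc p) Z (λ z → Z≢B (trans (sym z) e)) = cong not (∨-zeroʳ _)
    ... | isB refl | inj₁ e , b rewrite guessRule-B p | hot-self c (suc p) O e | hot-other c (suc p) B (λ z → O≢B (trans (sym e) z)) = refl
    ... | isB refl | inj₂ (inj₁ e) , b rewrite guessRule-B p | hot-self c (suc p) Z e | hot-other c (suc p) B (λ z → Z≢B (trans (sym e) z)) = cong not (∨-zeroʳ _)
    ... | isB refl | inj₂ (inj₂ e) , b rewrite guessRule-B p | hot-self c (suc p) B e | hot-other c (suc p) O (λ z → O≢B (trans (sym z) e)) | hot-other c (suc p) Z (λ z → Z≢B (trans (sym z) e)) = refl
    ... | other r n₁ n₂ n₃ | v , b rewrite r p | hot-vr c (suc p) q = sym (≢⇒≡ᵇ-false (λ z → ne v z))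
      where
      ne : (c (suc p) ≡ O ⊎ c (suc p) ≡ Z ⊎ c (suc p) ≡ B) → a ≡ idx (c (suc p)) → ⊥
      ne (inj₁ e) z = n₁ (trans z (cong idx e))
      ne (inj₂ (inj₁ e)) z = n₂ (trans z (cong idx e))
      ne (inj₂ (inj₂ e)) z = n₃ (trans z (cong idx e))

    split : ∀ r → suc (suc r) ≡ vr (r / K) (r % K)
    split r = cong (2 +_) (m≡m%n+[m/n]*n r K)

    accepting⇒¬InMinTrap : ∀ c → Valid c → c N' ≡ ✓ → ¬ InMinTrap instance′
    accepting⇒¬InMinTrap c V acc = fixed⇒¬InMinTrap (hot c) λ where
        0 _ → cong not (hot-self c N' ✓ acc)
        1 _ → refl
        (suc (suc r)) _ → subst (λ k → upd (hot c) k ≡ hot c k) (sym (split r)) (at (r / K) (m%n<n r K))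
      where
      at : ∀ j {a} → a < K → upd (hot c) (vr j a) ≡ hot c (vr j a)
      at j {a} p with kind j in eq | V j
      ... | fixed v | _ = early c j a (hot c) p V (λ e → contradiction (trans (sym e) eq) λ ()) (λ _ _ → refl)
      ... | evolve    | _ = early c j a (hot c) p V (λ e → contradiction (trans (sym e) eq) λ ()) (λ _ _ → refl)
      at zero p    | guess | _ = ⊥-elim (n≮0 (guess-late 0 eq))
      at (suc j) {a} p | guess | v = guess-fixed c j a p eq v

    nextCell : Kind Cell → Cell → Cell → Cell → Cell → Cell → Cell
    nextCell (fixed v) g π α β γ = v
    nextCell guess     g π α β γ = g
    nextCell evolve      g π α β γ = F π α β γ

    module Build (choice : ℕ → Cell → Cell) where

      -- Course-of-values recursion by fuel. By `tab-fuel` the value at fuel 0 does not influence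
      -- `built`.
      tab : ℕ → ℕ → Cell
      tab zero    j = B
      tab (suc f) j = nextCell (kind j) (choice j (tab f (j ∸ 1))) (tab f (j ∸ 1)) (tab f (j ∸ D)) (tab f (1 + (j ∸ D))) (tab f (2 + (j ∸ D)))

      tab-fuel : ∀ f f' j → j < f → j < f' → tab f j ≡ tab f' j
      tab-fuel (suc f) (suc f') j (s≤s p) (s≤s p') with kind j in eq
      ... | fixed v = refl
      ... | guess   = let q = pred-< (guess-late j eq) in cong (choice j) (tab-fuel f f' (j ∸ 1) (<-≤-trans q p) (<-≤-trans q p'))
      ... | evolve
        rewrite tab-fuel f f' (j ∸ 1) (<-≤-trans (pred-< (step-pos j eq)) p) (<-≤-trans (pred-< (step-pos j eq)) p')
        | tab-fuel f f' (j ∸ D) (<-≤-trans (step-back₀ j eq) p) (<-≤-trans (step-back₀ j eq) p')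
        | tab-fuel f f' (1 + (j ∸ D)) (<-≤-trans (step-back₁ j eq) p) (<-≤-trans (step-back₁ j eq) p')
        | tab-fuel f f' (2 + (j ∸ D)) (<-≤-trans (step-back j eq) p) (<-≤-trans (step-back j eq) p') = refl

      built : ℕ → Cell
      built j = tab (suc j) j

      built-fixed : ∀ {j v} → kind j ≡ fixed v → built j ≡ v
      built-fixed e rewrite e = refl

      built-guess : ∀ {j} → kind j ≡ guess → built j ≡ choice j (built (j ∸ 1))
      built-guess {j} e rewrite e = cong (choice j) (tab-fuel j (suc (j ∸ 1)) (j ∸ 1) (pred-< (guess-late j e)) ≤-refl)

      built-step : ∀ {j} → kind j ≡ evolve → built j ≡ F (built (j ∸ 1)) (built (j ∸ D)) (built (1 + (j ∸ D))) (built (2 + (j ∸ D)))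
      built-step {j} e rewrite e
        | tab-fuel j (suc (j ∸ 1)) (j ∸ 1) (pred-< (step-pos j e)) ≤-refl
        | tab-fuel j (suc (j ∸ D)) (j ∸ D) (step-back₀ j e) ≤-refl
        | tab-fuel j (2 + (j ∸ D)) (1 + (j ∸ D)) (step-back₁ j e) ≤-refl
        | tab-fuel j (3 + (j ∸ D)) (2 + (j ∸ D)) (step-back j e) ≤-refl = refl

      Good : Set
      Good = ∀ j π → kind j ≡ guess → π ≡ built (j ∸ 1) → (choice j π ≡ O ⊎ choice j π ≡ Z ⊎ choice j π ≡ B) × (π ≡ B → choice j π ≡ B)

      built-valid : Good → Valid built
      built-valid good j with kind j in eq
      ... | fixed v = built-fixed eq
      ... | guess   = let a , b = good j _ eq refl in
        subst (λ w → (w ≡ O ⊎ w ≡ Z ⊎ w ≡ B) × (built (j ∸ 1) ≡ B → w ≡ B)) (sym (built-guess eq)) (a , b)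
      ... | evolve    = built-step eq

    module FromTrap (H : ℕ → Maybe Bool) (T : Trap H) (reset : H 0 ≡ just false) where

      -- A letter frozen at 1 has to be taken; a blank predecessor rules out O and Z being so
      -- (`prevB`). If neither is, B is safe, because then it cannot be frozen at 0 (`B-free`).
      choice : ℕ → Cell → Cell
      choice j π with idx π ≟ idx B | H (vr j (idx O)) | H (vr j (idx Z))
      ... | yes _ | _         | _         = B
      ... | no _  | just true | _         = O
      ... | no _  | _         | just true = Z
      ... | no _  | _         | _         = B

      data Choice (j : ℕ) (π : Cell) : Cell → Set where
        choseB : (π ≡ B ⊎ (H (vr j (idx O)) ≢ just true × H (vr j (idx Z)) ≢ just true)) → Choice j π B
        choseO : π ≢ B → H (vr j (idx O)) ≡ just true → Choice j π O
        choseZ : π ≢ B → H (vr j (idx Z)) ≡ just true → Choice j π Z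

      differs : ∀ {h h' : Maybe Bool} → h ≡ h' → h' ≢ just true → h ≢ just true
      differs refl ne = ne

      choice-view : ∀ j π → Choice j π (choice j π)
      choice-view j π with idx π ≟ idx B | H (vr j (idx O)) in eO | H (vr j (idx Z)) in eZ
      ... | yes e | _          | _          = choseB (inj₁ (idx-inj e))
      ... | no ne | just true  | _          = choseO (λ { refl → ne refl }) eO
      ... | no ne | just false | just true  = choseZ (λ { refl → ne refl }) eZ
      ... | no ne | nothing    | just true  = choseZ (λ { refl → ne refl }) eZ
      ... | no ne | just false | just false = choseB (inj₂ (differs eO (λ ()) , differs eZ (λ ())))
      ... | no ne | just false | nothing    = choseB (inj₂ (differs eO (λ ()) , differs eZ (λ ())))
      ... | no ne | nothing    | just false = choseB (inj₂ (differs eO (λ ()) , differs eZ (λ ())))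
      ... | no ne | nothing    | nothing    = choseB (inj₂ (differs eO (λ ()) , differs eZ (λ ())))

      open Build choice public

      good : Good
      good j π _ _ with choice j π | choice-view j π
      ... | _ | choseB _    = inj₂ (inj₂ refl) , λ _ → refl
      ... | _ | choseO ne _ = inj₁ refl , λ e → ⊥-elim (ne e)
      ... | _ | choseZ ne _ = inj₂ (inj₁ refl) , λ e → ⊥-elim (ne e)

      valid : Valid built
      valid = built-valid good

      c = built

      Ok : ℕ → Set
      Ok k = ∀ b → H k ≡ just b → hot c k ≡ b

      -- The point of the trap space that follows the run wherever H permits. On earlier cells it is
      -- the run by induction, so updating it shows what a frozen bit of the next cell must be.
      merged : ℕ → Bool
      merged k = fromMaybe (hot c k) (H k)

      merged-agrees : Agrees H merged
      merged-agrees k b _ e = cong (fromMaybe (hot c k)) e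

      merged-ok : ∀ {k} → Ok k → merged k ≡ hot c k
      merged-ok {k} ok with H k
      ... | nothing = refl
      ... | just b  = sym (ok b refl)

      vr-n : ∀ {j a} → j < N → a < K → vr j a < n
      vr-n {j} p q = vr< j N q p

      ok-early : ∀ j a → j < N → a < K → kind j ≢ guess → (∀ k → k < 2 + j * K → Ok k) → Ok (vr j a)
      ok-early j a p q ng ih b e = trans (sym (early c j a merged q valid ng (λ k lt → merged-ok (ih k lt)))) (T merged merged-agrees (vr j a) b (vr-n p q) e)

      module _ (p : ℕ) (p<N : suc p < N) (kg : kind (suc p) ≡ guess) (ih : ∀ k → k < 2 + suc p * K → Ok k) where

        letterAt : Cell → Maybe Bool
        letterAt v = H (vr (suc p) (idx v))

        hotAt : Cell → Bool
        hotAt v = hot c (vr (suc p) (idx v))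

        ruleAt : ∀ y → Agrees H y → ∀ {a b} → a < K → H (vr (suc p) a) ≡ just b → not (y 0 ∨ evalP (guessRule p a) y) ≡ b
        ruleAt y ag {a} q e = trans (cong (λ r → not (y 0 ∨ evalP r y)) (sym (ψ-guess p kg q))) (T y ag (vr (suc p) a) _ (vr-n p<N q) e)

        exclude : ∀ y → Agrees H y → ∀ {v f} → guessRule p (idx v) ≡ f → letterAt v ≡ just true → evalP f y ≡ false
        exclude y ag {v} refl e = proj₂ (∨-false (not-true (ruleAt y ag (idx<K v) e)))

        hi = fill true H

        -- Set all free components to 1: O can stay at 1 after an update only if Z and B are 0 at
        -- this point, so neither of them is frozen at 1.
        O-excl : ∀ {v} → letterAt O ≡ just true → v ≡ Z ⊎ v ≡ B → letterAt v ≢ just true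
        O-excl e (inj₁ refl) e' = contradiction (trans (sym (cong (fromMaybe true) e')) (proj₁ (∨-false (exclude hi (fill-agrees true H) (guessRule-O p) e)))) λ ()
        O-excl e (inj₂ refl) e' = contradiction (trans (sym (cong (fromMaybe true) e')) (proj₁ (∨-false₂ (pvar (vr (suc p) (idx Z))) (pvar (vr (suc p) (idx B))) (pvar (vr p (idx B))) {hi} (exclude hi (fill-agrees true H) (guessRule-O p) e)))) λ ()

        Z-excl : letterAt Z ≡ just true → letterAt B ≢ just true
        Z-excl e e' = contradiction (trans (sym (cong (fromMaybe true) e')) (proj₁ (∨-false₂ (pvar (vr (suc p) (idx O))) (pvar (vr (suc p) (idx B))) (pvar (vr p (idx B))) {hi} (exclude hi (fill-agrees true H) (guessRule-Z p) e)))) λ ()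

        -- By induction `merged` has the bit of B at p equal to 1, and this bit switches O and Z off
        -- at `suc p`.
        prevB : ∀ {v} → v ≡ O ⊎ v ≡ Z → c p ≡ B → letterAt v ≢ just true
        prevB w e e' = contradiction (trans (sym (hot-self c p B e)) (trans (sym (merged-ok (ih (vr p (idx B)) (vr< p (suc p) (idx<K B) ≤-refl)))) (last w e'))) λ ()
          where
          last : ∀ {v} → v ≡ O ⊎ v ≡ Z → letterAt v ≡ just true → merged (vr p (idx B)) ≡ false
          last (inj₁ refl) e' = proj₂ (∨-false₂ (pvar (vr (suc p) (idx Z))) (pvar (vr (suc p) (idx B))) (pvar (vr p (idx B))) {merged} (exclude merged merged-agrees (guessRule-O p) e'))
          last (inj₂ refl) e' = proj₂ (∨-false₂ (pvar (vr (suc p) (idx O))) (pvar (vr (suc p) (idx B))) (pvar (vr p (idx B))) {merged} (exclude merged merged-agrees (guessRule-Z p) e'))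

        -- Set all free components to 0: an update gives B the value 0 only if b, O or Z is 1, hence
        -- frozen at 1. For b this contradicts `reset`.
        B-free : letterAt O ≢ just true → letterAt Z ≢ just true → letterAt B ≢ just false
        B-free nO nZ e with ∨-true {fill false H 0} (not-false (ruleAt (fill false H) (fill-agrees false H) (idx<K B) e))
        ... | inj₁ z = contradiction (trans (sym reset) (fill-opp false H 0 z λ ())) λ ()
        ... | inj₂ z rewrite guessRule-B p with ∨-true z
        ... | inj₁ z' = nO (fill-opp false H _ z' λ ())
        ... | inj₂ z' = nZ (fill-opp false H _ z' λ ())

        frozen0 : ∀ {v b} → c (suc p) ≢ v → letterAt v ≢ just true → letterAt v ≡ just b → hotAt v ≡ b
        frozen0 {v} {true}  ne nt e = ⊥-elim (nt e)
        frozen0 {v} {false} ne nt e = hot-other c (suc p) v ne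

        frozen1 : ∀ {v b} → c (suc p) ≡ v → letterAt v ≢ just false → letterAt v ≡ just b → hotAt v ≡ b
        frozen1 {v} {true}  eq nf e = hot-self c (suc p) v eq
        frozen1 {v} {false} eq nf e = ⊥-elim (nf e)

        ok-guess : ∀ a → a < K → Ok (vr (suc p) a)
        ok-guess a q b e = go (guessView a) (built-guess {suc p} kg) (choice-view (suc p) (c p))
          where
          not-just-false : ∀ {h : Maybe Bool} → h ≡ just true → h ≢ just false
          not-just-false refl ()
          -- A bit that stands for none of O, Z, B is switched off by variable 1, which is 1 at
          -- `merged` by induction.
          otherCase : ∀ {w} → (∀ p → guessRule p a ≡ pvar 1) → a ≢ idx O → a ≢ idx Z → a ≢ idx B → c (suc p) ≡ w → Choice (suc p) (c p) w → hot c (vr (suc p) a) ≡ b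
          otherCase r n₁ n₂ n₃ w ch = trans (trans (hot-vr c (suc p) q) (≢⇒≡ᵇ-false (ne ch w)))
            (trans (sym (trans (cong (λ f → not (merged 0 ∨ evalP f merged)) (r p)) (trans (cong (λ z → not (merged 0 ∨ z)) (merged-ok (ih 1 (s≤s (s≤s z≤n))))) (cong not (∨-zeroʳ _)))))
              (ruleAt merged merged-agrees q e))
            where
            ne : ∀ {w} → Choice (suc p) (c p) w → c (suc p) ≡ w → a ≡ idx (c (suc p)) → ⊥
            ne (choseB _) w z = n₃ (trans z (cong idx w))
            ne (choseO _ _) w z = n₁ (trans z (cong idx w))
            ne (choseZ _ _) w z = n₂ (trans z (cong idx w))
          go : ∀ {w} → GuessView a → c (suc p) ≡ w → Choice (suc p) (c p) w → hot c (vr (suc p) a) ≡ b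
          go (other r n₁ n₂ n₃) w ch = otherCase r n₁ n₂ n₃ w ch
          go (isO refl) w (choseO _ h) = frozen1 w (not-just-false h) e
          go (isZ refl) w (choseO _ h) = frozen0 (λ z → O≢Z (trans (sym w) z)) (O-excl h (inj₁ refl)) e
          go (isB refl) w (choseO _ h) = frozen0 (λ z → O≢B (trans (sym w) z)) (O-excl h (inj₂ refl)) e
          go (isO refl) w (choseZ _ h) = frozen0 (λ z → O≢Z (trans (sym z) w)) (λ e' → O-excl e' (inj₁ refl) h) e
          go (isZ refl) w (choseZ _ h) = frozen1 w (not-just-false h) e
          go (isB refl) w (choseZ _ h) = frozen0 (λ z → Z≢B (trans (sym w) z)) (Z-excl h) e
          go g w (choseB x) = chosenB g x
            where
            nO : (c p ≡ B ⊎ (letterAt O ≢ just true × letterAt Z ≢ just true)) → letterAt O ≢ just true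
            nO (inj₁ z) = prevB (inj₁ refl) z
            nO (inj₂ (z , _)) = z
            nZ : (c p ≡ B ⊎ (letterAt O ≢ just true × letterAt Z ≢ just true)) → letterAt Z ≢ just true
            nZ (inj₁ z) = prevB (inj₂ refl) z
            nZ (inj₂ (_ , z)) = z
            chosenB : GuessView a → _ → hot c (vr (suc p) a) ≡ b
            chosenB (isO refl) x = frozen0 (λ z → O≢B (trans (sym z) w)) (nO x) e
            chosenB (isZ refl) x = frozen0 (λ z → Z≢B (trans (sym z) w)) (nZ x) e
            chosenB (isB refl) x = frozen1 w (B-free (nO x) (nZ x)) e
            chosenB (other r n₁ n₂ n₃) x = otherCase r n₁ n₂ n₃ w (choseB x)

      ok : ∀ k → k < n → Ok k
      ok = <-rec (λ k → k < n → Ok k) λ where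
          0 ih p b e → just-injective (trans (sym reset) e)
          -- Component 1 is the negation of component 0, and the latter is frozen at 0.
          1 ih p b e → trans (sym (cong (λ z → not (z ∨ z)) (cong (fromMaybe false) reset))) (T merged merged-agrees 1 b p e)
          (suc (suc r)) ih (s≤s (s≤s lt)) → subst Ok (sym (split r)) (at (r / K) (m<n*o⇒m/o<n {r} {N} {K} lt) (m%n<n r K)
            (λ k q → ih (subst (k <_) (sym (split r)) (<-≤-trans q (s≤s (s≤s (m≤n+m _ _))))) (<-≤-trans q (≤-trans (s≤s (s≤s (m≤n+m _ (r % K)))) (≤-trans (≤-reflexive (sym (split r))) (<⇒≤ (s≤s (s≤s lt))))))))
        where
        at : ∀ j {a} → j < N → a < K → (∀ k → k < 2 + j * K → Ok k) → Ok (vr j a)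
        at j {a} p q ih with kind j in eq
        ... | fixed v = ok-early j a p q (λ e → contradiction (trans (sym e) eq) λ ()) ih
        ... | evolve    = ok-early j a p q (λ e → contradiction (trans (sym e) eq) λ ()) ih
        at zero p q ih    | guess = ⊥-elim (n≮0 (guess-late 0 eq))
        at (suc j) {a} p q ih | guess = ok-guess j p eq ih a q

      -- By `ok` the configuration `hot c` lies in the trap space, so its update has b = 0. Since b
      -- is 0 at `hot c`, only the bit of ✓ in the last cell can cause this.
      accepts : c N' ≡ ✓
      accepts = sym (hot-inv c N' ✓ (not-false (trans (sym (cong not refl)) (T (hot c) (λ k b p e → ok k p b e) 0 false (s≤s z≤n) reset))))

-- A one-dimensional cellular encoding of the runs of a Turing machine

-- `origin` is a head that waits to the left of the input, so that all input cells are plain; `done`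
-- marks acceptance.
data Cell (Q : ℕ) : Set where
  plain  : Sym → Cell Q
  done   : Cell Q
  origin : Cell Q
  headed : Fin (suc Q) → Sym → Cell Q

fin-Sym : Finite Sym
fin-Sym = blank ∷ bit true ∷ bit false ∷ [] , λ where
  blank       → here refl
  (bit true)  → there (here refl)
  (bit false) → there (there (here refl))

-- Abstract, so that the enumeration is not unfolded in the formulas that range over it.
abstract
  fin-Cell : ∀ Q → Finite (Cell Q)
  fin-Cell Q = fin-map to from (fin-⊎ (fin-Maybe (fin-Maybe fin-Sym)) (fin-Σ (fin-Fin (suc Q)) (λ _ → fin-Sym)))
    where
    to : Maybe (Maybe Sym) ⊎ Σ (Fin (suc Q)) (λ _ → Sym) → Cell Q
    to (inj₁ nothing)         = done
    to (inj₁ (just nothing))  = origin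
    to (inj₁ (just (just s))) = plain s
    to (inj₂ (q , s))         = headed q s
    from : ∀ c → ∃ λ a → to a ≡ c
    from done         = _ , refl
    from origin       = _ , refl
    from (plain s)    = _ , refl
    from (headed q s) = _ , refl

module Automaton (M : TM) where
  open TM M

  Action : Set
  Action = Maybe (Fin (suc Q) × Sym × Move)

  goesRight goesLeft : Action → Maybe (Fin (suc Q))
  goesRight (just (q , _ , right)) = just q
  goesRight _                      = nothing
  goesLeft (just (q , _ , left))   = just q
  goesLeft _                       = nothing

  becomes : Fin (suc Q) → Sym → Action → Cell Q
  becomes q s nothing               = headed q s
  becomes q s (just (q' , w , stay)) = headed q' w
  becomes q s (just (_ , w , _))    = plain w

  fromLeft fromRight : Cell Q → Maybe (Fin (suc Q))
  fromLeft origin       = just zero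
  fromLeft (headed q s) = goesRight (δ q s)
  fromLeft _            = nothing
  fromRight (headed q s) = goesLeft (δ q s)
  fromRight _            = nothing

  arrive : Maybe (Fin (suc Q)) → Maybe (Fin (suc Q)) → Sym → Cell Q
  arrive (just q) _        s = headed q s
  arrive nothing  (just q) s = headed q s
  arrive nothing  nothing  s = plain s

  self : Cell Q → Cell Q
  self (headed q s) = becomes q s (δ q s)
  self origin       = plain blank
  self c            = c

  evolved : Cell Q → Cell Q → Cell Q → Cell Q
  evolved α (plain s) γ = arrive (fromLeft α) (fromRight γ) s
  evolved α β         γ = self β

  halts : Action → Bool
  halts nothing  = true
  halts (just _) = false

  accepting isBlank isDone : Cell Q → Bool
  accepting (headed q (bit true)) = halts (δ q (bit true))
  accepting _                     = false
  isBlank (plain blank) = true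
  isBlank _             = false
  isDone done = true
  isDone _    = false

  -- A halted head accepts iff it reads 1 and the cell to its right is blank: two adjacent cells,
  -- which some window shows as α and β. The test of π then spreads `done` over all later cells.
  F : Cell Q → Cell Q → Cell Q → Cell Q → Cell Q
  F π α β γ = if isDone π then done else if accepting α ∧ isBlank β then done else evolved α β γ

  -- The row with head cell x at position p, ls to its left (nearest first) and rs to its right.
  row : List Sym → Cell Q → List Sym → ℕ → ℕ → Cell Q
  row ls x rs zero    zero    = x
  row ls x rs zero    (suc i) = plain (nth rs i)
  row ls x rs (suc p) zero    = plain (nth ls p)
  row ls x rs (suc p) (suc i) = row ls x rs p i

  module _ {ls rs : List Sym} {x : Cell Q} (ctr : ∀ α γ → evolved α x γ ≡ self x) where

    private r = row ls x rs

    -- The window at i, 1 + i, 2 + i yields the new cell at 2 + i instead of 1 + i. A head at p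
    -- therefore goes to `suc p` if it stays, to p if it moves left and to 2 + p if it moves right.
    row-stay : fromLeft x ≡ nothing → fromRight x ≡ nothing → ∀ p i →
      evolved (r p i) (r p (1 + i)) (r p (2 + i)) ≡ row ls (self x) rs (suc p) (2 + i)
    row-stay l g zero zero rewrite l = refl
    row-stay l g zero (suc i) = refl
    row-stay l g (suc zero) zero = ctr _ _
    row-stay l g (suc (suc zero)) zero rewrite g = refl
    row-stay l g (suc (suc (suc p))) zero = refl
    row-stay l g (suc p) (suc i) = row-stay l g p i

    row-right : ∀ {q w} → fromLeft x ≡ just q → fromRight x ≡ nothing → self x ≡ plain w → ∀ p i →
      evolved (r p i) (r p (1 + i)) (r p (2 + i)) ≡ row (w ∷ ls) (headed q (hd rs)) (tl rs) (2 + p) (2 + i)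
    row-right {q} l g e zero zero rewrite l = cong (headed q) (hd-nth rs)
    row-right l g e zero (suc i) = cong plain (sym (tl-nth rs i))
    row-right l g e (suc zero) zero = trans (ctr _ _) e
    row-right l g e (suc (suc zero)) zero rewrite g = refl
    row-right l g e (suc (suc (suc p))) zero = refl
    row-right l g e (suc p) (suc i) = row-right l g e p i

    row-left : ∀ {q w} → fromLeft x ≡ nothing → fromRight x ≡ just q → self x ≡ plain w → ∀ p i →
      evolved (r p i) (r p (1 + i)) (r p (2 + i)) ≡ row (tl ls) (headed q (hd ls)) (w ∷ rs) p (2 + i)
    row-left l g e zero zero rewrite l = refl
    row-left l g e zero (suc i) = refl
    row-left l g e (suc zero) zero = trans (ctr _ _) e
    row-left {q} l g e (suc (suc zero)) zero rewrite g = cong (headed q) (hd-nth ls)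
    row-left l g e (suc (suc (suc p))) zero = cong plain (sym (tl-nth ls p))
    row-left l g e (suc p) (suc i) = row-left l g e p i

  row-cong : ∀ {ls ls' rs rs' x x'} → ls ≈ ls' → x ≡ x' → rs ≈ rs' → ∀ p i → row ls x rs p i ≡ row ls' x' rs' p i
  row-cong a b c zero    zero    = b
  row-cong a b c zero    (suc i) = cong plain (c i)
  row-cong a b c (suc p) zero    = cong plain (a p)
  row-cong a b c (suc p) (suc i) = row-cong a b c p i

  row-head : ∀ ls x rs p → row ls x rs p p ≡ x
  row-head ls x rs zero    = refl
  row-head ls x rs (suc p) = row-head ls x rs p

  row-next : ∀ ls x rs p → row ls x rs p (suc p) ≡ plain (nth rs 0)
  row-next ls x rs zero    = refl
  row-next ls x rs (suc p) = row-next ls x rs p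

  row-inv : ∀ ls x rs p i {q s} → row ls x rs p i ≡ headed q s → i ≡ p × x ≡ headed q s
  row-inv ls x rs zero    zero    e = refl , e
  row-inv ls x rs (suc p) (suc i) e = let a , b = row-inv ls x rs p i e in cong suc a , b

  nth-end : ∀ xs i → length xs ≤ i → nth xs i ≡ blank
  nth-end []       i       le       = refl
  nth-end (x ∷ xs) (suc i) (s≤s le) = nth-end xs i le

  row-end : ∀ ls x rs p i → p + length rs < i → row ls x rs p i ≡ plain blank
  row-end ls x rs zero    (suc i) (s≤s le) = cong plain (nth-end rs i le)
  row-end ls x rs (suc p) (suc i) (s≤s le) = row-end ls x rs p i le

  row-begin : ∀ ls x rs p → length ls + 2 ≤ p → row ls x rs p 0 ≡ plain blank × row ls x rs p 1 ≡ plain blank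
  row-begin ls x rs zero le with () ← n≮0 (≤-trans (m≤n+m 1 (suc (length ls))) (≤-trans (≤-reflexive (sym (+-suc (length ls) 1))) le))
  row-begin ls x rs (suc zero) le with () ← n≮0 (≤-pred (≤-trans (m≤n+m 2 (length ls)) le))
  row-begin ls x rs (suc (suc p)) le = cong plain (nth-end ls (suc p) (m≤n⇒m≤1+n le')) , cong plain (nth-end ls p le')
    where
    le' : length ls ≤ p
    le' = +-cancelʳ-≤ 2 (length ls) p (≤-trans le (≤-reflexive (+-comm 2 p)))

  adv : MConf M → MConf M
  adv c = fromMaybe c (step M c)

  shift : Action → ℕ
  shift nothing                = 1
  shift (just (_ , _ , left))  = 0
  shift (just (_ , _ , stay))  = 1
  shift (just (_ , _ , right)) = 2

  rowOf : MConf M → ℕ → ℕ → Cell Q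
  rowOf (mconf q (tape ls h rs)) = row ls (headed q h) rs

  drift : MConf M → ℕ
  drift (mconf q (tape ls h rs)) = shift (δ q h)

  row-adv : ∀ c p i → evolved (rowOf c p i) (rowOf c p (1 + i)) (rowOf c p (2 + i)) ≡ rowOf (adv c) (drift c + p) (2 + i)
  row-adv (mconf q (tape ls h rs)) p i with δ q h in eq
  ... | nothing = trans (row-stay {ls} {rs} (λ _ _ → refl) (cong goesRight eq) (cong goesLeft eq) p i)
      (row-cong (λ _ → refl) (cong (becomes q h) eq) (λ _ → refl) (suc p) (2 + i))
  ... | just (q' , w , stay) = trans (row-stay {ls} {rs} (λ _ _ → refl) (cong goesRight eq) (cong goesLeft eq) p i)
      (row-cong (λ _ → refl) (cong (becomes q h) eq) (λ _ → refl) (suc p) (2 + i))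
  ... | just (q' , w , left) rewrite move-left ls w rs =
      row-left {ls} {rs} (λ _ _ → refl) (cong goesRight eq) (cong goesLeft eq) (cong (becomes q h) eq) p i
  ... | just (q' , w , right) rewrite move-right ls w rs =
      row-right {ls} {rs} (λ _ _ → refl) (cong goesRight eq) (cong goesLeft eq) (cong (becomes q h) eq) p i

  -- On the left two blanks remain, for the two cells of a row that no window yields. On the right
  -- the bound has to grow by 2 in each row, the largest `drift`.
  Fits : ℕ → MConf M → ℕ → Set
  Fits B c p = length (Tape.lefts (MConf.tp c)) + 2 ≤ p × p + length (Tape.rights (MConf.tp c)) ≤ B

  length-tl : ∀ (xs : List Sym) → length (tl xs) ≤ length xs
  length-tl []       = z≤n
  length-tl (_ ∷ xs) = n≤1+n _

  fits-adv : ∀ {B} c p → Fits B c p → Fits (2 + B) (adv c) (drift c + p)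
  fits-adv (mconf q (tape ls h rs)) p (a , b) with δ q h
  ... | nothing              = m≤n⇒m≤1+n a , m≤n⇒m≤1+n (s≤s b)
  ... | just (_ , w , stay)  = m≤n⇒m≤1+n a , m≤n⇒m≤1+n (s≤s b)
  ... | just (_ , w , left)  rewrite move-left ls w rs =
      ≤-trans (+-monoˡ-≤ 2 (length-tl ls)) a , ≤-trans (≤-reflexive (+-suc p (length rs))) (m≤n⇒m≤1+n (s≤s b))
  ... | just (_ , w , right) rewrite move-right ls w rs =
      s≤s (m≤n⇒m≤1+n a) , s≤s (s≤s (≤-trans (+-monoʳ-≤ p (length-tl rs)) b))

  run-adv : ∀ t c → run M (suc t) c ≡ adv (run M t c)
  run-adv zero c with step M c
  ... | nothing = refl
  ... | just _  = refl
  run-adv (suc t) c with step M c in eq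
  ... | nothing rewrite eq = refl
  ... | just c' = run-adv t c'

  run-halted-at : ∀ t k c → Halted M (run M t c) → run M (k + t) c ≡ run M t c
  run-halted-at t zero    c h = refl
  run-halted-at t (suc k) c h = trans (run-adv (k + t) c)
    (trans (cong adv (run-halted-at t k c h)) (cong (fromMaybe (run M t c)) h))

  initConf-atR : ∀ v → initConf M v ≡ mconf zero (atR [] (bits v))
  initConf-atR []      = refl
  initConf-atR (_ ∷ _) = refl

  -- The rows of a run

  module Simulation (v : List Bool) where

    Accepts : ℕ → Set
    Accepts t = Halted M (run M t (initConf M v)) × output M (run M t (initConf M v)) ≡ true ∷ []

    -- A halted configuration is final, so any two halting times have the same output.
    accepts-at : ∀ t t' → Halted M (run M t (initConf M v)) → Accepts t' → output M (run M t (initConf M v)) ≡ true ∷ []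
    accepts-at t t' h (h' , o) with ≤-total t t'
    ... | inj₁ le = trans (cong (output M) (sym (trans (cong (λ k → run M k _) (sym (m∸n+n≡m le))) (run-halted-at t (t' ∸ t) _ h)))) o
    ... | inj₂ le = trans (cong (output M) (trans (cong (λ k → run M k _) (sym (m∸n+n≡m le))) (run-halted-at t' (t ∸ t') _ h'))) o

    -- Row 0 has `origin` at 2 and no head; moving right out of it, with the shift, the head enters
    -- row 1 at 4. Hence time t is row `suc t`.
    pos : ℕ → ℕ
    pos zero    = 4
    pos (suc t) = drift (run M t (initConf M v)) + pos t

    z : ℕ → ℕ → Cell Q
    z zero    = row [] origin (bits v) 2
    z (suc t) = rowOf (run M t (initConf M v)) (pos t)

    init-conf : initConf M v ≡ mconf zero (atR [] (bits v))
    init-conf = initConf-atR v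

    z-evolved : ∀ t i → evolved (z t i) (z t (1 + i)) (z t (2 + i)) ≡ z (suc t) (2 + i)
    z-evolved zero i = trans (row-right {[]} {bits v} (λ _ _ → refl) refl refl refl 2 i)
      (trans (row-cong (λ { zero → refl ; (suc k) → refl }) refl (λ _ → refl) 4 (2 + i)) (cong (λ c → rowOf c 4 (2 + i)) (sym init-conf)))
    z-evolved (suc t) i = trans (row-adv (run M t (initConf M v)) (pos t) i)
      (cong (λ c → rowOf c (pos (suc t)) (2 + i)) (sym (run-adv t (initConf M v))))

    fits : ∀ t → Fits (4 + length v + 2 * t) (run M t (initConf M v)) (pos t)
    fits zero rewrite init-conf = s≤s (s≤s z≤n) , +-monoʳ-≤ 4 (≤-trans (length-tl (bits v)) (≤-reflexive (trans (length-map bit v) (sym (+-identityʳ _)))))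
    fits (suc t) = subst₂ (λ B c → Fits B c (pos (suc t)))
      (solve 2 (λ l t → con 2 :+ (con 4 :+ l :+ con 2 :* t) := con 4 :+ l :+ con 2 :* (con 1 :+ t)) refl (length v) t)
      (sym (run-adv t (initConf M v))) (fits-adv (run M t (initConf M v)) (pos t) (fits t))

    z-end : ∀ t i → 4 + length v + 2 * t < i → z t i ≡ plain blank
    z-end zero i le = row-end [] origin (bits v) 2 i (≤-<-trans (+-mono-≤ (s≤s (s≤s (z≤n {2}))) (≤-trans (≤-reflexive (length-map bit v)) (≤-reflexive (sym (+-identityʳ _))))) le)
    z-end (suc t) i le with run M t (initConf M v) | fits t
    ... | mconf q (tape ls h rs) | _ , b = row-end ls (headed q h) rs (pos t) i (≤-<-trans b (≤-<-trans (+-monoʳ-≤ (4 + length v) (*-monoʳ-≤ 2 (n≤1+n t))) le))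

    z-begin : ∀ t → z t 0 ≡ plain blank × z t 1 ≡ plain blank
    z-begin zero = refl , refl
    z-begin (suc t) with run M t (initConf M v) | fits t
    ... | mconf q (tape ls h rs) | a , _ = row-begin ls (headed q h) rs (pos t) a

    row≢done : ∀ ls x rs → isDone x ≡ false → ∀ p i → isDone (row ls x rs p i) ≡ false
    row≢done ls x rs e zero    zero    = e
    row≢done ls x rs e zero    (suc i) = refl
    row≢done ls x rs e (suc p) zero    = refl
    row≢done ls x rs e (suc p) (suc i) = row≢done ls x rs e p i

    z≢done : ∀ t i → isDone (z t i) ≡ false
    z≢done zero i = row≢done [] origin (bits v) refl 2 i
    z≢done (suc t) i with run M t (initConf M v)
    ... | mconf q (tape ls h rs) = row≢done ls (headed q h) rs refl (pos t) i

    accepting-inv : ∀ c → accepting c ≡ true → ∃ λ q → c ≡ headed q (bit true) × δ q (bit true) ≡ nothing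
    accepting-inv (headed q (bit true)) e with δ q (bit true) in eq
    ... | nothing = q , refl , eq

    isBlank-inv : ∀ c → isBlank c ≡ true → c ≡ plain blank
    isBlank-inv (plain blank) e = refl

    plain-inj : ∀ {s s'} → plain {Q} s ≡ plain s' → s ≡ s'
    plain-inj refl = refl

    readBits-single : ∀ h rs → h ≡ bit true → nth rs 0 ≡ blank → readBits (h ∷ rs) ≡ true ∷ []
    readBits-single .(bit true) []           refl e = refl
    readBits-single .(bit true) (blank ∷ rs) refl e = refl

    accepted : ∀ t i → accepting (z t i) ≡ true → isBlank (z t (suc i)) ≡ true → ∃ Accepts
    accepted zero i a b with accepting-inv (z 0 i) a
    ... | q , e , _ with () ← proj₂ (row-inv [] origin (bits v) 2 i e)
    accepted (suc t) i a b with accepting-inv (z (suc t) i) a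
    ... | q , e , halt = t , go (run M t (initConf M v)) e (isBlank-inv _ b)
      where
      go : ∀ c → rowOf c (pos t) i ≡ headed q (bit true) → rowOf c (pos t) (suc i) ≡ plain blank → Halted M c × output M c ≡ true ∷ []
      go (mconf q' (tape ls h rs)) e e' with row-inv ls (headed q' h) rs (pos t) i e
      ... | refl , refl = halted , readBits-single (bit true) rs refl (plain-inj (trans (sym (row-next ls (headed q' h) rs (pos t))) e'))
        where
        halted : Halted M (mconf q' (tape ls (bit true) rs))
        halted rewrite halt = refl

    accept-row : ∀ t → Accepts t → accepting (z (suc t) (pos t)) ≡ true × isBlank (z (suc t) (suc (pos t))) ≡ true
    accept-row t (h , o) with run M t (initConf M v)
    ... | mconf q (tape ls c rs) rewrite row-head ls (headed q c) rs (pos t) | row-next ls (headed q c) rs (pos t) = go c rs h o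
      where
      go : ∀ c rs → step M (mconf q (tape ls c rs)) ≡ nothing → readBits (c ∷ rs) ≡ true ∷ [] →
           accepting (headed q c) ≡ true × isBlank (plain (nth rs 0)) ≡ true
      go (bit true) rs h o with δ q (bit true)
      go (bit true) []           h o | nothing = refl , refl
      go (bit true) (blank ∷ rs) h o | nothing = refl , refl

    -- All rows are written one after the other into the single sequence c, with row t from position t * s on.
    -- Every row is shifted by one position against its predecessor, so that the head moves by 0, 1 or 2 positions
    -- and the cells above any position have already been written.
    module Helix (u T N' : ℕ) (c : ℕ → Cell Q)
      (room : 4 + length v + 2 * (T + 5) ≤ u) (N'-hi : N' < (T + 5) * (2 + u)) (N'-lo : (T + 3) * (2 + u) ≤ N')
      (c-origin : c 0 ≡ origin) (c-input : ∀ k → suc k < 4 + u → c (suc k) ≡ plain (nth (bits v) k))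
      (c-step : ∀ j → 4 + u ≤ j → c j ≡ F (c (j ∸ 1)) (c (j ∸ (4 + u))) (c (1 + (j ∸ (4 + u)))) (c (2 + (j ∸ (4 + u))))) where

      s D : ℕ
      s = 2 + u
      D = 2 + s

      -- Positions 0 and 1 of a row are not stored. They are blank, and so are the last two cells of
      -- the row before, which take their places in the windows.
      spec : ℕ → Cell Q
      spec j = z (j / s) (2 + j % s)

      spec-at : ∀ t i → i < s → spec (i + t * s) ≡ z t (2 + i)
      spec-at t i p = cong₂ (λ a b → z a (2 + b)) quot (trans ([m+kn]%n≡m%n i t s) (m<n⇒m%n≡m p))
        where
        quot : (i + t * s) / s ≡ t
        quot = trans (+-distrib-/ i (t * s) (subst (_< s) (sym (trans (cong₂ _+_ (m<n⇒m%n≡m p) (m*n%n≡0 t s)) (+-identityʳ i))) p))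
          (cong₂ _+_ (m<n⇒m/n≡0 p) (m*n/n≡m t s))

      blank-at : ∀ t i → t < T + 5 → u ≤ i → z t (2 + i) ≡ plain blank
      blank-at t i lt le = z-end t (2 + i) (s≤s (m≤n⇒m≤1+n (≤-trans (+-monoʳ-≤ (4 + length v) (*-monoʳ-≤ 2 (<⇒≤ lt))) (≤-trans room le))))

      Windowed : ℕ → ℕ → ℕ → Set
      Windowed d t i = spec d ≡ z t i × spec (1 + d) ≡ z t (1 + i) × spec (2 + d) ≡ z t (2 + i)

      windowed : ∀ t i → i < s → t < T + 5 → D ≤ i + suc t * s → Windowed (i + suc t * s ∸ D) t i
      windowed t (suc (suc i)) p lt le = subst (λ d → Windowed d t (2 + i)) (sym (trans (cong (_∸ D) (solve 3 (λ i s m → con 2 :+ i :+ (s :+ m) := con 2 :+ s :+ (i :+ m)) refl i s (t * s))) (m+n∸m≡n D (i + t * s))))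
        (spec-at t i (<-trans (<-trans (n<1+n i) (n<1+n (suc i))) p) , spec-at t (1 + i) (<-trans (n<1+n (suc i)) p) , spec-at t (2 + i) p)
      windowed zero 0 p lt le = ⊥-elim (<-irrefl refl (≤-trans (n≤1+n _) (≤-trans le (≤-reflexive (+-identityʳ s)))))
      windowed zero 1 p lt le = ⊥-elim (<-irrefl refl (≤-trans le (≤-reflexive (cong suc (+-identityʳ s)))))
      windowed (suc t) 0 p lt le = subst (λ d → Windowed d (suc t) 0) (sym (trans (cong (_∸ D) (solve 2 (λ u m → con 2 :+ u :+ (con 2 :+ u :+ m) := con 4 :+ u :+ (u :+ m)) refl u (t * s))) (m+n∸m≡n D (u + t * s))))
        ( trans (spec-at t u (m≤n+m (suc u) 1)) (trans (blank-at t u (<-trans (n<1+n t) lt) ≤-refl) (sym (proj₁ (z-begin (suc t)))))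
        , trans (spec-at t (suc u) ≤-refl) (trans (blank-at t (suc u) (<-trans (n<1+n t) lt) (n≤1+n u)) (sym (proj₂ (z-begin (suc t)))))
        , spec-at (suc t) 0 (s≤s z≤n) )
      windowed (suc t) 1 p lt le = subst (λ d → Windowed d (suc t) 1) (sym (trans (cong (_∸ D) (solve 2 (λ u m → con 3 :+ u :+ (con 2 :+ u :+ m) := con 4 :+ u :+ (con 1 :+ u :+ m)) refl u (t * s))) (m+n∸m≡n D (suc u + t * s))))
        ( trans (spec-at t (suc u) ≤-refl) (trans (blank-at t (suc u) (<-trans (n<1+n t) lt) (n≤1+n u)) (sym (proj₂ (z-begin (suc t)))))
        , spec-at (suc t) 0 (s≤s z≤n) , spec-at (suc t) 1 (s≤s (s≤s z≤n)) )

      record Window (j : ℕ) : Set where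
        field
          t i : ℕ
          here-spec : spec j ≡ z (suc t) (2 + i)
          above     : Windowed (j ∸ D) t i

      window-at : ∀ j → D ≤ j → j ≤ N' → Window j
      window-at j le le' = go (j / s) (m≡m%n+[m/n]*n j s) (m<n*o⇒m/o<n {j} {T + 5} {s} (≤-<-trans le' N'-hi))
        where
        i = j % s
        i<s : i < s
        i<s = m%n<n j s
        go : ∀ t → j ≡ i + t * s → t < T + 5 → Window j
        go zero e lt = ⊥-elim (<-irrefl refl (≤-<-trans (≤-trans (m≤n+m s 2) le) (subst (_< s) (trans (sym (+-identityʳ i)) (sym e)) i<s)))
        go (suc t) e lt = record { t = t ; i = i ; here-spec = trans (cong spec e) (spec-at (suc t) i i<s)
          ; above = subst (λ k → Windowed (k ∸ D) t i) (sym e) (windowed t i i<s (<-trans (n<1+n t) lt) (subst (D ≤_) e le)) }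

      -- The D = s + 2 prescribed cells are row 0 and two cells of row 1. The latter have positions
      -- 2 and 3, left of the head at 4, and are blank.
      c-spec-initial : ∀ j → j < D → c j ≡ spec j
      c-spec-initial zero lt = trans c-origin (sym (spec-at 0 0 (s≤s z≤n)))
      c-spec-initial (suc k) lt with suc k <? s
      ... | yes p = trans (c-input k lt) (sym (trans (cong spec (sym (+-identityʳ (suc k)))) (spec-at 0 (suc k) p)))
      ... | no ¬p = trans (c-input k lt) (sym (trans (cong spec (trans (sym e) (cong (d +_) (sym (+-identityʳ s)))))
          (trans (spec-at 1 d (<-≤-trans d<2 (s≤s (s≤s z≤n)))) (trans (first d d<2) (sym (blank-at 0 (suc k) (≤-trans (s≤s z≤n) (m≤n+m 5 T)) (≤-trans (m≤n+m u 2) (≮⇒≥ ¬p))))))))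
        where
        d = suc k ∸ s
        e : d + s ≡ suc k
        e = m∸n+n≡m (≮⇒≥ ¬p)
        d<2 : d < 2
        d<2 = +-cancelʳ-< s d 2 (subst (_< D) (sym e) lt)
        first : ∀ d → d < 2 → z 1 (2 + d) ≡ plain blank
        first zero _ rewrite init-conf = refl
        first (suc zero) _ rewrite init-conf = refl
        first (suc (suc d)) (s≤s (s≤s ()))

      F-spec : ∀ j → (w : Window j) → let open Window w in F (spec (j ∸ 1)) (spec (j ∸ D)) (spec (1 + (j ∸ D))) (spec (2 + (j ∸ D)))
        ≡ (if accepting (z t i) ∧ isBlank (z t (suc i)) then done else spec j)
      F-spec j w with Window.t w | Window.i w | Window.here-spec w | Window.above w
      ... | t | i | h | a , b , d rewrite z≢done ((j ∸ 1) / s) (2 + (j ∸ 1) % s) | a | b | d | z-evolved t i | h = refl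

      -- Once `done` has appeared the cells no longer show the run; all that has to be remembered is
      -- that a configuration accepts.
      Follows : ℕ → Set
      Follows j = (∀ i → i ≤ j → c i ≡ spec i) ⊎ (c j ≡ done × ∃ Accepts)

      F-cong : ∀ {π π' α α' β β' γ γ'} → π ≡ π' → α ≡ α' → β ≡ β' → γ ≡ γ' → F π α β γ ≡ F π' α' β' γ'
      F-cong refl refl refl refl = refl

      c-spec : ∀ j → D ≤ suc j → suc j ≤ N' → (∀ i → i ≤ j → c i ≡ spec i) → c (suc j) ≡ F (spec j) (spec (suc j ∸ D)) (spec (1 + (suc j ∸ D))) (spec (2 + (suc j ∸ D)))
      c-spec j le le' h = trans (c-step (suc j) le) (F-cong (h j ≤-refl) (h _ (≤-trans (≤-trans (n≤1+n _) (n≤1+n _)) b)) (h _ (≤-trans (n≤1+n _) b)) (h _ b))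
        where
        b : 2 + (suc j ∸ D) ≤ j
        b = ≤-pred (subst (3 + (suc j ∸ D) ≤_) (m+[n∸m]≡n le) (+-monoˡ-≤ (suc j ∸ D) (s≤s (s≤s (s≤s z≤n)))))

      extend : ∀ {j} → (∀ i → i ≤ j → c i ≡ spec i) → c (suc j) ≡ spec (suc j) → ∀ i → i ≤ suc j → c i ≡ spec i
      extend h e i le with m≤n⇒m<n∨m≡n le
      ... | inj₁ (s≤s lt) = h i lt
      ... | inj₂ refl     = e

      follow : ∀ j → D ≤ suc j → suc j ≤ N' → Follows j → Follows (suc j)
      follow j le le' (inj₂ (e , acc)) = inj₂ (trans (c-step (suc j) le) (cong (λ π → F π (c (suc j ∸ D)) (c (1 + (suc j ∸ D))) (c (2 + (suc j ∸ D)))) e) , acc)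
      follow j le le' (inj₁ h) with window-at (suc j) le le'
      ... | w with accepting (z (Window.t w) (Window.i w)) in ea | isBlank (z (Window.t w) (suc (Window.i w))) in eb
           | trans (c-spec j le le' h) (F-spec (suc j) w)
      ... | true  | true  | e = inj₂ (e , accepted (Window.t w) (Window.i w) ea eb)
      ... | true  | false | e = inj₁ (extend h e)
      ... | false | _     | e = inj₁ (extend h e)

      follows : ∀ j → j ≤ N' → Follows j
      follows j le with j <? D
      ... | yes p = inj₁ (λ i q → c-spec-initial i (≤-<-trans q p))
      follows zero le | no ¬p = ⊥-elim (¬p (s≤s z≤n))
      follows (suc j) le | no ¬p = follow j (≮⇒≥ ¬p) le (follows j (<⇒≤ le))

      done⇒accepts : c N' ≡ done → ∃ Accepts
      done⇒accepts e with follows N' ≤-refl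
      ... | inj₂ (_ , acc) = acc
      ... | inj₁ h = contradiction (trans (sym (z≢done (N' / s) (2 + N' % s))) (trans (cong isDone (sym (h N' ≤-refl))) (cong isDone e))) λ ()

      persist : ∀ k j → D ≤ suc j → c j ≡ done → c (k + j) ≡ done
      persist zero    j le e = e
      persist (suc k) j le e = trans (c-step (suc (k + j)) (≤-trans le (s≤s (m≤n+m j k))))
        (cong (λ π → F π (c (suc (k + j) ∸ D)) (c (1 + (suc (k + j) ∸ D))) (c (2 + (suc (k + j) ∸ D)))) (persist k j le e))

      -- Time t is row t + 1, and its accepting pair of cells is seen by a window of row t + 2. This
      -- is why N' must reach (T + 3) s.
      accepts⇒done : ∀ t → t ≤ T → Accepts t → c N' ≡ done
      accepts⇒done t t≤T acc = trans (cong c (sym (m∸n+n≡m j*≤N'))) (persist (N' ∸ j*) j* (m≤n⇒m≤1+n D≤j*) (hit j* refl D≤j* j*≤N'))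
        where
        p = pos t
        j* = p + suc (suc t) * s
        p<s : p < s
        p<s = s≤s (≤-trans (m≤m+n p _) (≤-trans (proj₂ (fits t)) (≤-trans (+-monoʳ-≤ (4 + length v) (*-monoʳ-≤ 2 (≤-trans t≤T (m≤m+n T 5)))) (≤-trans room (n≤1+n u)))))
        D≤j* : D ≤ j*
        D≤j* = ≤-trans (≤-reflexive (+-comm 2 s)) (≤-trans (+-monoʳ-≤ s (s≤s (s≤s z≤n))) (≤-trans (+-monoʳ-≤ s (m≤m+n s (t * s))) (m≤n+m (s + (s + t * s)) p)))
        j*≤N' : j* ≤ N'
        j*≤N' = ≤-trans (+-monoˡ-≤ (suc (suc t) * s) (<⇒≤ p<s)) (≤-trans (*-monoˡ-≤ s (≤-trans (s≤s (s≤s (s≤s t≤T))) (≤-reflexive (+-comm 3 T)))) N'-lo)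
        hit : ∀ j → j ≡ j* → D ≤ j → j ≤ N' → c j ≡ done
        hit (suc j) e le le' with follows j (<⇒≤ le')
        ... | inj₂ (d , _) = persist 1 j le d
        ... | inj₁ h = trans (c-spec j le le' h) (trans (F-spec (suc j) w) (cong (λ b → if b then done else spec (suc j)) (cong₂ _∧_ (proj₁ (accept-row t acc)) (proj₂ (accept-row t acc)))))
          where
          w : Window (suc j)
          w = record { t = suc t ; i = p ; here-spec = trans (cong spec e) (spec-at (suc (suc t)) p p<s)
            ; above = subst (λ k → Windowed (k ∸ D) (suc t) p) (sym e) (windowed (suc t) p p<s (≤-trans (s≤s (s≤s t≤T)) (≤-trans (m≤n+m (2 + T) 3) (≤-reflexive (+-comm 5 T)))) D≤j*) }

-- Printing

catFrom-cong : ∀ i k {f g : ℕ → List Bool} → (∀ j → i ≤ j → j < i + k → f j ≡ g j) → catFrom i k f ≡ catFrom i k g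
catFrom-cong i zero    h = refl
catFrom-cong i (suc k) h = cong₂ _++_ (h i ≤-refl (≤-trans (s≤s (m≤m+n i k)) (≤-reflexive (sym (+-suc i k)))))
  (catFrom-cong (suc i) k (λ j a b → h j (<⇒≤ a) (≤-trans b (≤-reflexive (sym (+-suc i k))))))

catFrom-shift : ∀ i j k {f g : ℕ → List Bool} → (∀ l → l < k → f (i + l) ≡ g (j + l)) → catFrom i k f ≡ catFrom j k g
catFrom-shift i j zero    h = refl
catFrom-shift i j (suc k) {f} {g} h = cong₂ _++_ (subst₂ (λ a b → f a ≡ g b) (+-identityʳ i) (+-identityʳ j) (h 0 (s≤s z≤n)))
  (catFrom-shift (suc i) (suc j) k (λ l lt → subst₂ (λ a b → f a ≡ g b) (+-suc i l) (+-suc j l) (h (suc l) (s≤s lt))))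

catFrom-+ : ∀ i a b f → catFrom i (a + b) f ≡ catFrom i a f ++ catFrom (i + a) b f
catFrom-+ i zero    b f = cong (λ j → catFrom j b f) (sym (+-identityʳ i))
catFrom-+ i (suc a) b f = trans (cong (f i ++_) (trans (catFrom-+ (suc i) a b f) (cong (λ j → catFrom (suc i) a f ++ catFrom j b f) (sym (+-suc i a)))))
  (sym (++-assoc (f i) _ _))

catFrom-* : ∀ s j n k f → catFrom (s + j * k) (n * k) f ≡ catFrom j n (λ j → catFrom 0 k (λ a → f (s + (a + j * k))))
catFrom-* s j zero    k f = refl
catFrom-* s j (suc n) k f = trans (catFrom-+ (s + j * k) k (n * k) f) (cong₂ _++_
  (catFrom-shift (s + j * k) 0 k (λ l _ → cong f (trans (+-assoc s (j * k) l) (cong (s +_) (+-comm (j * k) l)))))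
  (trans (cong (λ i → catFrom i (n * k) f) (trans (+-assoc s (j * k) k) (cong (s +_) (+-comm (j * k) k)))) (catFrom-* s (suc j) n k f)))

catFrom-list : ∀ j l {f : ℕ → List Bool} {h : Bool → List Bool} → (∀ k → k < length l → f (j + k) ≡ h (bitAt l k)) → catFrom j (length l) f ≡ concatMap h l
catFrom-list j []      e = refl
catFrom-list j (b ∷ l) {f} e = cong₂ _++_ (trans (cong f (sym (+-identityʳ j))) (e 0 (s≤s z≤n)))
  (catFrom-list (suc j) l (λ k lt → trans (cong f (sym (+-suc j k))) (e (suc k) (s≤s lt))))

replicate-++ : ∀ m n (b : Bool) → replicate m b ++ replicate n b ≡ replicate (m + n) b
replicate-++ zero    n b = refl
replicate-++ (suc m) n b = cong (b ∷_) (replicate-++ m n b)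

catFrom-replicate : ∀ i k n (b : Bool) → catFrom i k (λ _ → replicate n b) ≡ replicate (k * n) b
catFrom-replicate i zero    n b = refl
catFrom-replicate i (suc k) n b = trans (cong (replicate n b ++_) (catFrom-replicate (suc i) k n b)) (replicate-++ n (k * n) b)

encVecs-tabulate : ∀ {A : Set} (e : A → List Bool) (G : ℕ → List Bool) i n (h : Fin n → A) → (∀ f → e (h f) ≡ G (i + toℕ f)) →
  encVecs e (tabulate h) ≡ catFrom i n G
encVecs-tabulate e G i zero    h q = refl
encVecs-tabulate e G i (suc n) h q = cong₂ _++_ (trans (q zero) (cong G (+-identityʳ i)))
  (encVecs-tabulate e G (suc i) n (h ∘ suc) (λ f → trans (q (suc f)) (cong G (+-suc i (toℕ f)))))

encVecs-replicate : ∀ m n (b : Bool) → encVecs encBits (Data.Vec.replicate m (Data.Vec.replicate n b)) ≡ replicate (m * n) b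
encVecs-replicate zero    n b = refl
encVecs-replicate (suc m) n b = trans (cong₂ _++_ (toList-replicate n) (encVecs-replicate m n b)) (replicate-++ n (m * n) b)
  where
  toList-replicate : ∀ n → toList (Data.Vec.replicate n b) ≡ replicate n b
  toList-replicate zero    = refl
  toList-replicate (suc n) = cong (b ∷_) (toList-replicate n)

encBits-replicate : ∀ n (b : Bool) → encBits (Data.Vec.replicate n b) ≡ replicate n b
encBits-replicate zero    b = refl
encBits-replicate (suc n) b = cong (b ∷_) (encBits-replicate n b)

encP : PF → List Bool
encP (pvar k)    = false ∷ false ∷ encℕ k
encP (pconj p q) = true ∷ false ∷ encP p ++ encP q
encP (pdisj p q) = true ∷ true ∷ encP p ++ encP q

encLocal : PF → List Bool
encLocal p = false ∷ true ∷ encP (pdisj (pvar 0) p)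

module _ (m : ℕ) (ψ : ℕ → PF) (bounded : ∀ k → k < suc m → AllP (_< suc m) (ψ k)) where
  open Network m ψ bounded

  enc-form : ∀ p → AllP (_< n) p → encFormula (form p) ≡ encP p
  enc-form (pvar k)    a       = cong (λ k → false ∷ false ∷ encℕ k) (toℕ-clamp a)
  enc-form (pconj p q) (a , b) = cong₂ (λ s t → true ∷ false ∷ s ++ t) (enc-form p a) (enc-form q b)
  enc-form (pdisj p q) (a , b) = cong₂ (λ s t → true ∷ true ∷ s ++ t) (enc-form p a) (enc-form q b)

  enc-instance : encInstance instance′ ≡ encℕ n ++ catFrom 0 n (encLocal ∘ ψ) ++ replicate (n * n) false ++ replicate n false
  enc-instance = cong (encℕ n ++_) (cong₂ _++_
    (encVecs-tabulate encFormula (encLocal ∘ ψ) 0 n (local ∘ toℕ) (λ i → cong (λ s → false ∷ true ∷ s) (enc-form (rule (toℕ i)) (rule-bounded (toℕ<n i)))))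
    (cong₂ _++_ (encVecs-replicate n n false) (encBits-replicate n false)))

repeatC : ∀ {d} → ℕ → Code d → Code d
repeatC zero    E = skip
repeatC (suc k) E = E ⨾ repeatC k E

seqC : ∀ {d} → ℕ → ℕ → (ℕ → Code d) → Code d
seqC i zero    f = skip
seqC i (suc k) f = f i ⨾ seqC (suc i) k f

-- c nested loops, all bounded by the same variable; `inject₁` keeps its number as the depth grows.
powC : ∀ {d} → ℕ → Fin d → Code d
powC zero    r = emit true
powC (suc c) r = for r (powC c (inject₁ r))

module _ (x : List Bool) where

  ⟦repeatC⟧ : ∀ {d} k (E : Code d) {n b ρ} → ⟦ E ⟧ x ρ ≡ replicate n b → ⟦ repeatC k E ⟧ x ρ ≡ replicate (k * n) b
  ⟦repeatC⟧ zero    E e = refl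
  ⟦repeatC⟧ (suc k) E {n} {b} e = trans (cong₂ _++_ e (⟦repeatC⟧ k E e)) (replicate-++ n (k * n) b)

  ⟦units⟧ : ∀ {d} k b ρ → ⟦ repeatC {d} k (emit b) ⟧ x ρ ≡ replicate k b
  ⟦units⟧ zero    b ρ = refl
  ⟦units⟧ (suc k) b ρ = cong (b ∷_) (⟦units⟧ k b ρ)

  ⟦seqC⟧ : ∀ {d} i k (f : ℕ → Code d) ρ → ⟦ seqC i k f ⟧ x ρ ≡ catFrom i k (λ a → ⟦ f a ⟧ x ρ)
  ⟦seqC⟧ i zero    f ρ = refl
  ⟦seqC⟧ i (suc k) f ρ = cong (⟦ f i ⟧ x ρ ++_) (⟦seqC⟧ (suc i) k f ρ)

  ⟦for⟧ : ∀ {d} (r : Fin d) E n b ρ → (∀ i → ⟦ E ⟧ x (ρ [ d ↦ i ]) ≡ replicate n b) → ⟦ for r E ⟧ x ρ ≡ replicate (ρ (toℕ r) * n) b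
  ⟦for⟧ {d} r E n b ρ e = trans (catFrom-cong 0 (ρ (toℕ r)) (λ i _ _ → e i)) (catFrom-replicate 0 (ρ (toℕ r)) n b)

  ⟦powC⟧ : ∀ {d} c (r : Fin d) ρ → ⟦ powC c r ⟧ x ρ ≡ replicate (ρ (toℕ r) ^ c) true
  ⟦powC⟧ zero    r ρ = refl
  ⟦powC⟧ {d} (suc c) r ρ = ⟦for⟧ r (powC c (inject₁ r)) (ρ (toℕ r) ^ c) true ρ (λ i → trans (⟦powC⟧ c (inject₁ r) (ρ [ d ↦ i ]))
    (cong (λ v → replicate (v ^ c) true) (trans (cong (ρ [ d ↦ i ]) (toℕ-inject₁ r)) (↦-other ρ d i (λ e → <-irrefl e (toℕ<n r))))))

varC : ∀ {d} → Code d → Code d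
varC U = emit false ⨾ emit false ⨾ U ⨾ emit false

conjC disjC : ∀ {d} → Code d → Code d → Code d
conjC E E' = emit true ⨾ emit false ⨾ E ⨾ E'
disjC E E' = emit true ⨾ emit true ⨾ E ⨾ E'

localC : ∀ {d} → Code d → Code d
localC E = emit false ⨾ emit true ⨾ disjC (varC skip) E

module Printer (x : List Bool) {d : ℕ} (ρ : ℕ → ℕ) where

  -- A record, so that U and k can be inferred from the type; the bare equation would not determine
  -- them.
  record Unary′ (U : Code d) (k : ℕ) : Set where
    constructor mkUnary
    field unary : ⟦ U ⟧ x ρ ≡ replicate k true

  record Prints (E : Code d) (p : PF) : Set where
    constructor mkPrints
    field printed : ⟦ E ⟧ x ρ ≡ encP p

  units : ∀ k → Unary′ (repeatC k (emit true)) k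
  units k = mkUnary (⟦units⟧ x k true ρ)

  seq-units : ∀ {U V k l} → Unary′ U k → Unary′ V l → Unary′ (U ⨾ V) (k + l)
  seq-units {k = k} {l} (mkUnary e) (mkUnary e') = mkUnary (trans (cong₂ _++_ e e') (replicate-++ k l true))

  var-prints : ∀ {U k} → Unary′ U k → Prints (varC U) (pvar k)
  var-prints (mkUnary e) = mkPrints (cong (λ s → false ∷ false ∷ s ++ false ∷ []) e)

  conj-prints : ∀ {E E' p p'} → Prints E p → Prints E' p' → Prints (conjC E E') (pconj p p')
  conj-prints (mkPrints e) (mkPrints e') = mkPrints (cong₂ (λ s t → true ∷ false ∷ s ++ t) e e')

  disj-prints : ∀ {E E' p p'} → Prints E p → Prints E' p' → Prints (disjC E E') (pdisj p p')
  disj-prints (mkPrints e) (mkPrints e') = mkPrints (cong₂ (λ s t → true ∷ true ∷ s ++ t) e e')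

  if-prints : ∀ b {E E' p p'} → Prints E p → Prints E' p' → Prints (if b then E else E') (if b then p else p')
  if-prints true  e e' = e
  if-prints false e e' = e'

  local-prints : ∀ {E p} → Prints E p → ⟦ localC E ⟧ x ρ ≡ encLocal p
  local-prints (mkPrints e) = cong (λ s → false ∷ true ∷ true ∷ true ∷ false ∷ false ∷ false ∷ s) e

  for-units : ∀ (r : Fin d) {v} k → ρ (toℕ r) ≡ v → Unary′ (for r (repeatC k (emit true))) (v * k)
  for-units r k refl = mkUnary (⟦for⟧ x r (repeatC k (emit true)) k true ρ (λ i → ⟦units⟧ x k true (ρ [ d ↦ i ])))

  length-unary : ∀ {U k} → Unary′ U k → length (⟦ U ⟧ x ρ) ≡ k
  length-unary {k = k} (mkUnary e) = trans (cong length e) (length-replicate k)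

  to-unary : ∀ {U k l} → k ≡ l → Unary′ U k → Unary′ U l
  to-unary refl e = e

  zero-prints : Prints (varC skip) (pvar 0)
  zero-prints = mkPrints refl

  pow-unary : ∀ c (r : Fin d) → Unary′ (powC c r) (ρ (toℕ r) ^ c)
  pow-unary c r = mkUnary (⟦powC⟧ x c r ρ)

-- The reduction

-- Past the list of prescribed kinds all cells evolve, so a finite list gives the kind at every
-- position.
nthK : ∀ {A : Set} → List (Kind A) → ℕ → Kind A
nthK []       _       = evolve
nthK (k ∷ _)  zero    = k
nthK (_ ∷ ks) (suc j) = nthK ks j

nthK-++ˡ : ∀ {A : Set} (ks ls : List (Kind A)) j → j < length ks → nthK (ks ++ ls) j ≡ nthK ks j
nthK-++ˡ (k ∷ ks) ls zero    lt       = refl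
nthK-++ˡ (k ∷ ks) ls (suc j) (s≤s lt) = nthK-++ˡ ks ls j lt

nthK-++ʳ : ∀ {A : Set} (ks ls : List (Kind A)) j → nthK (ks ++ ls) (length ks + j) ≡ nthK ls j
nthK-++ʳ []       ls j = refl
nthK-++ʳ (k ∷ ks) ls j = nthK-++ʳ ks ls j

nthK-replicate : ∀ {A : Set} n (k : Kind A) j → j < n → nthK (replicate n k) j ≡ k
nthK-replicate (suc n) k zero    lt       = refl
nthK-replicate (suc n) k (suc j) (s≤s lt) = nthK-replicate n k j lt

nthK-end : ∀ {A : Set} (ks : List (Kind A)) j → length ks ≤ j → nthK ks j ≡ evolve
nthK-end []       j       le       = refl
nthK-end (k ∷ ks) (suc j) (s≤s le) = nthK-end ks j le

double : List Bool → List Bool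
double = concatMap (λ b → b ∷ b ∷ [])

length-double : ∀ x → length (double x) ≡ length x * 2
length-double []      = refl
length-double (_ ∷ x) = cong (2 +_) (length-double x)

concatMap-double : ∀ (h : Bool → List Bool) x → concatMap h (double x) ≡ concatMap (λ b → h b ++ h b) x
concatMap-double h []      = refl
concatMap-double h (b ∷ x) = trans (cong (λ z → h b ++ (h b ++ z)) (concatMap-double h x)) (sym (++-assoc (h b) (h b) _))

nth-bits : ∀ l k → k < length l → nth (bits l) k ≡ bit (bitAt l k)
nth-bits (b ∷ l) zero    lt       = refl
nth-bits (b ∷ l) (suc k) (s≤s lt) = nth-bits l k lt

nth-++ˡ : ∀ xs ys k → k < length xs → nth (xs ++ ys) k ≡ nth xs k
nth-++ˡ (x ∷ xs) ys zero    lt       = refl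
nth-++ˡ (x ∷ xs) ys (suc k) (s≤s lt) = nth-++ˡ xs ys k lt

nth-++ʳ : ∀ xs ys k → nth (xs ++ ys) (length xs + k) ≡ nth ys k
nth-++ʳ []       ys k = refl
nth-++ʳ (x ∷ xs) ys k = nth-++ʳ xs ys k

module Reduction (M : TM) (cV cW : ℕ) where

  open Automaton M

  Letter : Set
  Letter = Cell (TM.Q M)

  O Z B : Letter
  O = plain (bit true)
  Z = plain (bit false)
  B = plain blank

  open Circuit (fin-Cell (TM.Q M)) O Z B done (λ ()) (λ ()) (λ ()) F

  ones : ∀ {d} → ℕ → Code d
  ones k = repeatC k (emit true)

  fixedBody : ∀ {d} → Letter → ℕ → Code d
  fixedBody v a = if a ≡ᵇ idx v then varC skip else varC (ones 1)

  -- K depends on the machine alone, so the bits of a cell are unrolled in the program, and loops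
  -- are kept for what depends on x.
  fixedC : ∀ {d} → Letter → Code d
  fixedC v = seqC 0 K λ a → localC (fixedBody v a)

  -- The number of the bit v in cell k + 2 |x| + 2 + i, where i is variable 8: guess cell i comes
  -- right after `origin` and the 2 |x| + 2 cells of `prefix`, so k = 1 is the cell itself and k = 0
  -- its predecessor.
  guessU : ℕ → Letter → Code 9
  guessU k v = ones (2 + idx v + (2 + k) * K) ⨾ for (# 0) (ones (2 * K)) ⨾ for (# 8) (ones K)

  guessBody : ℕ → Code 9
  guessBody a =
    if a ≡ᵇ idx O then disjC (varC (guessU 1 Z)) (disjC (varC (guessU 1 B)) (varC (guessU 0 B)))
    else if a ≡ᵇ idx Z then disjC (varC (guessU 1 O)) (disjC (varC (guessU 1 B)) (varC (guessU 0 B)))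
    else if a ≡ᵇ idx B then disjC (varC (guessU 1 O)) (varC (guessU 1 Z))
    else varC (ones 1)

  guessC : Code 9
  guessC = seqC 0 K λ a → localC (guessBody a)

  -- For the evolving cell 2 + s + i the predecessor is 1 + s + i, and the cells above are i, 1 + i
  -- and 2 + i (`windowU`).
  prevU : Letter → Code 9
  prevU v = ones (2 + idx v + K) ⨾ for (# 5) (ones K) ⨾ for (# 8) (ones K)

  windowU : ℕ → Letter → Code 9
  windowU k v = ones (2 + idx v + k * K) ⨾ for (# 8) (ones K)

  windowC : ℕ → (Σ Letter λ _ → Σ Letter λ _ → Σ Letter λ _ → Letter) → Code 9
  windowC a (π , α , β , γ) = if idx (F π α β γ) ≡ᵇ a then varC skip else
    conjC (varC (prevU π)) (conjC (varC (windowU 0 α)) (conjC (varC (windowU 1 β)) (varC (windowU 2 γ))))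

  windowsC : ℕ → List (Σ Letter λ _ → Σ Letter λ _ → Σ Letter λ _ → Letter) → Code 9
  windowsC a []       = varC skip
  windowsC a (q ∷ qs) = disjC (windowC a q) (windowsC a qs)

  stepC : Code 9
  stepC = seqC 0 K λ a → localC (windowsC a (proj₁ quads))

  inputC : Code 9
  inputC = ifx (# 8) (fixedC O ⨾ fixedC O) (fixedC Z ⨾ fixedC Z)

  zeroRow : ∀ {d} → Fin d → Code d
  zeroRow r = repeatC 2 (emit false) ⨾ for r (repeatC K (emit false))

  dimC accC oneC cellsC tailC : Code 8
  dimC   = ones 2 ⨾ for (# 7) (ones K) ⨾ emit false
  accC   = localC (varC (ones (2 + idx done + K) ⨾ for (# 5) (ones K) ⨾ for (# 6) (ones K)))
  oneC   = localC (varC skip)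
  cellsC = fixedC origin ⨾ for (# 0) inputC ⨾ fixedC O ⨾ fixedC Z
         ⨾ for (# 1) guessC ⨾ for (# 4) (fixedC B) ⨾ for (# 6) stepC
  -- The orderings are n = 2 + N K rows of n zeros; the point is one more.
  tailC  = (zeroRow (# 7) ⨾ zeroRow (# 7) ⨾ for (# 7) (repeatC K (zeroRow {9} (# 7)))) ⨾ zeroRow (# 7)

  -- The variables are 0: |x|, 1: W, 2: U, 3: T, 4: E, 5: s, 6: R, 7: N, in the notation of the module For below.
  defW : Code 1
  defW = powC cW (# 0) ⨾ ones cW

  defU : Code 2
  defU = for (# 0) (ones 2) ⨾ for (# 1) (ones 1) ⨾ ones 2

  defT : Code 3
  defT = powC cV (# 2) ⨾ ones cV

  defE : Code 4
  defE = for (# 3) (ones 2) ⨾ ones 20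

  defS : Code 5
  defS = ones 2 ⨾ for (# 0) (ones 2) ⨾ for (# 1) (ones 1) ⨾ for (# 3) (ones 2) ⨾ ones 19

  defR : Code 6
  defR = for (# 3) (for (# 5) (ones 1)) ⨾ for (# 5) (ones 3)

  defN : Code 7
  defN = ones 2 ⨾ for (# 5) (ones 1) ⨾ for (# 6) (ones 1)

  program : Prog 1
  program = def defW (def defU (def defT (def defE (def defS (def defR (def defN (main (dimC ⨾ accC ⨾ oneC ⨾ cellsC ⨾ tailC))))))))

  -- The instance for one input

  module For (x : List Bool) where

    -- W bounds the witness, U the input of the verifier and T its time. u satisfies `room` for T +
    -- 5 rows with 3 cells to spare, E fills the prescribed part up to 2 + s cells, and R makes N'
    -- equal to (T + 4) s + 1, within the interval that `Helix` demands.
    m W U T E u s R N' : ℕ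
    m = length x
    W = m ^ cW + cW
    U = m * 2 + (W * 1 + 2)
    T = U ^ cV + cV
    E = T * 2 + 20
    u = m * 2 + (W + (T * 2 + 19))
    s = 2 + u
    R = T * s + s * 3
    N' = 1 + s + R

    prefix : List Bool
    prefix = double x ++ true ∷ false ∷ []

    length-prefix : length prefix ≡ m * 2 + 2
    length-prefix = trans (length-++ (double x)) (cong (_+ 2) (length-double x))

    head-kinds tail-kinds initial : List (Kind Letter)
    head-kinds = fixed origin ∷ map (λ b → fixed (plain (bit b))) prefix
    tail-kinds = replicate W guess ++ replicate E (fixed (plain blank))
    initial    = head-kinds ++ tail-kinds

    kind : ℕ → Kind Letter
    kind = nthK initial

    g₀ : ℕ
    g₀ = suc (length prefix)

    length-head : length head-kinds ≡ g₀
    length-head = cong suc (length-map _ prefix)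

    length-initial : length initial ≡ 2 + s
    length-initial = trans (length-++ head-kinds) (trans (cong₂ _+_ (trans length-head (cong suc length-prefix))
      (trans (length-++ (replicate W guess)) (cong₂ _+_ (length-replicate W) (length-replicate E))))
      (solve 3 (λ m w t → con 1 :+ (m :* con 2 :+ con 2) :+ (w :+ (t :* con 2 :+ con 20)) := con 4 :+ (m :* con 2 :+ (w :+ (t :* con 2 :+ con 19)))) refl m W T))

    kind-prefix : ∀ k → k < length prefix → kind (suc k) ≡ fixed (plain (bit (bitAt prefix k)))
    kind-prefix k lt = trans (nthK-++ˡ (map _ prefix) tail-kinds k (subst (k <_) (sym (length-map _ prefix)) lt)) (go prefix k lt)
      where
      go : ∀ l k → k < length l → nthK (map (λ b → fixed (plain {TM.Q M} (bit b))) l) k ≡ fixed (plain (bit (bitAt l k)))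
      go (b ∷ l) zero    lt       = refl
      go (b ∷ l) (suc k) (s≤s lt) = go l k lt

    kind-tail : ∀ i → kind (g₀ + i) ≡ nthK tail-kinds i
    kind-tail i = trans (cong (λ l → kind (l + i)) (sym length-head)) (nthK-++ʳ head-kinds tail-kinds i)

    kind-guess : ∀ i → i < W → kind (g₀ + i) ≡ guess
    kind-guess i lt = trans (kind-tail i) (trans (nthK-++ˡ (replicate W guess) _ i (subst (i <_) (sym (length-replicate W)) lt)) (nthK-replicate W guess i lt))

    kind-blank : ∀ i → i < E → kind (g₀ + (W + i)) ≡ fixed B
    kind-blank i lt = trans (kind-tail (W + i)) (trans (cong (λ l → nthK tail-kinds (l + i)) (sym (length-replicate W)))
      (trans (nthK-++ʳ (replicate W guess) _ i) (nthK-replicate E (fixed B) i lt)))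

    kind-evolve : ∀ j → 2 + s ≤ j → kind j ≡ evolve
    kind-evolve j le = nthK-end initial j (≤-trans (≤-reflexive length-initial) le)

    data Region : ℕ → Set where
      at-origin : Region 0
      at-prefix : ∀ k → k < length prefix → Region (suc k)
      at-guess  : ∀ i → i < W → Region (g₀ + i)
      at-blank  : ∀ i → i < E → Region (g₀ + (W + i))
      at-evolve : ∀ j → 2 + s ≤ j → Region j

    size : 2 + s ≡ g₀ + (W + E)
    size = trans (sym length-initial) (trans (length-++ head-kinds) (cong₂ _+_ length-head (trans (length-++ (replicate W guess)) (cong₂ _+_ (length-replicate W) (length-replicate E)))))

    region : ∀ j → Region j
    region zero = at-origin
    region (suc k) with k <? length prefix
    ... | yes p = at-prefix k p
    ... | no ¬p = subst Region (cong suc (m+[n∸m]≡n (≮⇒≥ ¬p))) (later (k ∸ length prefix))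
      where
      later : ∀ i → Region (g₀ + i)
      later i with i <? W
      ... | yes q = at-guess i q
      ... | no ¬q = subst (λ i → Region (g₀ + i)) (m+[n∸m]≡n (≮⇒≥ ¬q)) (latest (i ∸ W))
        where
        latest : ∀ i → Region (g₀ + (W + i))
        latest i with i <? E
        ... | yes r = at-blank i r
        ... | no ¬r = at-evolve _ (≤-trans (≤-reflexive size) (+-monoʳ-≤ g₀ (+-monoʳ-≤ W (≮⇒≥ ¬r))))

    late : ∀ j → kind j ≡ evolve → 2 + s ≤ j
    late j e with region j
    ... | at-prefix k p = contradiction (trans (sym (kind-prefix k p)) e) λ ()
    ... | at-guess i p  = contradiction (trans (sym (kind-guess i p)) e) λ ()
    ... | at-blank i p  = contradiction (trans (sym (kind-blank i p)) e) λ ()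
    ... | at-evolve j p = p

    guess-region : ∀ j → kind j ≡ guess → ∃ λ i → i < W × j ≡ g₀ + i
    guess-region j e with region j
    ... | at-prefix k p = contradiction (trans (sym (kind-prefix k p)) e) λ ()
    ... | at-guess i p  = i , p , refl
    ... | at-blank i p  = contradiction (trans (sym (kind-blank i p)) e) λ ()
    ... | at-evolve j p = contradiction (trans (sym (kind-evolve j p)) e) λ ()

    guess-pos : ∀ j → kind j ≡ guess → 1 ≤ j
    guess-pos j e with guess-region j e
    ... | i , _ , refl = s≤s z≤n

    open Tableau (2 + s) N' kind (s≤s (s≤s (s≤s z≤n))) late guess-pos public

    pair-prefix : ∀ w → pair x w ≡ prefix ++ w
    pair-prefix w = sym (++-assoc (double x) (true ∷ false ∷ []) w)

    length-pair : ∀ w → length w ≤ W → length (pair x w) ≤ U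
    length-pair w le = begin
      length (pair x w)                ≡⟨ cong length (pair-prefix w) ⟩
      length (prefix ++ w)             ≡⟨ length-++ prefix ⟩
      length prefix + length w         ≡⟨ cong (_+ length w) length-prefix ⟩
      m * 2 + 2 + length w             ≤⟨ +-monoʳ-≤ (m * 2 + 2) le ⟩
      m * 2 + 2 + W                    ≡⟨ solve 2 (λ m w → m :* con 2 :+ con 2 :+ w := m :* con 2 :+ (w :* con 1 :+ con 2)) refl m W ⟩
      U                                ∎
      where open ≤-Reasoning

    Codes : (ℕ → Letter) → List Bool → Set
    Codes c w = ∀ k → suc k < 2 + s → c (suc k) ≡ plain (nth (bits (pair x w)) k)

    codes : ∀ {c} w → Valid c → (∀ i → i < W → c (g₀ + i) ≡ plain (nth (bits w) i)) → length w ≤ W → Codes c w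
    codes {c} w V h le k lt rewrite pair-prefix w | map-++ bit prefix w = go (suc k) refl (region (suc k))
      where
      past : ∀ i → nth (bits prefix ++ bits w) (length prefix + i) ≡ nth (bits w) i
      past i = trans (cong (λ l → nth (bits prefix ++ bits w) (l + i)) (sym (length-map bit prefix))) (nth-++ʳ (bits prefix) (bits w) i)
      valid-at : ∀ {j κ} → kind j ≡ κ → ValidAt c j κ
      valid-at {j} e = subst (ValidAt c j) e (V j)
      go : ∀ j → j ≡ suc k → Region j → c j ≡ plain (nth (bits prefix ++ bits w) k)
      go _ refl (at-prefix _ p) = trans (valid-at (kind-prefix k p)) (cong plain (sym (trans (nth-++ˡ (bits prefix) (bits w) k (subst (k <_) (sym (length-map bit prefix)) p)) (nth-bits prefix k p))))
      go _ e (at-guess i p) with refl ← suc-injective e = trans (h i p) (cong plain (sym (past i)))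
      go _ e (at-blank i p) with refl ← suc-injective e = trans (valid-at (kind-blank i p)) (cong plain (sym (trans (past (W + i)) (nth-end (bits w) (W + i) (≤-trans (≤-reflexive (length-map bit w)) (≤-trans le (m≤m+n W i)))))))
      go _ refl (at-evolve _ p) = ⊥-elim (<-irrefl refl (≤-trans lt p))

    module _ {c : ℕ → Letter} {w : List Bool} (V : Valid c) (cd : Codes c w) (le : length w ≤ W) where

      room : 4 + length (pair x w) + 2 * (T + 5) ≤ u
      room = ≤-trans (+-monoˡ-≤ (2 * (T + 5)) (+-monoʳ-≤ 4 (length-pair w le)))
        (le-by 3 (solve 3 (λ m w t → con 4 :+ (m :* con 2 :+ (w :* con 1 :+ con 2)) :+ con 2 :* (t :+ con 5) :+ con 3 := m :* con 2 :+ (w :+ (t :* con 2 :+ con 19))) refl m W T))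

      open Simulation (pair x w) using (Accepts; module Helix)
      open Helix u T N' c room
        (≤-trans (+-monoˡ-≤ R (+-monoˡ-≤ s (m≤m+n 2 u))) (≤-reflexive (solve 2 (λ t s → s :+ s :+ (t :* s :+ s :* con 3) := (t :+ con 5) :* s) refl T s)))
        (≤-trans (≤-reflexive (solve 2 (λ t s → (t :+ con 3) :* s := t :* s :+ s :* con 3) refl T s)) (m≤n+m R (1 + s)))
        (V 0) cd (λ j le → subst (ValidAt c j) (kind-evolve j le) (V j))
        public using (done⇒accepts; accepts⇒done)

    -- By validity the guessed letters are bits up to the first blank, and blanks from then on.
    decode : ∀ {c} → Valid c → ∀ n i → i + n ≡ W → ∃ λ w → length w ≤ n × (∀ k → k < n → c (g₀ + (i + k)) ≡ plain (nth (bits w) k))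
    decode {c} V zero i e = [] , z≤n , λ _ ()
    decode {c} V (suc n) i e = go (subst (ValidAt c (g₀ + i)) (kind-guess i (subst (_< W) (+-identityʳ i) (i<W 0 (s≤s z≤n)))) (V (g₀ + i)))
      where
      i<W : ∀ k → k < suc n → i + k < W
      i<W k lt = subst (i + k <_) e (+-monoʳ-< i lt)
      cons : ∀ b → c (g₀ + i) ≡ plain (bit b) → ∃ λ w → length w ≤ suc n × (∀ k → k < suc n → c (g₀ + (i + k)) ≡ plain (nth (bits w) k))
      cons b eq with decode {c} V n (suc i) (trans (sym (+-suc i n)) e)
      ... | w , le , h = b ∷ w , s≤s le , λ where
        zero    _        → trans (cong (λ z → c (g₀ + z)) (+-identityʳ i)) eq
        (suc k) (s≤s lt) → trans (cong (λ z → c (g₀ + z)) (+-suc i k)) (h k lt)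
      stays : c (g₀ + i) ≡ B → ∀ k → k < suc n → c (g₀ + (i + k)) ≡ B
      stays eq zero    _  = trans (cong (λ z → c (g₀ + z)) (+-identityʳ i)) eq
      stays eq (suc k) lt = proj₂ (subst (ValidAt c (g₀ + (i + suc k))) (kind-guess (i + suc k) (i<W (suc k) lt)) (V _))
        (trans (cong (λ z → c (z ∸ 1)) (trans (cong (g₀ +_) (+-suc i k)) (+-suc g₀ (i + k)))) (stays eq k (<⇒≤ lt)))
      go : ValidAt c (g₀ + i) guess → ∃ λ w → length w ≤ suc n × (∀ k → k < suc n → c (g₀ + (i + k)) ≡ plain (nth (bits w) k))
      go (inj₁ eq , _)        = cons true eq
      go (inj₂ (inj₁ eq) , _) = cons false eq
      go (inj₂ (inj₂ eq) , _) = [] , z≤n , stays eq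

    module Encode (w : List Bool) where

      choice : ℕ → Letter → Letter
      choice j _ = plain (nth (bits w) (j ∸ g₀))

      open Build choice

      nth-blank : ∀ l i → nth (bits l) i ≡ blank → nth (bits l) (suc i) ≡ blank
      nth-blank []      i       e = refl
      nth-blank (b ∷ l) (suc i) e = nth-blank l i e

      plain-sym : ∀ {a b} → plain {TM.Q M} a ≡ plain b → a ≡ b
      plain-sym refl = refl

      letter : ∀ l i → let v = plain {TM.Q M} (nth (bits l) i) in v ≡ O ⊎ v ≡ Z ⊎ v ≡ B
      letter []          i       = inj₂ (inj₂ refl)
      letter (true ∷ l)  zero    = inj₁ refl
      letter (false ∷ l) zero    = inj₂ (inj₁ refl)
      letter (b ∷ l)     (suc i) = letter l i

      built-guess-at : ∀ i → i < W → built (g₀ + i) ≡ plain (nth (bits w) i)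
      built-guess-at i lt = trans (built-guess {g₀ + i} (kind-guess i lt)) (cong (λ z → plain (nth (bits w) z)) (m+n∸m≡n g₀ i))

      good : Good
      good j π e refl with guess-region j e
      -- The first guess cell comes after the last bit of `prefix`, which is not blank, so nothing
      -- forces it to be blank.
      ... | zero , lt , refl = letter w (g₀ + 0 ∸ g₀) , λ eq → contradiction (trans (sym eq) (trans (cong built last) (built-fixed {suc (suc (length (double x)))} (kind-prefix (suc (length (double x))) (≤-reflexive lp))))) λ ()
        where
        lp : suc (suc (length (double x))) ≡ length prefix
        lp = trans (+-comm 2 _) (sym (length-++ (double x)))
        last : g₀ + 0 ∸ 1 ≡ suc (suc (length (double x)))
        last = trans (+-identityʳ _) (sym lp)
      ... | suc i , lt , refl = letter w (g₀ + suc i ∸ g₀) , λ eq → cong plain (trans (cong (nth (bits w)) (m+n∸m≡n g₀ (suc i)))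
        (nth-blank w i (plain-sym (trans (sym (built-guess-at i (<⇒≤ lt))) (trans (cong built (sym (+-suc (length prefix) i))) eq)))))

      valid-built : Valid built
      valid-built = built-valid good

      codes-built : length w ≤ W → Codes built w
      codes-built le = codes w valid-built built-guess-at le

    cellEnc : Kind Letter → ℕ → List Bool
    cellEnc κ j = catFrom 0 K (λ a → encLocal (cellRule κ j a))

    fixedEnc : Letter → List Bool
    fixedEnc v = catFrom 0 K (λ a → encLocal (fixedRule v a))

    module _ {d : ℕ} (ρ : ℕ → ℕ) where
      open Printer x {d} ρ

      fixedC-prints : ∀ v → ⟦ fixedC {d} v ⟧ x ρ ≡ fixedEnc v
      fixedC-prints v = trans (⟦seqC⟧ x 0 K (λ a → localC (fixedBody v a)) ρ) (catFrom-cong 0 K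
        {λ a → ⟦ localC (fixedBody {d} v a) ⟧ x ρ} {λ a → encLocal (fixedRule v a)} (λ a _ _ → local-prints {fixedBody v a} {fixedRule v a} (if-prints (a ≡ᵇ idx v) zero-prints (var-prints (units 1)))))

      zeroRow-prints : ∀ (r : Fin d) {v} → ρ (toℕ r) ≡ v → ⟦ zeroRow r ⟧ x ρ ≡ replicate (2 + v * K) false
      zeroRow-prints r refl = trans (cong₂ _++_ (⟦units⟧ x {d} 2 false ρ) (⟦for⟧ x r (repeatC K (emit false)) K false ρ (λ i → ⟦units⟧ x K false (ρ [ d ↦ i ]))))
        (replicate-++ 2 (ρ (toℕ r) * K) false)

    module _ (ρ : ℕ → ℕ) where
      open Printer x {9} ρ

      guessC-prints : ∀ i → ρ 0 ≡ m → ρ 8 ≡ i → ⟦ guessC ⟧ x ρ ≡ cellEnc guess (g₀ + i)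
      guessC-prints i e₀ e₈ = trans (⟦seqC⟧ x 0 K (λ a → localC (guessBody a)) ρ) (catFrom-cong 0 K
        {λ a → ⟦ localC (guessBody a) ⟧ x ρ} {λ a → encLocal (guessRule (length prefix + i) a)} (λ a _ _ → local-prints {guessBody a} {guessRule (length prefix + i) a}
        (if-prints (a ≡ᵇ idx O) (disj-prints (now Z) (disj-prints (now B) (before B)))
        (if-prints (a ≡ᵇ idx Z) (disj-prints (now O) (disj-prints (now B) (before B)))
        (if-prints (a ≡ᵇ idx B) (disj-prints (now O) (now Z)) (var-prints (units 1)))))))
        where
        at : ∀ k v → Unary′ (guessU k v) (2 + (idx v + (k + (length prefix + i)) * K))
        at k v = to-unary (trans (solve 5 (λ a k m i c → con 2 :+ a :+ (con 2 :+ k) :* c :+ (m :* (con 2 :* c) :+ i :* c) := con 2 :+ (a :+ (k :+ (m :* con 2 :+ con 2 :+ i)) :* c)) refl (idx v) k m i K)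
            (cong (λ l → 2 + (idx v + (k + (l + i)) * K)) (sym length-prefix)))
          (seq-units (units (2 + idx v + (2 + k) * K)) (seq-units (for-units (# 0) (2 * K) e₀) (for-units (# 8) K e₈)))
        now : ∀ v → Prints (varC (guessU 1 v)) (pvar (vr (suc (length prefix + i)) (idx v)))
        now v = var-prints (at 1 v)
        before : ∀ v → Prints (varC (guessU 0 v)) (pvar (vr (length prefix + i) (idx v)))
        before v = var-prints (at 0 v)

      stepC-prints : ∀ i → ρ 5 ≡ s → ρ 8 ≡ i → ⟦ stepC ⟧ x ρ ≡ cellEnc evolve (2 + s + i)
      stepC-prints i e₅ e₈ = trans (⟦seqC⟧ x 0 K (λ a → localC (windowsC a (proj₁ quads))) ρ) (catFrom-cong 0 K
        {λ a → ⟦ localC (windowsC a (proj₁ quads)) ⟧ x ρ} {λ a → encLocal (stepRule (1 + s + i) (2 + s + i ∸ (2 + s)) a)} (λ a _ _ →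
        trans (local-prints {windowsC a (proj₁ quads)} {stepRule (1 + s + i) i a} (all a (proj₁ quads)))
          (cong (λ d → encLocal (stepRule (1 + s + i) d a)) {i} {2 + s + i ∸ (2 + s)} (sym (m+n∸m≡n (2 + s) i)))))
        where
        prev : ∀ v → Prints (varC (prevU v)) (pvar (vr (1 + s + i) (idx v)))
        prev v = var-prints (to-unary (solve 4 (λ a s i c → con 2 :+ a :+ c :+ (s :* c :+ i :* c) := con 2 :+ (a :+ (con 1 :+ s :+ i) :* c)) refl (idx v) s i K)
          (seq-units (units (2 + idx v + K)) (seq-units (for-units (# 5) K e₅) (for-units (# 8) K e₈))))
        above : ∀ k v → Prints (varC (windowU k v)) (pvar (vr (k + i) (idx v)))
        above k v = var-prints (to-unary (solve 4 (λ a k i c → con 2 :+ a :+ k :* c :+ i :* c := con 2 :+ (a :+ (k :+ i) :* c)) refl (idx v) k i K)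
          (seq-units (units (2 + idx v + k * K)) (for-units (# 8) K e₈)))
        one : ∀ a q → Prints (windowC a q) (window (1 + s + i) i a q)
        one a (π , α , β , γ) = if-prints (idx (F π α β γ) ≡ᵇ a) zero-prints
          (conj-prints (prev π) (conj-prints (above 0 α) (conj-prints (above 1 β) (above 2 γ))))
        all : ∀ a qs → Prints (windowsC a qs) (disjAll (map (window (1 + s + i) i a) qs))
        all a []       = zero-prints
        all a (q ∷ qs) = disj-prints (one a q) (all a qs)

    printedCell : ℕ → List Bool
    printedCell j = cellEnc (kind j) j

    size-N : N ≡ 1 + (length prefix + (W + (E + R)))
    size-N = trans (cong (_+ R) size) (cong suc (trans (+-assoc (length prefix) (W + E) R) (cong (length prefix +_) (+-assoc W E R))))

    module _ (ρ : ℕ → ℕ) (e₀ : ρ 0 ≡ m) (e₁ : ρ 1 ≡ W) (e₄ : ρ 4 ≡ E) (e₅ : ρ 5 ≡ s) (e₆ : ρ 6 ≡ R) (e₇ : ρ 7 ≡ N) where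
      open Printer x {8} ρ

      pairEnc : Bool → List Bool
      pairEnc b = fixedEnc (plain (bit b)) ++ fixedEnc (plain (bit b))

      input-prints : ⟦ for (# 0) inputC ⟧ x ρ ≡ concatMap pairEnc x
      input-prints = trans (cong (λ k → catFrom 0 k step₁) e₀) (catFrom-list 0 x (λ k _ → both k (bitAt x k) refl))
        where
        step₁ : ℕ → List Bool
        step₁ i = ⟦ inputC ⟧ x (ρ [ 8 ↦ i ])
        both : ∀ k b → bitAt x k ≡ b → step₁ k ≡ pairEnc b
        both k true  e rewrite e = cong₂ _++_ (fixedC-prints (ρ [ 8 ↦ k ]) O) (fixedC-prints (ρ [ 8 ↦ k ]) O)
        both k false e rewrite e = cong₂ _++_ (fixedC-prints (ρ [ 8 ↦ k ]) Z) (fixedC-prints (ρ [ 8 ↦ k ]) Z)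

      prefix-region : catFrom 1 (length prefix) printedCell ≡ concatMap pairEnc x ++ (fixedEnc O ++ fixedEnc Z)
      prefix-region = trans (catFrom-list 1 prefix {h = λ b → fixedEnc (plain (bit b))} (λ k lt → cong (λ κ → cellEnc κ (suc k)) (kind-prefix k lt)))
        (trans (concatMap-++ _ (double x) (true ∷ false ∷ [])) (cong₂ _++_ (concatMap-double _ x) (cong (fixedEnc O ++_) (++-identityʳ (fixedEnc Z)))))

      guess-region-prints : ⟦ for (# 1) guessC ⟧ x ρ ≡ catFrom g₀ W printedCell
      guess-region-prints = trans (cong (λ k → catFrom 0 k (λ i → ⟦ guessC ⟧ x (ρ [ 8 ↦ i ]))) e₁)
        (catFrom-shift 0 g₀ W (λ i lt → trans (guessC-prints (ρ [ 8 ↦ i ]) i e₀ refl) (cong (λ κ → cellEnc κ (g₀ + i)) (sym (kind-guess i lt)))))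

      blank-region-prints : ⟦ for (# 4) (fixedC B) ⟧ x ρ ≡ catFrom (g₀ + W) E printedCell
      blank-region-prints = trans (cong (λ k → catFrom 0 k (λ i → ⟦ fixedC {9} B ⟧ x (ρ [ 8 ↦ i ]))) e₄)
        (catFrom-shift 0 (g₀ + W) E (λ i lt → trans (fixedC-prints (ρ [ 8 ↦ i ]) B)
          (cong (λ κ → cellEnc κ (g₀ + W + i)) (sym (trans (cong kind (+-assoc g₀ W i)) (kind-blank i lt))))))

      step-region-prints : ⟦ for (# 6) stepC ⟧ x ρ ≡ catFrom (g₀ + W + E) R printedCell
      step-region-prints = trans (cong (λ k → catFrom 0 k (λ i → ⟦ stepC ⟧ x (ρ [ 8 ↦ i ]))) e₆)
        (catFrom-shift 0 (g₀ + W + E) R (λ i lt → trans (stepC-prints (ρ [ 8 ↦ i ]) i e₅ refl)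
          (trans (cong (λ κ → cellEnc κ (2 + s + i)) (sym (kind-evolve (2 + s + i) (m≤m+n (2 + s) i))))
            (cong printedCell (cong (_+ i) (trans size (sym (+-assoc g₀ W E))))))))

      cells-print : ⟦ cellsC ⟧ x ρ ≡ catFrom 0 N printedCell
      cells-print = trans
        (cong₂ _++_ (fixedC-prints ρ origin) (trans
          (cong₂ _++_ input-prints (cong₂ _++_ (fixedC-prints ρ O) (cong₂ _++_ (fixedC-prints ρ Z)
            (cong₂ _++_ guess-region-prints (cong₂ _++_ blank-region-prints step-region-prints)))))
          (trans (assoc₃ (concatMap pairEnc x) (fixedEnc O) (fixedEnc Z)) (cong (_++ rest) (sym prefix-region)))))
        (sym (trans (cong (λ k → catFrom 0 k printedCell) size-N) (cong (printedCell 0 ++_)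
          (trans (catFrom-+ 1 (length prefix) (W + (E + R)) printedCell) (cong (catFrom 1 (length prefix) printedCell ++_)
            (trans (catFrom-+ g₀ W (E + R) printedCell) (cong (catFrom g₀ W printedCell ++_) (catFrom-+ (g₀ + W) E R printedCell))))))))
        where
        rest : List Bool
        rest = catFrom g₀ W printedCell ++ (catFrom (g₀ + W) E printedCell ++ catFrom (g₀ + W + E) R printedCell)
        assoc₃ : ∀ (a b c : List Bool) → a ++ (b ++ (c ++ rest)) ≡ (a ++ (b ++ c)) ++ rest
        assoc₃ a b c = trans (cong (a ++_) (sym (++-assoc b c rest))) (sym (++-assoc a (b ++ c) rest))

      all-cells : catFrom 2 (N * K) (encLocal ∘ ψ) ≡ catFrom 0 N printedCell
      all-cells = trans (catFrom-* 2 0 N K (encLocal ∘ ψ)) (catFrom-cong 0 N (λ j _ _ → catFrom-cong 0 K (λ a _ lt → cong encLocal (ψ-vr j lt))))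

      dim-prints : ⟦ dimC ⟧ x ρ ≡ encℕ n
      dim-prints = trans (cong (λ z → true ∷ true ∷ z ++ false ∷ []) (Unary′.unary (for-units (# 7) K e₇))) refl

      acc-prints : ⟦ accC ⟧ x ρ ≡ encLocal (ψ 0)
      acc-prints = local-prints {varC (ones (2 + idx done + K) ⨾ for (# 5) (ones K) ⨾ for (# 6) (ones K))} {pvar (vr N' (idx done))} (var-prints (to-unary
        (solve 4 (λ a s r c → con 2 :+ a :+ c :+ (s :* c :+ r :* c) := con 2 :+ (a :+ (con 1 :+ s :+ r) :* c)) refl (idx done) s R K)
        (seq-units (units (2 + idx done + K)) (seq-units (for-units (# 5) K e₅) (for-units (# 6) K e₆)))))

      one-prints : ⟦ oneC ⟧ x ρ ≡ encLocal (ψ 1)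
      one-prints = local-prints {varC skip} {pvar 0} zero-prints

      tail-prints : ⟦ tailC ⟧ x ρ ≡ replicate (n * n) false ++ replicate n false
      tail-prints = cong₂ _++_ (trans (cong₂ _++_ row₀ (cong₂ _++_ row₀ rows))
          (trans (cong (replicate n false ++_) (replicate-++ n (N * (K * n)) false)) (trans (replicate-++ n (n + N * (K * n)) false)
            (cong (λ k → replicate (n + (n + k)) false) (sym (*-assoc N K n)))))) row₀
        where
        row₀ : ⟦ zeroRow {8} (# 7) ⟧ x ρ ≡ replicate n false
        row₀ = zeroRow-prints ρ (# 7) e₇
        rows : ⟦ for {8} (# 7) (repeatC K (zeroRow {9} (# 7))) ⟧ x ρ ≡ replicate (N * (K * n)) false
        rows = trans (⟦for⟧ x {8} (# 7) (repeatC K (zeroRow {9} (# 7))) (K * n) false ρ (λ i → ⟦repeatC⟧ x K (zeroRow {9} (# 7)) (zeroRow-prints {9} (ρ [ 8 ↦ i ]) (# 7) e₇)))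
          (cong (λ v → replicate (v * (K * n)) false) e₇)

      main-prints : ⟦ dimC ⨾ accC ⨾ oneC ⨾ cellsC ⨾ tailC ⟧ x ρ ≡ encInstance instance′
      main-prints = trans
        (cong₂ _++_ dim-prints (cong₂ _++_ acc-prints (cong₂ _++_ one-prints (cong₂ _++_ (trans cells-print (sym all-cells)) tail-prints))))
        (sym (trans (enc-instance (suc (N * K)) ψ bounded) (cong (encℕ n ++_)
          (trans (++-assoc (encLocal (ψ 0)) (encLocal (ψ 1) ++ cs) zs) (cong (encLocal (ψ 0) ++_) (++-assoc (encLocal (ψ 1)) cs zs))))))
        where
        cs zs : List Bool
        cs = catFrom 2 (N * K) (encLocal ∘ ψ)
        zs = replicate (n * n) false ++ replicate n false

    program-prints : ⟦ program ⟧ᴾ x (inputEnv x) ≡ encInstance instance′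
    program-prints = main-prints ρ₇ refl e₁ e₄ e₅ e₆ e₇
      where
      ρ₁ = inputEnv x [ 1 ↦ length (⟦ defW ⟧ x (inputEnv x)) ]
      ρ₂ = ρ₁ [ 2 ↦ length (⟦ defU ⟧ x ρ₁) ]
      ρ₃ = ρ₂ [ 3 ↦ length (⟦ defT ⟧ x ρ₂) ]
      ρ₄ = ρ₃ [ 4 ↦ length (⟦ defE ⟧ x ρ₃) ]
      ρ₅ = ρ₄ [ 5 ↦ length (⟦ defS ⟧ x ρ₄) ]
      ρ₆ = ρ₅ [ 6 ↦ length (⟦ defR ⟧ x ρ₅) ]
      ρ₇ = ρ₆ [ 7 ↦ length (⟦ defN ⟧ x ρ₆) ]
      e₁ : length (⟦ defW ⟧ x (inputEnv x)) ≡ W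
      e₁ = length-unary (seq-units (pow-unary cW (# 0)) (units cW))
        where open Printer x {1} (inputEnv x)
      e₂ : length (⟦ defU ⟧ x ρ₁) ≡ U
      e₂ = length-unary (seq-units (for-units (# 0) 2 refl) (seq-units (for-units (# 1) 1 e₁) (units 2)))
        where open Printer x {2} ρ₁
      e₃ : length (⟦ defT ⟧ x ρ₂) ≡ T
      e₃ = trans (length-unary (seq-units (pow-unary cV (# 2)) (units cV))) (cong (λ v → v ^ cV + cV) e₂)
        where open Printer x {3} ρ₂
      e₄ : length (⟦ defE ⟧ x ρ₃) ≡ E
      e₄ = length-unary (seq-units (for-units (# 3) 2 e₃) (units 20))
        where open Printer x {4} ρ₃
      e₅ : length (⟦ defS ⟧ x ρ₄) ≡ s
      e₅ = trans (length-unary (seq-units (units 2) (seq-units (for-units (# 0) 2 refl) (seq-units (for-units (# 1) 1 e₁) (seq-units (for-units (# 3) 2 e₃) (units 19))))))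
        (cong (λ w → 2 + (m * 2 + (w + (T * 2 + 19)))) (*-identityʳ W))
        where open Printer x {5} ρ₄
      e₆ : length (⟦ defR ⟧ x ρ₅) ≡ R
      e₆ = length-unary (seq-units (mkUnary {for (# 3) (for (# 5) (ones 1))} rows) (for-units (# 5) 3 e₅))
        where
        open Printer x {6} ρ₅
        rows : ⟦ for {6} (# 3) (for (# 5) (ones 1)) ⟧ x ρ₅ ≡ replicate (T * s) true
        rows = trans (⟦for⟧ x {6} (# 3) (for (# 5) (ones 1)) s true ρ₅ (λ i → trans (⟦for⟧ x {7} (# 5) (ones 1) 1 true (ρ₅ [ 6 ↦ i ]) (λ j → refl))
          (cong (λ v → replicate v true) (trans (*-identityʳ _) e₅)))) (cong (λ v → replicate (v * s) true) e₃)
      e₇ : length (⟦ defN ⟧ x ρ₆) ≡ N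
      e₇ = trans (length-unary (seq-units (units 2) (seq-units (for-units (# 5) 1 e₅) (for-units (# 6) 1 e₆))))
        (cong₂ (λ a b → 2 + (a + b)) (*-identityʳ s) (*-identityʳ R))
        where open Printer x {7} ρ₆

    decoded : ∀ {c} → Valid c → c N' ≡ done → ∃ λ w → length w ≤ W × ∃ (Simulation.Accepts (pair x w))
    decoded {c} V e = let w , le , h = decode {c} V W 0 refl in w , le , done⇒accepts {c} {w} V (codes {c} w V h le) le e

    trapped⇒rejected : ∀ w t → length w ≤ W → t ≤ T → Simulation.Accepts (pair x w) t → ¬ InMinTrap instance′
    trapped⇒rejected w t le le' acc = accepting⇒¬InMinTrap built valid-built (accepts⇒done valid-built (codes-built le) le t le' acc)
      where
      open Encode w
      open Build choice using (built)

    rejected⇒trapped : (∀ w t → length w ≤ W → ¬ Simulation.Accepts (pair x w) t) → InMinTrap instance′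
    rejected⇒trapped none = noReset⇒InMinTrap λ H T reset →
      let w , le , t , acc = decoded {FromTrap.c H T reset} (FromTrap.valid H T reset) (FromTrap.accepts H T reset) in none w t le acc

theorem5 : IN-MINTRAP-coNP-hard
theorem5 L (L' , (V , (M , cV , decides) , cW , L'-spec) , L-spec) =
  (λ x → ⟦ program ⟧ᴾ x (inputEnv x)) , Prog-polyTime program , For.instance′ , λ x →
    sym (For.program-prints x) , For.promise x , mk⇔ (yes-instance x) (no-instance x)
  where
  open Reduction M cV cW

  Accepts : List Bool → List Bool → ℕ → Set
  Accepts x w = Automaton.Simulation.Accepts M (pair x w)

  time : List Bool → List Bool → ℕ
  time x w = poly cV (length (pair x w))

  -- The cells show acceptance at some time t, which need not be the time bound in `decides`;
  -- `accepts-at` reconciles the two.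
  accepts⇒V : ∀ x w t → Accepts x w t → V (pair x w) ≡ true ∷ []
  accepts⇒V x w t acc = trans (sym (proj₂ (decides (pair x w))))
    (Automaton.Simulation.accepts-at M (pair x w) (time x w) t (proj₁ (decides (pair x w))) acc)

  V⇒accepts : ∀ x w → V (pair x w) ≡ true ∷ [] → Accepts x w (time x w)
  V⇒accepts x w e = proj₁ (decides (pair x w)) , trans (proj₂ (decides (pair x w))) e

  time-≤ : ∀ x w → length w ≤ For.W x → time x w ≤ For.T x
  time-≤ x w le = +-monoˡ-≤ cV (^-monoˡ-≤ cV (For.length-pair x w le))

  yes-instance : ∀ x → L x → InMinTrap (For.instance′ x)
  yes-instance x l = For.rejected⇒trapped x λ w t le acc →
    Equivalence.to (L-spec x) l (Equivalence.from (L'-spec x) (w , le , accepts⇒V x w t acc))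

  no-instance : ∀ x → InMinTrap (For.instance′ x) → L x
  no-instance x trapped = Equivalence.from (L-spec x) λ l' →
    let w , le , e = Equivalence.to (L'-spec x) l' in
    For.trapped⇒rejected x w (time x w) le (time-≤ x w le) (V⇒accepts x w e) trapped
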